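{- For every tree poset $P$ of height $k$, real $\varepsilon>0$ and positive integer $\ell$, there exists $\delta=\delta(\varepsilon,P,\ell)>0$ such that the following holds. Let $n$ be sufficiently large and let $\mathcal{F}\subseteq\widetilde{\mathcal{B}}_n$ be $\ell$-gapped with $|\mathcal{F}|\ge(k-1+\varepsilon)\binom{n}{n/2}$. Then there is a collection $\mathcal{H}$ of induced copies of $P$ in $\mathcal{F}$ satisfying (1) $|\mathcal{H}|\ge\delta^{|P|}n^{\ell(|P|-1)}\binom{n}{n/2}$; (2) $\Delta_j(\mathcal{H})\le(\delta n^\ell)^{|P|-j}$ for all $1\le j\le|P|$.
   Context: $\mathcal{B}_n$ is the power set of $[n]$; $\widetilde{\mathcal{B}}_n=\{F:||F|-n/2|<2\sqrt{n\ln n}\}$; $\binom{n}{n/2}$ means $\binom{n}{\lfloor n/2\rfloor}$. An induced copy of $P$ in $\mathcal{F}$ is the image of an injective map $\varphi:P\to\mathcal{F}$ with $\varphi(x)\subsetneq\varphi(y)$ iff $x<_Py$. $P$ is a tree poset if its Hasse diagram (as an undirected graph) is a tree; the height is the maximum size of a chain. $\mathcal{F}$ is $\ell$-gapped if $|G\setminus F|\ge\ell$ whenever $F\subsetneq G$ in $\mathcal{F}$. A collection $\mathcal{H}$ of induced copies is viewed as a $|P|$-uniform hypergraph on vertex set $\mathcal{F}$ whose edges are the copies; $\deg_{\mathcal{H}}(\mathcal{D})$ is the number of edges containing $\mathcal{D}$ and $\Delta_j(\mathcal{H})=\max_{|\mathcal{D}|=j}\deg_{\mathcal{H}}(\mathcal{D})$.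 -}

module Defs where

open import Data.Nat as ℕ using (ℕ; zero; suc; _∸_; ∣_-_∣)
open import Data.Bool using (Bool; true; false; _∧_; _∨_)
import Data.Bool as Bool
open import Data.Integer using (+_)
open import Data.Rational as ℚ using (ℚ; _/_; 1ℚ)
open import Data.Fin using (Fin)
open import Data.Fin.Subset using (Subset; _⊂_; ∣_∣; _─_)
open import Data.List using (List; []; _∷_; length; tabulate; filterᵇ)
open import Data.Bool.ListAction using (all; any)
open import Data.List.Membership.Propositional using (_∈_)
open import Data.List.Relation.Unary.All using (All)
open import Data.List.Relation.Unary.AllPairs using (AllPairs)
open import Data.List.Relation.Unary.Linked using (Linked)
open import Data.List.Relation.Unary.Unique.Propositional using (Unique)
open import Data.Vec.Properties using (≡-dec)
open import Data.Product using (Σ; ∃; ∃-syntax; _×_; _,_)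
open import Data.Sum using (_⊎_)
open import Relation.Nullary using (¬_; does)
open import Relation.Binary.PropositionalEquality using (_≡_)
open import Relation.Binary.Structures using (IsStrictPartialOrder)
open import Function.Definitions using (Injective)
open import Function.Bundles using (_⇔_)

ℕ→ℚ : ℕ → ℚ
ℕ→ℚ n = + n / 1

_^ℚ_ : ℚ → ℕ → ℚ
q ^ℚ zero  = 1ℚ
q ^ℚ suc k = q ℚ.* (q ^ℚ k)

module _ {m : ℕ} (_<P_ : Fin m → Fin m → Set) where

  Covers : Fin m → Fin m → Set
  Covers x y = x <P y × ¬ (∃[ z ] (x <P z × z <P y))

  HasseAdj : Fin m → Fin m → Set
  HasseAdj x y = Covers x y ⊎ Covers y x

  data HasseWalk : Fin m → Fin m → List (Fin m) → Set where
    here : ∀ x → HasseWalk x x (x ∷ [])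
    step : ∀ {x y z vs} → HasseAdj x y → HasseWalk y z vs → HasseWalk x z (x ∷ vs)

  HassePath : Fin m → Fin m → List (Fin m) → Set
  HassePath x y vs = HasseWalk x y vs × Unique vs

  IsTreePoset : Set
  IsTreePoset =
    (1 ℕ.≤ m)
    × (∀ x y → ∃[ vs ] HassePath x y vs)
    × (∀ x y vs ws → HassePath x y vs → HassePath x y ws → vs ≡ ws)

  IsChain : List (Fin m) → Set
  IsChain = Linked _<P_

  HasHeight : ℕ → Set
  HasHeight k =
    (∃[ cs ] (IsChain cs × length cs ≡ k))
    × (∀ cs → IsChain cs → length cs ℕ.≤ k)

_≟ₛ_ : ∀ {n} (s t : Subset n) → _
_≟ₛ_ = ≡-dec Bool._≟_

_∈ᵇ_ : ∀ {n} → Subset n → List (Subset n) → Bool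
s ∈ᵇ xs = any (λ t → does (s ≟ₛ t)) xs

-- central window  B̃ₙ = { F : | |F| - n/2 | < 2 √(n ln n) }.
-- With d = |2|F| - n|, for n ≥ 1 this says d² < 16 n ln n, i.e.
-- exp(q) < n with q = d²/(16n).  Since (1 - q/N)^(-N) decreases strictly
-- to exp(q) for integers N > q, this holds iff for some N > q,
-- N^N < n (N - q)^N, i.e. (clearing denominators)
-- d² < 16nN and (16nN)^N < n (16nN - d²)^N.
InWindow : (n : ℕ) → Subset n → Set
InWindow n s =
  ∃[ N ] (d2 ℕ.< M N × (M N) ℕ.^ N ℕ.< n ℕ.* ((M N ∸ d2) ℕ.^ N))
  where
    d : ℕ
    d = ∣ 2 ℕ.* ∣ s ∣ - n ∣
    d2 : ℕ
    d2 = d ℕ.* d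
    M : ℕ → ℕ
    M N = 16 ℕ.* n ℕ.* N

-- a family F ⊆ B̃ₙ given as a duplicate-free list of subsets
-- ℓ-gapped:  F ⊊ G in 𝓕  ⇒  |G ∖ F| ≥ ℓ
IsGapped : ∀ {n} → ℕ → List (Subset n) → Set
IsGapped ℓ 𝓕 = ∀ {F G} → F ∈ 𝓕 → G ∈ 𝓕 → F ⊂ G → ℓ ℕ.≤ ∣ G ─ F ∣

IsInducedCopy : ∀ {m n} (_<P_ : Fin m → Fin m → Set) →
                List (Subset n) → (Fin m → Subset n) → Set
IsInducedCopy _<P_ 𝓕 φ =
  Injective _≡_ _≡_ φ
  × (∀ x → φ x ∈ 𝓕)
  × (∀ x y → (φ x ⊂ φ y) ⇔ (x <P y))

-- the copy itself (a hyperedge) is the image of φ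
image : ∀ {m n} → (Fin m → Subset n) → List (Subset n)
image φ = tabulate φ

SameCopy : ∀ {m n} → (Fin m → Subset n) → (Fin m → Subset n) → Set
SameCopy φ ψ = ∀ s → (s ∈ image φ) ⇔ (s ∈ image ψ)

-- a collection 𝓗 of induced copies, given by maps whose images are
-- pairwise distinct (so |𝓗| = length)
IsCopyCollection : ∀ {m n} (_<P_ : Fin m → Fin m → Set) →
                   List (Subset n) → List (Fin m → Subset n) → Set
IsCopyCollection _<P_ 𝓕 𝓗 =
  All (IsInducedCopy _<P_ 𝓕) 𝓗 × AllPairs (λ φ ψ → ¬ SameCopy φ ψ) 𝓗

deg : ∀ {m n} → List (Fin m → Subset n) → List (Subset n) → ℕ
deg 𝓗 𝓓 = length (filterᵇ (λ φ → all (λ s → s ∈ᵇ image φ) 𝓓) 𝓗)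

-- Copies are added greedily.  Put δ = 1/D and b = ⌊n^ℓ/D⌋, and keep deg 𝓓 ≤ b^(m-|𝓓|) for all nonempty
-- 𝓓; call 𝓓 saturated when equality holds.  While the collection is smaller than required, double counting
-- leaves few saturated single sets, so removing them keeps |𝓕| large, and any unsaturated 𝓓 becomes
-- saturated by adding one of at most m b sets.  It therefore suffices to embed P while avoiding, at each
-- step, O(b) forbidden sets.
--
-- For this take a uniformly random maximal chain M of subsets of [n].  By the LYM argument M meets 𝓕 in
-- k - 1 + ε members on average, so there are many windows of k consecutive members of M ∩ 𝓕.  Repeatedly
-- deleting the windows whose i-th member F occurs there for too small a fraction of the chains through F
-- leaves a nonempty collection, in which every F "alive" at level i sees, for every j ≠ i, a set alive
-- at level j on a constant fraction of the chains through F.  A random chain through F rarely meets the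
-- wrong sets: a given gapped set has probability O(n^-ℓ), and being comparable to a given member of 𝓕
-- not forced to be comparable has probability O(w/n), where w = o(n) bounds the width of the window.
-- So a tree poset can be embedded vertex by vertex along its Hasse diagram, sending rank i to level i.
module Submission where

open import Defs
open import Data.Bool using (true; false; _∧_; _∨_)
open import Data.Bool.ListAction using (all)
open import Data.Empty using () renaming (⊥ to Absurd)
open import Data.Fin using (Fin; zero; suc; fromℕ<)
open import Data.Fin.Induction using (spo-wellFounded; spo-noetherian)
import Data.Fin.Properties as Finₚ
open import Data.Fin.Subset using (Subset; inside; outside; ⊥; ⊤; ∣_∣; _⊆_; _⊂_; _⊈_)
import Data.Fin.Subset as S
open import Data.Fin.Subset.Properties
import Data.Integer as ℤ
import Data.Integer.Properties as ℤₚ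
open import Data.List using (List; []; _∷_; map; _++_; concatMap; filter; length; upTo; allFin)
open import Data.List.Membership.Propositional using (_∈_; _∉_; find; lose)
open import Data.List.Membership.Propositional.Properties
open import Data.List.Properties using (length-++; length-map; length-tabulate)
import Data.List.Properties as Listₚ
open import Data.List.Relation.Unary.All as All using (All; []; _∷_)
import Data.List.Relation.Unary.All.Properties as Allₚ
open import Data.List.Relation.Unary.AllPairs as AllPairs using (AllPairs; []; _∷_)
import Data.List.Relation.Unary.AllPairs.Properties as AllPairsₚ
open import Data.List.Relation.Unary.Any as Any using (Any; here; there)
open import Data.List.Relation.Unary.Linked using (Linked; []; [-]; _∷_)
import Data.List.Relation.Unary.Linked.Properties as Linkedₚ
open import Data.List.Relation.Unary.Unique.Propositional using (Unique)
import Data.List.Relation.Unary.Unique.Propositional.Properties as Uniqueₚ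
open import Data.Nat hiding (_/_; _%_)
open import Data.Nat.Combinatorics using (_C_; nCk≡n!/k![n-k]!; k![n∸k]!∣n!)
import Data.Nat.Coprimality as Coprimality
open import Data.Nat.DivMod using (_/_; _%_; m≡m%n+[m/n]*n; m%n<n; m/n*n≤m; m/n*n≡m; m*n/n≡m; /-monoˡ-≤; m≥n⇒m/n>0)
open import Data.Nat.Properties
open import Data.Nat.Tactic.RingSolver using (solve-∀)
open import Data.Product using (∃; ∃-syntax; _×_; _,_; proj₁; proj₂)
open import Data.Rational using (ℚ)
import Data.Rational as ℚ
import Data.Rational.Properties as ℚₚ
open import Data.Rational.Unnormalised using (mkℚᵘ)
import Data.Rational.Unnormalised as ℚᵘ
import Data.Rational.Unnormalised.Properties as ℚᵘₚ
open import Data.Sum using (_⊎_; inj₁; inj₂; [_,_]′)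
open import Data.Unit using () renaming (⊤ to Unit)
open import Data.Vec using ([]; _∷_; _[_]≔_; here; there)
open import Function using (_∘_; case_of_)
open import Function.Bundles using (mk⇔; module Equivalence)
open import Induction.WellFounded using (Acc; acc)
open import Relation.Binary.PropositionalEquality
open import Relation.Binary.Structures using (IsStrictPartialOrder)
open import Relation.Nullary
open import Relation.Nullary.Decidable using (decidable-stable)
open import Relation.Unary using (Decidable)

-- Finite sums and pruning

-- Probabilities are counts of maximal chains: `n !` in all and `N F = ∣ F ∣ ! * (n ∸ ∣ F ∣) !`
-- through `F`. A rare event at `F` is thus an inequality between a sum of indicators and a multiple
-- of `N F`, with all divisions cleared. The constants depend on each other in the order `e`, `h`,
-- `K`, `D`. Here `1/e` is at most half of ε; the other half pays for the saturated sets. Pruning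
-- leaves every live set at least a fraction `1/h` of its chains, so all events to be avoided must
-- together have probability below `1/h`. Of the central window only a width `n / K` with constant
-- `K` is used: one unwanted comparability then has probability at most `6/K`, and at most `m` of
-- them occur. Finally `D` makes `b` so small that the `2 ^ m * (m * b)` forbidden sets, each met
-- with probability at most `3 ^ ℓ * ℓ !` over `n ^ ℓ`, are affordable too. The tree hypothesis
-- makes one conditioning per vertex enough: a new vertex has a single Hasse neighbour `p` among
-- those already placed, and every relation it must satisfy follows from the one with `p`. All other
-- placed sets only have to be incomparable to it.

variable
  A B P Q : Set
  n : ℕ

^-distribʳ-* : ∀ ℓ a b → (a * b) ^ ℓ ≡ a ^ ℓ * b ^ ℓ
^-distribʳ-* zero a b = refl
^-distribʳ-* (suc ℓ) a b = trans (cong (a * b *_) (^-distribʳ-* ℓ a b)) (f a b (a ^ ℓ) (b ^ ℓ))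
  where
  f : ∀ a b c d → a * b * (c * d) ≡ a * c * (b * d)
  f = solve-∀

⟦_⟧ : Dec P → ℕ
⟦ yes _ ⟧ = 1
⟦ no  _ ⟧ = 0

⟦⟧-mono : (p : Dec P) (q : Dec Q) → (P → Q) → ⟦ p ⟧ ≤ ⟦ q ⟧
⟦⟧-mono (yes p) (yes q) f = ≤-refl
⟦⟧-mono (yes p) (no ¬q) f = contradiction (f p) ¬q
⟦⟧-mono (no ¬p) q       f = z≤n

⟦⟧-cong : (p : Dec P) (q : Dec Q) → (P → Q) → (Q → P) → ⟦ p ⟧ ≡ ⟦ q ⟧
⟦⟧-cong p q f g = ≤-antisym (⟦⟧-mono p q f) (⟦⟧-mono q p g)

⟦⟧-yes : (p : Dec P) → P → ⟦ p ⟧ ≡ 1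
⟦⟧-yes (yes _) _ = refl
⟦⟧-yes (no ¬p) p = contradiction p ¬p

⟦⟧-no : (p : Dec P) → ¬ P → ⟦ p ⟧ ≡ 0
⟦⟧-no (yes p) ¬p = contradiction p ¬p
⟦⟧-no (no _)  _  = refl

⟦⟧≤1 : (p : Dec P) → ⟦ p ⟧ ≤ 1
⟦⟧≤1 (yes _) = ≤-refl
⟦⟧≤1 (no  _) = z≤n

⟦⟧-⊎ : {R : Set} (p : Dec P) (q : Dec Q) (r : Dec R) → (P → Q ⊎ R) → ⟦ p ⟧ ≤ ⟦ q ⟧ + ⟦ r ⟧
⟦⟧-⊎ (no _) q r f = z≤n
⟦⟧-⊎ (yes p) q r f with f p
... | inj₁ x = ≤-trans (≤-reflexive (sym (⟦⟧-yes q x))) (m≤m+n _ _)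
... | inj₂ y = ≤-trans (≤-reflexive (sym (⟦⟧-yes r y))) (m≤n+m _ ⟦ q ⟧)

∑ : List A → (A → ℕ) → ℕ
∑ []       f = 0
∑ (x ∷ xs) f = f x + ∑ xs f

∑-mono : ∀ (xs : List A) {f g : A → ℕ} → (∀ {x} → x ∈ xs → f x ≤ g x) → ∑ xs f ≤ ∑ xs g
∑-mono []       h = z≤n
∑-mono (x ∷ xs) h = +-mono-≤ (h (here refl)) (∑-mono xs (h ∘ there))

∑-cong : ∀ (xs : List A) {f g : A → ℕ} → (∀ {x} → x ∈ xs → f x ≡ g x) → ∑ xs f ≡ ∑ xs g
∑-cong []       h = refl
∑-cong (x ∷ xs) h = cong₂ _+_ (h (here refl)) (∑-cong xs (h ∘ there))

∑-zero : ∀ (xs : List A) {f : A → ℕ} → (∀ {x} → x ∈ xs → f x ≡ 0) → ∑ xs f ≡ 0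
∑-zero []       h = refl
∑-zero (x ∷ xs) h = cong₂ _+_ (h (here refl)) (∑-zero xs (h ∘ there))

∑-const : ∀ (xs : List A) c → ∑ xs (λ _ → c) ≡ length xs * c
∑-const []       c = refl
∑-const (x ∷ xs) c = cong (c +_) (∑-const xs c)

∑-+ : ∀ (xs : List A) (f g : A → ℕ) → ∑ xs (λ x → f x + g x) ≡ ∑ xs f + ∑ xs g
∑-+ []       f g = refl
∑-+ (x ∷ xs) f g = trans (cong ((f x + g x) +_) (∑-+ xs f g)) (lemma (f x) (g x) (∑ xs f) (∑ xs g))
  where
  lemma : ∀ a b c d → (a + b) + (c + d) ≡ (a + c) + (b + d)
  lemma = solve-∀

∑-*ʳ : ∀ (xs : List A) (f : A → ℕ) c → ∑ xs (λ x → f x * c) ≡ ∑ xs f * c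
∑-*ʳ []       f c = refl
∑-*ʳ (x ∷ xs) f c = trans (cong (f x * c +_) (∑-*ʳ xs f c)) (sym (*-distribʳ-+ c (f x) (∑ xs f)))

∑-*ˡ : ∀ (xs : List A) (f : A → ℕ) c → ∑ xs (λ x → c * f x) ≡ c * ∑ xs f
∑-*ˡ xs f c = trans (∑-cong xs λ {x} _ → *-comm c (f x)) (trans (∑-*ʳ xs f c) (*-comm _ c))

∑-++ : ∀ (xs ys : List A) (f : A → ℕ) → ∑ (xs ++ ys) f ≡ ∑ xs f + ∑ ys f
∑-++ []       ys f = refl
∑-++ (x ∷ xs) ys f = trans (cong (f x +_) (∑-++ xs ys f)) (sym (+-assoc (f x) _ _))

∑-map : ∀ (g : A → B) (xs : List A) (f : B → ℕ) → ∑ (map g xs) f ≡ ∑ xs (f ∘ g)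
∑-map g []       f = refl
∑-map g (x ∷ xs) f = cong (f (g x) +_) (∑-map g xs f)

∑-concatMap : ∀ (g : A → List B) (xs : List A) (f : B → ℕ) →
              ∑ (concatMap g xs) f ≡ ∑ xs (λ x → ∑ (g x) f)
∑-concatMap g []       f = refl
∑-concatMap g (x ∷ xs) f =
  trans (∑-++ (g x) (concatMap g xs) f) (cong (∑ (g x) f +_) (∑-concatMap g xs f))

∑-swap : ∀ (xs : List A) (ys : List B) (f : A → B → ℕ) →
         ∑ xs (λ x → ∑ ys (f x)) ≡ ∑ ys (λ y → ∑ xs (λ x → f x y))
∑-swap []       ys f = sym (∑-zero ys (λ _ → refl))
∑-swap (x ∷ xs) ys f =
  trans (cong (∑ ys (f x) +_) (∑-swap xs ys f)) (sym (∑-+ ys (f x) _))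

∑-∈ : ∀ {xs : List A} (f : A → ℕ) {x} → x ∈ xs → f x ≤ ∑ xs f
∑-∈ f (here refl) = m≤m+n _ _
∑-∈ {xs = y ∷ _} f (there i)   = ≤-trans (∑-∈ f i) (m≤n+m _ (f y))

length≡∑ : ∀ (xs : List A) → length xs ≡ ∑ xs (λ _ → 1)
length≡∑ xs = sym (trans (∑-const xs 1) (*-identityʳ _))

length-filter≡∑ : ∀ {P : A → Set} (P? : Decidable P) (xs : List A) →
                  length (filter P? xs) ≡ ∑ xs (λ x → ⟦ P? x ⟧)
length-filter≡∑ P? []       = refl
length-filter≡∑ P? (x ∷ xs) with P? x
... | yes _ = cong suc (length-filter≡∑ P? xs)
... | no  _ = length-filter≡∑ P? xs

∑-filter : ∀ {P : A → Set} (P? : Decidable P) (xs : List A) (f : A → ℕ) →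
           ∑ (filter P? xs) f ≡ ∑ xs (λ x → ⟦ P? x ⟧ * f x)
∑-filter P? []       f = refl
∑-filter P? (x ∷ xs) f with P? x
... | yes _ = cong₂ _+_ (sym (+-identityʳ (f x))) (∑-filter P? xs f)
... | no  _ = ∑-filter P? xs f

length-filter-not : ∀ {P : A → Set} (P? : Decidable P) (xs : List A) →
                    length (filter P? xs) + length (filter (¬? ∘ P?) xs) ≡ length xs
length-filter-not P? []       = refl
length-filter-not P? (x ∷ xs) with P? x
... | yes _ = cong suc (length-filter-not P? xs)
... | no  _ = trans (+-suc _ _) (cong suc (length-filter-not P? xs))

-- The union bound, for indicators.
⟦any⟧≤∑ : ∀ {P : A → Set} (P? : Decidable P) (xs : List A) (q : Dec Q) →
          (Q → Any P xs) → ⟦ q ⟧ ≤ ∑ xs (λ x → ⟦ P? x ⟧)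
⟦any⟧≤∑ P? xs (no _)  f = z≤n
⟦any⟧≤∑ P? xs (yes q) f = go (f q)
  where
  go : ∀ {xs} → Any _ xs → 1 ≤ ∑ xs (λ x → ⟦ P? x ⟧)
  go {x ∷ _} (here px) = ≤-trans (≤-reflexive (sym (⟦⟧-yes (P? x) px))) (m≤m+n _ _)
  go {x ∷ _} (there i) = ≤-trans (go i) (m≤n+m _ ⟦ P? x ⟧)

-- Pigeonhole: the place of `x` in `ys` is cut out before the recursion, and uniqueness keeps the
-- other members of `xs` away from it.
length-∈-mono : ∀ {xs ys : List A} → Unique xs → (∀ {x} → x ∈ xs → x ∈ ys) → length xs ≤ length ys
length-∈-mono {xs = []} _ _ = z≤n
length-∈-mono {xs = x ∷ xs} (x∉ ∷ u) f with ∈-∃++ (f (here refl))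
... | as , bs , refl =
  ≤-trans (s≤s (length-∈-mono u g)) (≤-reflexive (sym (length-mid as)))
  where
  length-mid : ∀ as → length (as ++ x ∷ bs) ≡ suc (length (as ++ bs))
  length-mid []       = refl
  length-mid (_ ∷ as) = cong suc (length-mid as)
  g : ∀ {y} → y ∈ xs → y ∈ as ++ bs
  g {y} y∈ with ∈-++⁻ as (f (there y∈))
  ... | inj₁ i = ∈-++⁺ˡ i
  ... | inj₂ (here refl) = contradiction refl (All.lookup x∉ y∈)
  ... | inj₂ (there i) = ∈-++⁺ʳ as i

-- Deleting, one vertex at a time, the edges through a vertex of too small positive degree.
-- The budget h * |edges| > Σ w guarantees that some edge survives.
module _ {E V : Set} {_∋_ : E → V → Set} (_∋?_ : ∀ e v → Dec (e ∋ v)) (h : ℕ) (w : V → ℕ) where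

  -- The edge `e` makes the demand conditional: a vertex that has lost all its edges is exempt.
  Rich : List E → List V → Set
  Rich es vs = ∀ {v} → v ∈ vs → ∀ {e} → e ∈ es → e ∋ v → w v ≤ h * ∑ es (λ e → ⟦ e ∋? v ⟧)

  -- Edges occur with multiplicity, since one window can come from many chains, so the survivors
  -- must form a sub-multiset. The comparison of sums for every `f` records this; membership alone
  -- would not.
  prune : ∀ N vs → length vs ≤ N → ∀ es → ∑ vs w < h * length es →
          ∃[ es′ ] ((∃[ e ] e ∈ es′) × (∀ f → ∑ es′ f ≤ ∑ es f)
                    × (∀ {e} → e ∈ es′ → e ∈ es) × Rich es′ vs)
  prune N vs ≤N es budget
    with Any.any? (λ v → Any.any? (_∋? v) es ×-dec (h * ∑ es (λ e → ⟦ e ∋? v ⟧) <? w v)) vs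
  prune N vs ≤N es budget | no ¬bad =
    es , nonempty es budget , (λ _ → ≤-refl) , (λ i → i) , rich
    where
    nonempty : ∀ es → ∑ vs w < h * length es → ∃[ e ] e ∈ es
    nonempty []      b = contradiction (subst (∑ vs w <_) (*-zeroʳ h) b) (λ ())
    nonempty (e ∷ _) b = e , here refl
    rich : Rich es vs
    rich v∈ e∈ e∋v = ≮⇒≥ λ lt → ¬bad (lose v∈ (lose e∈ e∋v , lt))
  prune N vs ≤N es budget | yes bad with find bad
  ... | v , v∈ , _ , few with ∈-∃++ v∈
  prune zero    _ () es budget | yes bad | v , v∈ , _ , few | []     , bs , refl
  prune zero    _ () es budget | yes bad | v , v∈ , _ , few | _ ∷ as , bs , refl
  prune (suc N) _ ≤N es budget | yes bad | v , v∈ , _ , few | as , bs , refl =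
    let es″ , ne , sums , sub , rich = prune N (as ++ bs) shorter es₁ budget₁
    in es″ , ne , (λ f → ≤-trans (sums f) (sums₁ f)) , (λ i → proj₁ (∈-filter⁻ keep? (sub i)))
       , λ {u} u∈ {e} e∈ e∋u → case ∈-++⁻ as u∈ of λ where
           (inj₁ i)            → rich (∈-++⁺ˡ i) e∈ e∋u
           -- The deleted vertex lies on no surviving edge, so its demand is vacuous from here on.
           (inj₂ (here refl))  → contradiction e∋u (proj₂ (∈-filter⁻ keep? {xs = es} (sub e∈)))
           (inj₂ (there i))    → rich (∈-++⁺ʳ as i) e∈ e∋u
    where
    keep? : ∀ e → Dec (¬ e ∋ v)
    keep? e = ¬? (e ∋? v)
    es₁ = filter keep? es
    shorter : length (as ++ bs) ≤ N
    shorter = s≤s⁻¹ (subst (_≤ suc N) eq ≤N)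
      where
      eq : length (as ++ v ∷ bs) ≡ suc (length (as ++ bs))
      eq = trans (length-++ as) (trans (+-suc _ _) (cong suc (sym (length-++ as))))
    sums₁ : ∀ f → ∑ es₁ f ≤ ∑ es f
    sums₁ f = ≤-trans (≤-reflexive (∑-filter keep? es f))
      (∑-mono es λ {e} _ → ≤-trans (*-monoˡ-≤ (f e) (⟦⟧≤1 (keep? e))) (≤-reflexive (*-identityˡ (f e))))
    -- Fewer than `w v / h` edges are lost, and the weight `w v` leaves the left side together with
    -- them.
    budget₁ : ∑ (as ++ bs) w < h * length es₁
    budget₁ = +-cancelˡ-< (w v) _ _ (begin-strict
      w v + ∑ (as ++ bs) w                           ≡⟨ cong (w v +_) (∑-++ as bs w) ⟩
      w v + (∑ as w + ∑ bs w)                        ≡⟨ shuffle (w v) (∑ as w) (∑ bs w) ⟩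
      ∑ as w + (w v + ∑ bs w)                        ≡⟨ ∑-++ as (v ∷ bs) w ⟨
      ∑ (as ++ v ∷ bs) w                             <⟨ budget ⟩
      h * length es                                  ≡⟨ cong (h *_) (length-filter-not (_∋? v) es) ⟨
      h * (length (filter (_∋? v) es) + length es₁)  ≡⟨ *-distribˡ-+ h _ (length es₁) ⟩
      h * length (filter (_∋? v) es) + h * length es₁
        ≡⟨ cong (λ x → h * x + h * length es₁) (length-filter≡∑ (_∋? v) es) ⟩
      h * ∑ es (λ e → ⟦ e ∋? v ⟧) + h * length es₁   ≤⟨ +-monoˡ-≤ _ (<⇒≤ few) ⟩
      w v + h * length es₁                           ∎)
      where
      open ≤-Reasoning
      shuffle : ∀ a b c → a + (b + c) ≡ b + (a + c)
      shuffle = solve-∀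

-- Maximal chains of subsets

outs : Subset n → List (Fin n)
outs []            = []
outs (inside  ∷ E) = map suc (outs E)
outs (outside ∷ E) = zero ∷ map suc (outs E)

outs⁻ : (E : Subset n) {a : Fin n} → a ∈ outs E → a S.∉ E
outs⁻ (inside ∷ E) i with ∈-map⁻ suc i
... | b , b∈ , refl = λ { (there j) → outs⁻ E b∈ j }
outs⁻ (outside ∷ E) (here refl) = λ ()
outs⁻ (outside ∷ E) (there i) with ∈-map⁻ suc i
... | b , b∈ , refl = λ { (there j) → outs⁻ E b∈ j }

outs⁺ : (E : Subset n) {a : Fin n} → a S.∉ E → a ∈ outs E
outs⁺ (inside  ∷ E) {zero}  a∉ = contradiction here a∉
outs⁺ (inside  ∷ E) {suc a} a∉ = ∈-map⁺ suc (outs⁺ E (a∉ ∘ there))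
outs⁺ (outside ∷ E) {zero}  a∉ = here refl
outs⁺ (outside ∷ E) {suc a} a∉ = there (∈-map⁺ suc (outs⁺ E (a∉ ∘ there)))

∑-outs-∈ : (E G : Subset n) → E ⊆ G → ∑ (outs E) (λ b → ⟦ b ∈? G ⟧) + ∣ E ∣ ≡ ∣ G ∣
∑-outs-∈ []            []            E⊆G = refl
∑-outs-∈ (inside ∷ E)  (outside ∷ G) E⊆G with () ← E⊆G here
∑-outs-∈ (inside ∷ E)  (inside ∷ G)  E⊆G =
  trans (+-suc _ _) (cong suc (trans (cong (_+ ∣ E ∣)
    (trans (∑-map suc (outs E) _) (∑-cong (outs E) λ {b} _ →
      ⟦⟧-cong (suc b ∈? (inside ∷ G)) (b ∈? G) drop-there there)))
    (∑-outs-∈ E G (drop-∷-⊆ E⊆G))))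
∑-outs-∈ (outside ∷ E) (inside ∷ G)  E⊆G =
  cong suc (trans (cong (_+ ∣ E ∣)
    (trans (∑-map suc (outs E) _) (∑-cong (outs E) λ {b} _ →
      ⟦⟧-cong (suc b ∈? (inside ∷ G)) (b ∈? G) drop-there there)))
    (∑-outs-∈ E G (drop-∷-⊆ E⊆G)))
∑-outs-∈ (outside ∷ E) (outside ∷ G) E⊆G =
  trans (cong (_+ ∣ E ∣)
    (trans (∑-map suc (outs E) _) (∑-cong (outs E) λ {b} _ →
      ⟦⟧-cong (suc b ∈? (outside ∷ G)) (b ∈? G) drop-there there)))
    (∑-outs-∈ E G (drop-∷-⊆ E⊆G))

-- One step of a chain from `E`: if the next element `b` matters only when it lies in `F`, then `d`
-- choices count. `F` need not be the set the chain aims at; the recursions below also use `E ⊕ a`,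
-- `F ⊖ a` and `⊤ ⊖ a`.
module _ (E F : Subset n) (E⊆F : E ⊆ F) {d : ℕ} (∣E∣+d : ∣ E ∣ + d ≡ ∣ F ∣) {g : Fin n → ℕ} (X : ℕ) where

  private
    count : ∑ (outs E) (λ b → ⟦ b ∈? F ⟧) ≡ d
    count = +-cancelʳ-≡ ∣ E ∣ _ _ (trans (∑-outs-∈ E F E⊆F) (trans (sym ∣E∣+d) (+-comm ∣ E ∣ d)))

  ∑-outs≡ : (∀ {b} → b S.∉ E → b S.∈ F → g b ≡ X) → (∀ {b} → b S.∉ E → b S.∉ F → g b ≡ 0) →
            ∑ (outs E) g ≡ d * X
  ∑-outs≡ in≡ out≡ = trans (∑-cong (outs E) λ {b} b∈ → pointwise b (outs⁻ E b∈))
                       (trans (∑-*ʳ (outs E) _ X) (cong (_* X) count))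
    where
    pointwise : ∀ b → b S.∉ E → g b ≡ ⟦ b ∈? F ⟧ * X
    pointwise b b∉E with b ∈? F
    ... | yes b∈F = trans (in≡ b∉E b∈F) (sym (*-identityˡ X))
    ... | no  b∉F = out≡ b∉E b∉F

  ∑-outs≤ : (∀ {b} → b S.∉ E → b S.∈ F → g b ≤ X) → (∀ {b} → b S.∉ E → b S.∉ F → g b ≡ 0) →
            ∑ (outs E) g ≤ d * X
  ∑-outs≤ in≤ out≡ = ≤-trans (∑-mono (outs E) λ {b} b∈ → pointwise b (outs⁻ E b∈))
                       (≤-reflexive (trans (∑-*ʳ (outs E) _ X) (cong (_* X) count)))
    where
    pointwise : ∀ b → b S.∉ E → g b ≤ ⟦ b ∈? F ⟧ * X
    pointwise b b∉E with b ∈? F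
    ... | yes b∈F = ≤-trans (in≤ b∉E b∈F) (≤-reflexive (sym (*-identityˡ X)))
    ... | no  b∉F = ≤-reflexive (out≡ b∉E b∉F)

-- Adding and deleting one element

infixl 5 _⊕_ _⊖_
_⊕_ _⊖_ : Subset n → Fin n → Subset n
E ⊕ a = E [ a ]≔ inside
E ⊖ a = E [ a ]≔ outside

∈⊕ : (E : Subset n) (a : Fin n) → a S.∈ E ⊕ a
∈⊕ (x ∷ E) zero    = here
∈⊕ (x ∷ E) (suc a) = there (∈⊕ E a)

⊆⊕ : (E : Subset n) (a : Fin n) → E ⊆ E ⊕ a
⊆⊕ (_ ∷ E) zero    here      = here
⊆⊕ (_ ∷ E) zero    (there i) = there i
⊆⊕ (_ ∷ E) (suc a) here      = here
⊆⊕ (_ ∷ E) (suc a) (there i) = there (⊆⊕ E a i)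

∈⊕⁻ : (E : Subset n) (a : Fin n) {b : Fin n} → b S.∈ E ⊕ a → b S.∈ E ⊎ b ≡ a
∈⊕⁻ (_ ∷ E) zero    here      = inj₂ refl
∈⊕⁻ (_ ∷ E) zero    (there i) = inj₁ (there i)
∈⊕⁻ (_ ∷ E) (suc a) here      = inj₁ here
∈⊕⁻ (_ ∷ E) (suc a) (there i) with ∈⊕⁻ E a i
... | inj₁ j    = inj₁ (there j)
... | inj₂ refl = inj₂ refl

⊕⊆ : {E G : Subset n} {a : Fin n} → E ⊆ G → a S.∈ G → E ⊕ a ⊆ G
⊕⊆ {E = E} {a = a} E⊆G a∈G i with ∈⊕⁻ E a i
... | inj₁ j    = E⊆G j
... | inj₂ refl = a∈G

∣⊕∣ : (E : Subset n) {a : Fin n} → a S.∉ E → ∣ E ⊕ a ∣ ≡ suc ∣ E ∣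
∣⊕∣ (inside  ∷ E) {zero}  a∉ = contradiction here a∉
∣⊕∣ (outside ∷ E) {zero}  a∉ = refl
∣⊕∣ (inside  ∷ E) {suc a} a∉ = cong suc (∣⊕∣ E (a∉ ∘ there))
∣⊕∣ (outside ∷ E) {suc a} a∉ = ∣⊕∣ E (a∉ ∘ there)

∣⊖∣ : (F : Subset n) {a : Fin n} → a S.∈ F → suc ∣ F ⊖ a ∣ ≡ ∣ F ∣
∣⊖∣ (inside  ∷ F) here      = refl
∣⊖∣ (inside  ∷ F) (there i) = cong suc (∣⊖∣ F i)
∣⊖∣ (outside ∷ F) (there i) = ∣⊖∣ F i

∈⊖⁻ : (F : Subset n) (a : Fin n) {b : Fin n} → b S.∈ F ⊖ a → b S.∈ F × b ≢ a
∈⊖⁻ (_ ∷ F) zero    (there i) = there i , λ ()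
∈⊖⁻ (_ ∷ F) (suc a) here      = here , λ ()
∈⊖⁻ (_ ∷ F) (suc a) (there i) with ∈⊖⁻ F a i
... | j , b≢a = there j , λ { refl → b≢a refl }

∈⊖⁺ : (F : Subset n) (a : Fin n) {b : Fin n} → b S.∈ F → b ≢ a → b S.∈ F ⊖ a
∈⊖⁺ (_ ∷ F) zero    here      b≢a = contradiction refl b≢a
∈⊖⁺ (_ ∷ F) zero    (there i) b≢a = there i
∈⊖⁺ (_ ∷ F) (suc a) here      b≢a = here
∈⊖⁺ (_ ∷ F) (suc a) (there i) b≢a = there (∈⊖⁺ F a i (b≢a ∘ cong suc))

⊆⊖ : {E F : Subset n} {a : Fin n} → E ⊆ F → a S.∉ E → E ⊆ F ⊖ a
⊆⊖ {F = F} {a} E⊆F a∉E i = ∈⊖⁺ F a (E⊆F i) λ { refl → a∉E i }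

⊕⊖ : (E : Subset n) {a : Fin n} → a S.∉ E → (E ⊕ a) ⊖ a ≡ E
⊕⊖ E {a} a∉ = ⊆-antisym
  (λ i → case ∈⊖⁻ (E ⊕ a) a i of λ where
    (j , b≢a) → case ∈⊕⁻ E a j of λ where
      (inj₁ k) → k
      (inj₂ e) → contradiction e b≢a)
  (⊆⊖ (⊆⊕ E a) a∉)

-- `_⊂_` carries an element of `F` outside `E`; recursion along the two vectors extracts it from the
-- bare negation.
⊆∧≢⇒⊂ : {E F : Subset n} → E ⊆ F → ¬ F ⊆ E → E ⊂ F
⊆∧≢⇒⊂ {E = []}    {[]}    E⊆F F⊈E = contradiction (λ ()) F⊈E
⊆∧≢⇒⊂ {E = inside ∷ E}  {outside ∷ F} E⊆F F⊈E with () ← E⊆F here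
⊆∧≢⇒⊂ {E = inside ∷ E}  {inside ∷ F}  E⊆F F⊈E = in⊂in (⊆∧≢⇒⊂ (drop-∷-⊆ E⊆F) (λ s → F⊈E (in⊆in s)))
⊆∧≢⇒⊂ {E = outside ∷ E} {inside ∷ F}  E⊆F F⊈E = out⊂in (drop-∷-⊆ E⊆F)
⊆∧≢⇒⊂ {E = outside ∷ E} {outside ∷ F} E⊆F F⊈E = out⊂ (⊆∧≢⇒⊂ (drop-∷-⊆ E⊆F) (λ s → F⊈E (out⊆ s)))

⊆∧∣≡∣⇒≡ : {E F : Subset n} → E ⊆ F → ∣ E ∣ ≡ ∣ F ∣ → E ≡ F
⊆∧∣≡∣⇒≡ {E = E} {F} E⊆F eq with F ⊆? E
... | yes F⊆E = ⊆-antisym E⊆F F⊆E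
... | no  F⊈E = contradiction eq (<⇒≢ (p⊂q⇒∣p∣<∣q∣ (⊆∧≢⇒⊂ E⊆F F⊈E)))

infix 4 _∈ₗ?_
_∈ₗ?_ : (F : Subset n) (M : List (Subset n)) → Dec (F ∈ M)
F ∈ₗ? M = Any.any? (F ≟ₛ_) M

-- 𝓒 t E lists the maximal chains from E to the full set, provided ∣ E ∣ + t ≡ n.
𝓒 : ℕ → Subset n → List (List (Subset n))
𝓒 zero    E = (E ∷ []) ∷ []
𝓒 (suc t) E = concatMap (λ a → map (E ∷_) (𝓒 t (E ⊕ a))) (outs E)

∑-𝓒-suc : ∀ t (E : Subset n) f → ∑ (𝓒 (suc t) E) f ≡ ∑ (outs E) (λ a → ∑ (𝓒 t (E ⊕ a)) (f ∘ (E ∷_)))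
∑-𝓒-suc t E f = trans (∑-concatMap _ (outs E) f) (∑-cong (outs E) λ {a} _ → ∑-map (E ∷_) (𝓒 t (E ⊕ a)) f)

𝓒⁻ : ∀ t (E : Subset n) {M} → M ∈ 𝓒 (suc t) E →
     ∃[ a ] ∃[ M′ ] (a S.∉ E × M′ ∈ 𝓒 t (E ⊕ a) × M ≡ E ∷ M′)
𝓒⁻ t E i with find (∈-concatMap⁻ (λ a → map (E ∷_) (𝓒 t (E ⊕ a))) {xs = outs E} i)
... | a , a∈ , j with ∈-map⁻ (E ∷_) j
... | M′ , M′∈ , eq = a , M′ , outs⁻ E a∈ , M′∈ , eq

𝓒-head : ∀ t (E : Subset n) {M} → M ∈ 𝓒 t E → E ∈ M
𝓒-head zero    E (here refl) = here refl
𝓒-head (suc t) E i with 𝓒⁻ t E i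
... | _ , _ , _ , _ , refl = here refl

𝓒-above : ∀ t (E : Subset n) {M} → M ∈ 𝓒 t E → ∀ {G} → G ∈ M → E ⊆ G
𝓒-above zero    E (here refl) (here refl) = λ i → i
𝓒-above (suc t) E i j with 𝓒⁻ t E i
𝓒-above (suc t) E i (here refl) | a , M′ , _ , i′ , refl = λ i → i
𝓒-above (suc t) E i (there j)   | a , M′ , _ , i′ , refl = 𝓒-above t (E ⊕ a) i′ j ∘ ⊆⊕ E a

𝓒-chain : ∀ t (E : Subset n) {M} → M ∈ 𝓒 t E → AllPairs _⊂_ M
𝓒-chain zero    E (here refl) = [] ∷ []
𝓒-chain (suc t) E i with 𝓒⁻ t E i
... | a , M′ , a∉ , i′ , refl =
  All.tabulate (λ j → (𝓒-above t (E ⊕ a) i′ j ∘ ⊆⊕ E a) , a , 𝓒-above t (E ⊕ a) i′ j (∈⊕ E a) , a∉)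
  ∷ 𝓒-chain t (E ⊕ a) i′

-- Maximality seen from above: the set just below `F` on the chain is some `F ⊖ b`. It contains `G`,
-- so the deleted `b` is outside `G`.
𝓒-saturated : ∀ t (E : Subset n) {M} → M ∈ 𝓒 t E → ∀ {F G} → G ∈ M → F ∈ M → G ⊂ F →
              ∃[ b ] (b S.∈ F × b S.∉ G × F ⊖ b ∈ M)
𝓒-saturated zero    E (here refl) (here refl) (here refl) G⊂F = contradiction G⊂F (⊂-irref refl)
𝓒-saturated (suc t) E i j k G⊂F with 𝓒⁻ t E i
𝓒-saturated (suc t) E i (here refl) (here refl) G⊂F | _ = contradiction G⊂F (⊂-irref refl)
𝓒-saturated (suc t) E i {F} (here refl) (there k) G⊂F | a , M′ , a∉ , i′ , refl
  with F ⊆? (E ⊕ a)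
... | yes F⊆ with refl ← ⊆-antisym F⊆ (𝓒-above t (E ⊕ a) i′ k) =
  a , ∈⊕ E a , a∉ , here (⊕⊖ E a∉)
... | no  F⊈ with 𝓒-saturated t (E ⊕ a) i′ (𝓒-head t (E ⊕ a) i′) k (⊆∧≢⇒⊂ (𝓒-above t (E ⊕ a) i′ k) F⊈)
...   | b , b∈ , b∉ , m = b , b∈ , b∉ ∘ ⊆⊕ E a , there m
𝓒-saturated (suc t) E i (there j) (here refl) G⊂F | a , M′ , a∉ , i′ , refl =
  contradiction (⊆-⊂-trans (𝓒-above t (E ⊕ a) i′ j ∘ ⊆⊕ E a) G⊂F) (⊂-irref refl)
𝓒-saturated (suc t) E i (there j) (there k) G⊂F | a , M′ , a∉ , i′ , refl
  with 𝓒-saturated t (E ⊕ a) i′ j k G⊂F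
... | b , b∈ , b∉ , m = b , b∈ , b∉ , there m

∣⊕∣+ : ∀ (E : Subset n) {a} → a S.∉ E → ∀ {t m} → ∣ E ∣ + suc t ≡ m → ∣ E ⊕ a ∣ + t ≡ m
∣⊕∣+ E a∉ {t} eq = trans (cong (_+ t) (∣⊕∣ E a∉)) (trans (sym (+-suc ∣ E ∣ t)) eq)

∣𝓒∣ : ∀ t (E : Subset n) → ∣ E ∣ + t ≡ n → ∑ (𝓒 t E) (λ _ → 1) ≡ t !
∣𝓒∣ zero    E eq = refl
∣𝓒∣ {n} (suc t) E eq = trans (∑-𝓒-suc t E _)
  (∑-outs≡ E ⊤ (⊆-max E) (trans eq (sym (∣⊤∣≡n n))) (t !)
    (λ {b} b∉ _ → ∣𝓒∣ t (E ⊕ b) (∣⊕∣+ E b∉ eq)) (λ _ b∉ → contradiction ∈⊤ b∉))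

∑-𝓒≤ : ∀ t (E : Subset n) → ∣ E ∣ + t ≡ n → ∀ {f} → (∀ {M} → M ∈ 𝓒 t E → f M ≤ 1) → ∑ (𝓒 t E) f ≤ t !
∑-𝓒≤ t E eq h = ≤-trans (∑-mono (𝓒 t E) h) (≤-reflexive (∣𝓒∣ t E eq))

-- The `d` elements of `F` outside `E` must come first, in any order, and then the `s` elements
-- outside `F`.
through : ∀ d s (E F : Subset n) → E ⊆ F → ∣ E ∣ + d ≡ ∣ F ∣ → ∣ F ∣ + s ≡ n →
          ∑ (𝓒 (d + s) E) (λ M → ⟦ F ∈ₗ? M ⟧) ≡ d ! * s !
through zero s E F E⊆F ∣E∣ ∣F∣ with refl ← ⊆∧∣≡∣⇒≡ E⊆F (trans (sym (+-identityʳ _)) ∣E∣) =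
  trans (∑-cong (𝓒 s E) λ {M} i → ⟦⟧-yes (E ∈ₗ? M) (𝓒-head s E i))
    (trans (∣𝓒∣ s E ∣F∣) (sym (+-identityʳ (s !))))
through (suc d) s E F E⊆F ∣E∣ ∣F∣ =
  trans (∑-𝓒-suc (d + s) E _) (trans (∑-outs≡ E F E⊆F ∣E∣ (d ! * s !) inF outF) (sym (*-assoc (suc d) (d !) (s !))))
  where
  F≢E : F ≢ E
  F≢E refl = m≢1+m+n ∣ E ∣ (sym (trans (sym (+-suc ∣ E ∣ d)) ∣E∣))
  inF : ∀ {b} → b S.∉ E → b S.∈ F → ∑ (𝓒 (d + s) (E ⊕ b)) (λ M → ⟦ F ∈ₗ? (E ∷ M) ⟧) ≡ d ! * s !
  inF {b} b∉ b∈ = trans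
    (∑-cong (𝓒 (d + s) (E ⊕ b)) λ {M} _ → ⟦⟧-cong (F ∈ₗ? (E ∷ M)) (F ∈ₗ? M)
      (λ { (here e) → contradiction e F≢E ; (there i) → i }) there)
    (through d s (E ⊕ b) F (⊕⊆ E⊆F b∈) (∣⊕∣+ E b∉ ∣E∣) ∣F∣)
  outF : ∀ {b} → b S.∉ E → b S.∉ F → ∑ (𝓒 (d + s) (E ⊕ b)) (λ M → ⟦ F ∈ₗ? (E ∷ M) ⟧) ≡ 0
  outF {b} b∉ b∉F = ∑-zero (𝓒 (d + s) (E ⊕ b)) λ {M} i → ⟦⟧-no (F ∈ₗ? (E ∷ M)) λ where
    (here e)  → F≢E e
    (there j) → b∉F (𝓒-above (d + s) (E ⊕ b) i j (∈⊕ E b))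

-- Rare events along a random maximal chain

any-tail : {R : Subset n → Set} {E : Subset n} {M : List (Subset n)} → ¬ R E → Any R (E ∷ M) → Any R M
any-tail ¬R (here r)  = contradiction r ¬R
any-tail ¬R (there i) = i

-- Markov property: once F is reached, only the part of the chain from F on matters.
markov : ∀ d s (E F : Subset n) → E ⊆ F → ∣ E ∣ + d ≡ ∣ F ∣ → ∣ F ∣ + s ≡ n →
         {R : Subset n → Set} (R? : Decidable R) → (∀ {G} → R G → F ⊆ G) →
         ∑ (𝓒 (d + s) E) (λ M → ⟦ F ∈ₗ? M ×-dec Any.any? R? M ⟧)
         ≤ d ! * ∑ (𝓒 s F) (λ M → ⟦ Any.any? R? M ⟧)
markov zero s E F E⊆F ∣E∣ ∣F∣ R? R⊇ with refl ← ⊆∧∣≡∣⇒≡ E⊆F (trans (sym (+-identityʳ _)) ∣E∣) =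
  ≤-trans (∑-mono (𝓒 s E) λ {M} _ → ⟦⟧-mono (E ∈ₗ? M ×-dec Any.any? R? M) (Any.any? R? M) proj₂)
    (≤-reflexive (sym (*-identityˡ _)))
markov (suc d) s E F E⊆F ∣E∣ ∣F∣ {R} R? R⊇ =
  ≤-trans (≤-reflexive (∑-𝓒-suc (d + s) E _)) (≤-trans
    (∑-outs≤ E F E⊆F ∣E∣ (d ! * _) inF outF) (≤-reflexive (sym (*-assoc (suc d) (d !) _))))
  where
  F⊈E : F ⊈ E
  F⊈E F⊆E = <⇒≱ (≤-trans (s≤s (m≤m+n ∣ E ∣ d)) (≤-reflexive (trans (sym (+-suc ∣ E ∣ d)) ∣E∣)))
                 (p⊆q⇒∣p∣≤∣q∣ F⊆E)
  inF : ∀ {b} → b S.∉ E → b S.∈ F → _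
  inF {b} b∉ b∈ = ≤-trans
    (∑-mono (𝓒 (d + s) (E ⊕ b)) λ {M} _ →
      ⟦⟧-mono (F ∈ₗ? (E ∷ M) ×-dec Any.any? R? (E ∷ M)) (F ∈ₗ? M ×-dec Any.any? R? M)
      λ { (i , j) → any-tail (λ { refl → F⊈E (λ i → i) }) i , any-tail (F⊈E ∘ R⊇) j })
    (markov d s (E ⊕ b) F (⊕⊆ E⊆F b∈) (∣⊕∣+ E b∉ ∣E∣) ∣F∣ R? R⊇)
  outF : ∀ {b} → b S.∉ E → b S.∉ F → _
  outF {b} b∉ b∉F = ∑-zero (𝓒 (d + s) (E ⊕ b)) λ {M} i →
    ⟦⟧-no (F ∈ₗ? (E ∷ M) ×-dec Any.any? R? (E ∷ M)) λ where
      (here e , _)  → F⊈E (⊆-reflexive e)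
      (there j , _) → b∉F (𝓒-above (d + s) (E ⊕ b) i j (∈⊕ E b))

-- The next `w` elements are a random selection from the `suc t` missing ones, so `a` is among them
-- with probability at most `w / suc t`, that is, on at most `w * t !` of the `(suc t) !` chains.
hits-element : ∀ t w (E : Subset n) {a} → a S.∉ E → ∣ E ∣ + suc t ≡ n → ∀ q → ∣ E ∣ + w ≡ q →
               ∑ (𝓒 (suc t) E) (λ M → ⟦ Any.any? (λ G → (a ∈? G) ×-dec (∣ G ∣ ≤? q)) M ⟧) ≤ w * t !
hits-element t zero E {a} a∉ ∣E∣ q eq =
  ≤-reflexive (∑-zero (𝓒 (suc t) E) λ {M} i → ⟦⟧-no (Any.any? _ M) (none i))
  where
  none : ∀ {M} → M ∈ 𝓒 (suc t) E → ¬ Any (λ G → a S.∈ G × ∣ G ∣ ≤ q) M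
  none i r with find r
  ... | G , G∈ , a∈G , G≤ with refl ← ⊆∧∣≡∣⇒≡ {E = E} {G} (𝓒-above (suc t) E i G∈)
          (≤-antisym (p⊆q⇒∣p∣≤∣q∣ (𝓒-above (suc t) E i G∈)) (≤-trans G≤ (≤-reflexive (trans (sym eq) (+-identityʳ _))))) = a∉ a∈G
-- Only one chain is left, and the bound is at least 1.
hits-element zero (suc w) E {a} a∉ ∣E∣ q eq =
  ≤-trans (∑-𝓒≤ 1 E ∣E∣ λ {M} _ → ⟦⟧≤1 (Any.any? _ M)) (s≤s z≤n)
hits-element {n} (suc t) (suc w) E {a} a∉ ∣E∣ q eq = begin
  ∑ (𝓒 (2 + t) E) (λ M → ⟦ R? M ⟧)                               ≡⟨ ∑-𝓒-suc (suc t) E _ ⟩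
  ∑ (outs E) (λ b → ∑ (𝓒 (suc t) (E ⊕ b)) (λ M → ⟦ R? (E ∷ M) ⟧))
    ≤⟨ ∑-mono (outs E) (λ {b} b∈ → pointwise b (outs⁻ E b∈)) ⟩
  -- For `b` outside `E` the two indicators separate `b ≡ a`, after which every chain may count,
  -- from `b ≢ a`, which uses up one of the `w` steps.
  ∑ (outs E) (λ b → ⟦ b ∈? (E ⊕ a) ⟧ * (suc t) ! + ⟦ b ∈? (⊤ ⊖ a) ⟧ * (w * t !))
    ≡⟨ ∑-+ (outs E) _ _ ⟩
  _ ≤⟨ +-mono-≤ (∑-outs≤ E (E ⊕ a) (⊆⊕ E a) (trans (+-comm _ 1) (sym (∣⊕∣ E a∉))) ((suc t) !) here≤ here0)
               (∑-outs≤ E (⊤ ⊖ a) (⊆⊖ (⊆-max E) a∉) size (w * t !) there≤ there0) ⟩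
  1 * (suc t) ! + suc t * (w * t !)                               ≡⟨ arith (suc t) w (t !) ⟩
  suc w * (suc t) !                                               ∎
  where
  open ≤-Reasoning
  R? = λ M → Any.any? (λ G → (a ∈? G) ×-dec (∣ G ∣ ≤? q)) M
  arith : ∀ t w x → 1 * (t * x) + t * (w * x) ≡ suc w * (t * x)
  arith = solve-∀
  size : ∣ E ∣ + suc t ≡ ∣ ⊤ ⊖ a ∣
  size = suc-injective (trans (sym (+-suc ∣ E ∣ (suc t))) (trans ∣E∣ (trans (sym (∣⊤∣≡n n)) (sym (∣⊖∣ (⊤ {n}) ∈⊤)))))
  here≤ : ∀ {b} → b S.∉ E → b S.∈ E ⊕ a → ⟦ b ∈? (E ⊕ a) ⟧ * (suc t) ! ≤ (suc t) !
  here≤ {b} _ _ = ≤-trans (*-monoˡ-≤ ((suc t) !) (⟦⟧≤1 (b ∈? (E ⊕ a)))) (≤-reflexive (*-identityˡ _))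
  here0 : ∀ {b} → b S.∉ E → b S.∉ E ⊕ a → ⟦ b ∈? (E ⊕ a) ⟧ * (suc t) ! ≡ 0
  here0 {b} _ b∉ = cong (_* (suc t) !) (⟦⟧-no (b ∈? (E ⊕ a)) b∉)
  there≤ : ∀ {b} → b S.∉ E → b S.∈ ⊤ ⊖ a → ⟦ b ∈? (⊤ ⊖ a) ⟧ * (w * t !) ≤ w * t !
  there≤ {b} _ _ = ≤-trans (*-monoˡ-≤ (w * t !) (⟦⟧≤1 (b ∈? (⊤ ⊖ a)))) (≤-reflexive (*-identityˡ _))
  there0 : ∀ {b} → b S.∉ E → b S.∉ ⊤ ⊖ a → ⟦ b ∈? (⊤ ⊖ a) ⟧ * (w * t !) ≡ 0
  there0 {b} _ b∉ = cong (_* (w * t !)) (⟦⟧-no (b ∈? (⊤ ⊖ a)) b∉)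
  pointwise : ∀ b → b S.∉ E → ∑ (𝓒 (suc t) (E ⊕ b)) (λ M → ⟦ R? (E ∷ M) ⟧)
              ≤ ⟦ b ∈? (E ⊕ a) ⟧ * (suc t) ! + ⟦ b ∈? (⊤ ⊖ a) ⟧ * (w * t !)
  pointwise b b∉ with b Finₚ.≟ a
  ... | yes refl = ≤-trans
    (∑-𝓒≤ (suc t) (E ⊕ b) (∣⊕∣+ E b∉ ∣E∣) λ {M} _ → ⟦⟧≤1 (R? (E ∷ M)))
    (≤-trans (≤-reflexive (trans (sym (*-identityˡ _)) (cong (_* (suc t) !) (sym (⟦⟧-yes (b ∈? (E ⊕ b)) (∈⊕ E b)))))) (m≤m+n _ _))
  ... | no b≢a = ≤-trans (∑-mono (𝓒 (suc t) (E ⊕ b)) λ {M} _ → ⟦⟧-mono (R? (E ∷ M)) (R? M)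
                    (any-tail (a∉ ∘ proj₁)))
    (≤-trans (hits-element t w (E ⊕ b) a∉′ (∣⊕∣+ E b∉ ∣E∣) q (∣⊕∣+ E b∉ eq))
    (≤-trans (≤-reflexive (trans (sym (*-identityˡ _)) (cong (_* (w * t !)) (sym (⟦⟧-yes (b ∈? (⊤ ⊖ a)) (∈⊖⁺ ⊤ a ∈⊤ b≢a))))))
      (m≤n+m _ _)))
    where
    a∉′ : a S.∉ E ⊕ b
    a∉′ i with ∈⊕⁻ E b i
    ... | inj₁ j = a∉ j
    ... | inj₂ e = b≢a (sym e)

-- Every proper superset of `F` on the chain contains the first element added, so that element has
-- to lie in `A`: `d` of the `suc t` choices.
stays-inside : ∀ t (F A : Subset n) d → ∣ F ∣ + suc t ≡ n → ∣ F ∣ + d ≡ ∣ A ∣ →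
               ∑ (𝓒 (suc t) F) (λ M → ⟦ Any.any? (λ G → (F ⊂? G) ×-dec (G ⊆? A)) M ⟧) ≤ d * t !
stays-inside t F A d ∣F∣ eq with F ⊆? A
... | no F⊈A = ≤-trans (≤-reflexive (∑-zero (𝓒 (suc t) F) λ {M} _ → ⟦⟧-no (Any.any? _ M) λ r →
        case find r of λ { (G , _ , (F⊆G , _) , G⊆A) → F⊈A (λ i → G⊆A (F⊆G i)) })) z≤n
... | yes F⊆A = ≤-trans (≤-reflexive (∑-𝓒-suc t F _)) (∑-outs≤ F A F⊆A eq (t !)
  (λ {b} b∉ _ → ∑-𝓒≤ t (F ⊕ b) (∣⊕∣+ F b∉ ∣F∣) λ {M} _ → ⟦⟧≤1 (Any.any? _ (F ∷ M)))
  λ {b} b∉ b∉A → ∑-zero (𝓒 t (F ⊕ b)) λ {M} i → ⟦⟧-no (Any.any? _ (F ∷ M)) λ where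
    (here (F⊂F , _)) → ⊂-irref refl F⊂F
    (there r) → case find r of λ { (G , G∈ , _ , G⊆A) → b∉A (G⊆A (𝓒-above t (F ⊕ b) i G∈ (∈⊕ F b))) })

-- Counterpart of `hits-element` read downwards from `F`: a set of size at least `q` without `a`
-- forces `a` to be among the last `w` of the `suc d` elements added on the way to `F`. Chains are
-- generated upwards, so the induction still moves `E` towards `F`.
misses-element : ∀ d s w q (E F : Subset n) {a} → E ⊆ F → a S.∈ F → a S.∉ E →
                 ∣ E ∣ + suc d ≡ ∣ F ∣ → ∣ F ∣ + s ≡ n → q < ∣ F ∣ → q + w ≡ ∣ F ∣ →
                 ∑ (𝓒 (suc d + s) E)
                   (λ M → ⟦ F ∈ₗ? M ×-dec Any.any? (λ G → ¬? (a ∈? G) ×-dec (q ≤? ∣ G ∣)) M ⟧)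
                 ≤ w * d ! * s !
misses-element d s w q E F {a} E⊆F a∈F a∉E ∣E∣ ∣F∣ q<F eq with q ≤? ∣ E ∣
-- Here `suc d ≤ w`, so the bound already covers all chains through `F`.
... | yes q≤E = begin
  ∑ (𝓒 (suc d + s) E) _                     ≤⟨ ∑-mono (𝓒 (suc d + s) E) (λ {M} _ → ⟦⟧-mono (F ∈ₗ? M ×-dec Any.any? _ M) (F ∈ₗ? M) proj₁) ⟩
  ∑ (𝓒 (suc d + s) E) (λ M → ⟦ F ∈ₗ? M ⟧)   ≡⟨ through (suc d) s E F E⊆F ∣E∣ ∣F∣ ⟩
  suc d * d ! * s !                          ≤⟨ *-monoˡ-≤ (s !) (*-monoˡ-≤ (d !) d<w) ⟩
  w * d ! * s !                              ∎
  where
  open ≤-Reasoning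
  d<w : suc d ≤ w
  d<w = +-cancelˡ-≤ q _ _ (≤-trans (+-monoˡ-≤ (suc d) q≤E) (≤-reflexive (trans ∣E∣ (sym eq))))
misses-element zero s w q E F {a} E⊆F a∈F a∉E ∣E∣ ∣F∣ q<F eq | no q≰E =
  contradiction (s≤s⁻¹ (≤-trans q<F (≤-reflexive (trans (sym ∣E∣) (+-comm ∣ E ∣ 1))))) q≰E
misses-element (suc d) s w q E F {a} E⊆F a∈F a∉E ∣E∣ ∣F∣ q<F eq | no q≰E =
  ≤-trans (≤-reflexive (∑-𝓒-suc (suc d + s) E _)) (≤-trans
    -- `E` is still too small to be the set that lacks `a`, so the next element must stay in `F` and
    -- differ from `a`.
    (∑-outs≤ E (F ⊖ a) (⊆⊖ E⊆F a∉E) size (w * d ! * s !) inF outF) (≤-reflexive (arith (suc d) w (d !) (s !))))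
  where
  arith : ∀ k w x y → k * (w * x * y) ≡ w * (k * x) * y
  arith = solve-∀
  R? = λ M → F ∈ₗ? M ×-dec Any.any? (λ G → ¬? (a ∈? G) ×-dec (q ≤? ∣ G ∣)) M
  size : ∣ E ∣ + suc d ≡ ∣ F ⊖ a ∣
  size = suc-injective (trans (sym (+-suc ∣ E ∣ (suc d))) (trans ∣E∣ (sym (∣⊖∣ F a∈F))))
  F≢E : F ≢ E
  F≢E refl = a∉E a∈F
  inF : ∀ {b} → b S.∉ E → b S.∈ F ⊖ a → _
  inF {b} b∉ b∈ = ≤-trans
    (∑-mono (𝓒 (suc d + s) (E ⊕ b)) λ {M} _ → ⟦⟧-mono (R? (E ∷ M)) (R? M)
      λ { (i , j) → any-tail (λ e → F≢E e) i , any-tail (q≰E ∘ proj₂) j })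
    (misses-element d s w q (E ⊕ b) F (⊕⊆ E⊆F (proj₁ (∈⊖⁻ F a b∈))) a∈F a∉′ (∣⊕∣+ E b∉ ∣E∣) ∣F∣ q<F eq)
    where
    a∉′ : a S.∉ E ⊕ b
    a∉′ i with ∈⊕⁻ E b i
    ... | inj₁ j = a∉E j
    ... | inj₂ e = proj₂ (∈⊖⁻ F a b∈) (sym e)
  outF : ∀ {b} → b S.∉ E → b S.∉ F ⊖ a → _
  outF {b} b∉ b∉F = ∑-zero (𝓒 (suc d + s) (E ⊕ b)) λ {M} i → ⟦⟧-no (R? (E ∷ M)) λ where
    (here e , _)            → F≢E e
    (there j , here (_ , q≤))  → q≰E q≤
    (there j , there r)     → case find r of λ where
      (G , G∈ , a∉G , _) → b∉F (∈⊖⁺ F a (𝓒-above (suc d + s) (E ⊕ b) i j (∈⊕ E b))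
        λ { refl → a∉G (𝓒-above (suc d + s) (E ⊕ b) i G∈ (∈⊕ E b)) })

-- With `g = ℓ + r`, the binomial coefficient of `s + g` over `g` is at least `s ^ ℓ / ℓ !`. Raising
-- `r` multiplies the left side by `suc (ℓ + r)` and the right side by the larger
-- `suc (s + (ℓ + r))`, so a gap wider than `ℓ` does no harm.
factorial-growth : ∀ ℓ r s → (ℓ + r) ! * s ! * s ^ ℓ ≤ ℓ ! * (s + (ℓ + r)) !
factorial-growth ℓ (suc r) s = begin
  (ℓ + suc r) ! * s ! * s ^ ℓ              ≡⟨ cong (λ x → x ! * s ! * s ^ ℓ) (+-suc ℓ r) ⟩
  suc (ℓ + r) * (ℓ + r) ! * s ! * s ^ ℓ    ≡⟨ assoc (suc (ℓ + r)) ((ℓ + r) !) (s !) (s ^ ℓ) ⟩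
  suc (ℓ + r) * ((ℓ + r) ! * s ! * s ^ ℓ)  ≤⟨ *-mono-≤ {suc (ℓ + r)} {suc (s + (ℓ + r))} (s≤s (m≤n+m (ℓ + r) s)) (factorial-growth ℓ r s) ⟩
  suc (s + (ℓ + r)) * (ℓ ! * (s + (ℓ + r)) !) ≡⟨ swap (suc (s + (ℓ + r))) (ℓ !) ((s + (ℓ + r)) !) ⟩
  ℓ ! * (suc (s + (ℓ + r))) !              ≡⟨ cong (λ x → ℓ ! * x !) (trans (sym (+-suc s (ℓ + r))) (cong (s +_) (sym (+-suc ℓ r)))) ⟩
  ℓ ! * (s + (ℓ + suc r)) !                ∎
  where
  open ≤-Reasoning
  assoc : ∀ a b c d → a * b * c * d ≡ a * (b * c * d)
  assoc = solve-∀
  swap : ∀ a b c → a * (b * c) ≡ b * (a * c)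
  swap = solve-∀
factorial-growth zero zero s = ≤-reflexive (trans (*-identityʳ _) (trans (+-identityʳ _) (trans (cong _! (sym (+-identityʳ s))) (sym (+-identityʳ _)))))
factorial-growth (suc ℓ) zero s = begin
  (suc ℓ + 0) ! * s ! * (s * s ^ ℓ)         ≡⟨ cong (λ x → x ! * s ! * (s * s ^ ℓ)) (+-identityʳ (suc ℓ)) ⟩
  suc ℓ * ℓ ! * s ! * (s * s ^ ℓ)           ≡⟨ assoc (suc ℓ) (ℓ !) (s !) s (s ^ ℓ) ⟩
  suc ℓ * (s * (ℓ ! * s ! * s ^ ℓ))         ≤⟨ *-monoʳ-≤ (suc ℓ) (*-mono-≤ s≤ IH) ⟩
  suc ℓ * (suc (s + ℓ) * (ℓ ! * (s + ℓ) !)) ≡⟨ swap (suc ℓ) (suc (s + ℓ)) (ℓ !) ((s + ℓ) !) ⟩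
  suc ℓ * ℓ ! * (suc (s + ℓ)) !             ≡⟨ cong (λ x → (suc ℓ) ! * x !) (trans (sym (+-suc s ℓ)) (cong (s +_) (sym (+-identityʳ (suc ℓ))))) ⟩
  (suc ℓ) ! * (s + (suc ℓ + 0)) !           ∎
  where
  open ≤-Reasoning
  s≤ : s ≤ suc (s + ℓ)
  s≤ = m≤n⇒m≤1+n (m≤m+n s ℓ)
  IH : ℓ ! * s ! * s ^ ℓ ≤ ℓ ! * (s + ℓ) !
  IH = subst (λ x → x ! * s ! * s ^ ℓ ≤ ℓ ! * (s + x) !) (+-identityʳ ℓ) (factorial-growth ℓ zero s)
  assoc : ∀ a b c d e → a * b * c * (d * e) ≡ a * (d * (b * c * e))
  assoc = solve-∀
  swap : ∀ a b c d → a * (b * (c * d)) ≡ a * c * (b * d)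
  swap = solve-∀

≤-difference : ∀ {m n} → m ≤ n → ∃[ d ] m + d ≡ n
≤-difference {m} {n} le = n ∸ m , m+[n∸m]≡n le

-- Rare events among the chains through a set of middle size

module Events (n w K : ℕ) (1≤w : 1 ≤ w) (3≤K : 3 ≤ K) (Kw≤n : K * w ≤ n) where

  Mid : Subset n → Set
  Mid F = 2 * ∣ F ∣ ≤ n + w × n ≤ 2 * ∣ F ∣ + w

  private
    3w≤n : 3 * w ≤ n
    3w≤n = ≤-trans (*-monoˡ-≤ w 3≤K) Kw≤n

    1≤n : 1 ≤ n
    1≤n = ≤-trans 1≤w (≤-trans (m≤m+n w _) 3w≤n)

    halve : ∀ {a b} → 2 * a ≤ 2 * b → a ≤ b
    halve {a} {b} = *-cancelˡ-≤ 2

    double+ : ∀ f w → 2 * f + w + w ≡ 2 * (f + w)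
    double+ = solve-∀

    -- Applied to `∣ F ∣` and to `n ∸ ∣ F ∣`, it lets these sizes be replaced by `n` at the price of
    -- a factor 3. The slack comes from `3 * w ≤ n`.
    third : ∀ x → n ≤ 2 * x + w → n ≤ 3 * x
    third x n≤ = halve (+-cancelʳ-≤ n (2 * n) (2 * (3 * x)) (begin
      2 * n + n            ≡⟨ e₁ n ⟩
      3 * n                ≤⟨ *-monoʳ-≤ 3 n≤ ⟩
      3 * (2 * x + w)      ≡⟨ e₂ x w ⟩
      2 * (3 * x) + 3 * w  ≤⟨ +-monoʳ-≤ (2 * (3 * x)) 3w≤n ⟩
      2 * (3 * x) + n      ∎))
      where
      open ≤-Reasoning
      e₁ : ∀ n → 2 * n + n ≡ 3 * n
      e₁ = solve-∀
      e₂ : ∀ x w → 3 * (2 * x + w) ≡ 2 * (3 * x) + 3 * w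
      e₂ = solve-∀

  Mid-size : ∀ {F G} → Mid F → Mid G → ∣ G ∣ ≤ ∣ F ∣ + w
  Mid-size {F} {G} (_ , n≤) (G≤ , _) =
    halve (≤-trans G≤ (≤-trans (+-monoˡ-≤ w n≤) (≤-reflexive (double+ ∣ F ∣ w))))

  third-below : ∀ {F} → Mid F → n ≤ 3 * ∣ F ∣
  third-below {F} (_ , n≤) = third ∣ F ∣ n≤

  third-above : ∀ {F} → Mid F → ∀ {s} → ∣ F ∣ + s ≡ n → n ≤ 3 * s
  third-above {F} (F≤ , _) {s} eq = third s (+-cancelˡ-≤ n n (2 * s + w) (begin
    n + n                      ≡⟨ cong₂ _+_ eq eq ⟨
    (∣ F ∣ + s) + (∣ F ∣ + s)  ≡⟨ e₁ ∣ F ∣ s ⟩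
    2 * ∣ F ∣ + 2 * s          ≤⟨ +-monoˡ-≤ (2 * s) F≤ ⟩
    n + w + 2 * s              ≡⟨ e₂ n w s ⟩
    n + (2 * s + w)            ∎))
    where
    open ≤-Reasoning
    e₁ : ∀ f s → (f + s) + (f + s) ≡ 2 * f + 2 * s
    e₁ = solve-∀
    e₂ : ∀ n w s → n + w + 2 * s ≡ n + (2 * s + w)
    e₂ = solve-∀

  𝓜 : List (List (Subset n))
  𝓜 = 𝓒 n ⊥

  N : Subset n → ℕ
  N F = ∣ F ∣ ! * (n ∸ ∣ F ∣) !

  split : ∀ F → ∣ F ∣ + (n ∸ ∣ F ∣) ≡ n
  split F = m+[n∸m]≡n (∣p∣≤n F)

  ∣⊥∣+ : ∀ {m} → ∣ ⊥ {n} ∣ + m ≡ m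
  ∣⊥∣+ {m} = cong (_+ m) (∣⊥∣≡0 n)

  ∑𝓜-markov : ∀ F {R : Subset n → Set} (R? : Decidable R) → (∀ {G} → R G → F ⊆ G) →
    ∑ 𝓜 (λ M → ⟦ F ∈ₗ? M ×-dec Any.any? R? M ⟧)
      ≤ ∣ F ∣ ! * ∑ (𝓒 (n ∸ ∣ F ∣) F) (λ M → ⟦ Any.any? R? M ⟧)
  ∑𝓜-markov F R? R⊇ = subst (λ t → ∑ (𝓒 t ⊥) (λ M → ⟦ F ∈ₗ? M ×-dec Any.any? R? M ⟧)
                        ≤ ∣ F ∣ ! * ∑ (𝓒 (n ∸ ∣ F ∣) F) (λ M → ⟦ Any.any? R? M ⟧)) (split F)
    (markov ∣ F ∣ (n ∸ ∣ F ∣) ⊥ F ⊥⊆ ∣⊥∣+ (split F) R? R⊇)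

  both : ∀ {F G} g s → F ⊆ G → ∣ F ∣ + g ≡ ∣ G ∣ → ∣ G ∣ + s ≡ n →
         ∑ 𝓜 (λ M → ⟦ F ∈ₗ? M ×-dec G ∈ₗ? M ⟧) ≤ ∣ F ∣ ! * (g ! * s !)
  both {F} {G} g s F⊆G eqg eqs = ≤-trans (∑𝓜-markov F (G ≟ₛ_) λ { refl → F⊆G })
    (*-monoʳ-≤ (∣ F ∣ !) (≤-reflexive (subst (λ t → ∑ (𝓒 t F) (λ M → ⟦ G ∈ₗ? M ⟧) ≡ g ! * s !) g+s
      (through g s F G F⊆G eqg eqs))))
    where
    g+s : g + s ≡ n ∸ ∣ F ∣
    g+s = +-cancelˡ-≡ ∣ F ∣ _ _ (trans (sym (+-assoc ∣ F ∣ g s)) (trans (cong (_+ s) eqg) (trans eqs (sym (split F)))))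

  private
    -- Origin of `3 ^ ℓ * ℓ !`: the 3 replaces `s` by `n`, and the factorial is the one in
    -- `factorial-growth`.
    power-bound : ∀ ℓ g s → ℓ ≤ g → n ≤ 3 * s → (g ! * s !) * n ^ ℓ ≤ 3 ^ ℓ * ℓ ! * (s + g) !
    power-bound ℓ g s ℓ≤g n≤3s with r , refl ← ≤-difference ℓ≤g = begin
      ((ℓ + r) ! * s !) * n ^ ℓ               ≤⟨ *-monoʳ-≤ ((ℓ + r) ! * s !) (^-monoˡ-≤ ℓ n≤3s) ⟩
      ((ℓ + r) ! * s !) * (3 * s) ^ ℓ         ≡⟨ cong (((ℓ + r) ! * s !) *_) (^-distribʳ-* ℓ 3 s) ⟩
      ((ℓ + r) ! * s !) * (3 ^ ℓ * s ^ ℓ)     ≡⟨ e ((ℓ + r) ! * s !) (3 ^ ℓ) (s ^ ℓ) ⟩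
      3 ^ ℓ * ((ℓ + r) ! * s ! * s ^ ℓ)       ≤⟨ *-monoʳ-≤ (3 ^ ℓ) (factorial-growth ℓ r s) ⟩
      3 ^ ℓ * (ℓ ! * (s + (ℓ + r)) !)         ≡⟨ *-assoc (3 ^ ℓ) (ℓ !) _ ⟨
      3 ^ ℓ * ℓ ! * (s + (ℓ + r)) !           ∎
      where
      open ≤-Reasoning
      e : ∀ a b c → a * (b * c) ≡ b * (a * c)
      e = solve-∀

    gap : ∀ {F G : Subset n} ℓ → F ⊆ G → ∣ F ∣ + ℓ ≤ ∣ G ∣ → ∃[ g ] (∣ F ∣ + g ≡ ∣ G ∣ × ℓ ≤ g)
    gap {F} {G} ℓ F⊆G le = let g , eq = ≤-difference (p⊆q⇒∣p∣≤∣q∣ F⊆G) in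
      g , eq , +-cancelˡ-≤ ∣ F ∣ ℓ g (≤-trans le (≤-reflexive (sym eq)))

  -- A chain through `F` meets `G` with probability one over the binomial coefficient of `s + g`
  -- over `g`, where `s = n ∸ ∣ G ∣` is at least `n / 3`.
  both-up : ∀ ℓ {F G} → Mid G → F ⊆ G → ∣ F ∣ + ℓ ≤ ∣ G ∣ →
            ∑ 𝓜 (λ M → ⟦ F ∈ₗ? M ×-dec G ∈ₗ? M ⟧) * n ^ ℓ ≤ 3 ^ ℓ * ℓ ! * N F
  both-up ℓ {F} {G} midG F⊆G le with gap {F} {G} ℓ F⊆G le
  ... | g , eqg , ℓ≤g = begin
    _                                        ≤⟨ *-monoˡ-≤ (n ^ ℓ) (both g s F⊆G eqg (split G)) ⟩
    ∣ F ∣ ! * (g ! * s !) * n ^ ℓ            ≡⟨ *-assoc (∣ F ∣ !) (g ! * s !) (n ^ ℓ) ⟩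
    ∣ F ∣ ! * (g ! * s ! * n ^ ℓ)            ≤⟨ *-monoʳ-≤ (∣ F ∣ !) (power-bound ℓ g s ℓ≤g (third-above {G} midG (split G))) ⟩
    ∣ F ∣ ! * (3 ^ ℓ * ℓ ! * (s + g) !)      ≡⟨ cong (λ x → ∣ F ∣ ! * (3 ^ ℓ * ℓ ! * x !)) s+g ⟩
    ∣ F ∣ ! * (3 ^ ℓ * ℓ ! * (n ∸ ∣ F ∣) !)  ≡⟨ e (∣ F ∣ !) (3 ^ ℓ * ℓ !) _ ⟩
    3 ^ ℓ * ℓ ! * N F                        ∎
    where
    open ≤-Reasoning
    s = n ∸ ∣ G ∣
    s+g : s + g ≡ n ∸ ∣ F ∣
    s+g = +-cancelˡ-≡ ∣ F ∣ _ _ (trans (cong (∣ F ∣ +_) (+-comm s g)) (trans (sym (+-assoc ∣ F ∣ g s))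
            (trans (cong (_+ s) eqg) (trans (split G) (sym (split F))))))
    e : ∀ a b c → a * (b * c) ≡ b * (a * c)
    e = solve-∀

  -- The dual count: the binomial coefficient is that of `∣ G ∣` over `g`, and `∣ F ∣` takes the
  -- role of `s`.
  both-down : ∀ ℓ {F G} → Mid F → F ⊆ G → ∣ F ∣ + ℓ ≤ ∣ G ∣ →
              ∑ 𝓜 (λ M → ⟦ F ∈ₗ? M ×-dec G ∈ₗ? M ⟧) * n ^ ℓ ≤ 3 ^ ℓ * ℓ ! * N G
  both-down ℓ {F} {G} midF F⊆G le with gap {F} {G} ℓ F⊆G le
  ... | g , eqg , ℓ≤g = begin
    _                                            ≤⟨ *-monoˡ-≤ (n ^ ℓ) (both g s F⊆G eqg (split G)) ⟩
    ∣ F ∣ ! * (g ! * s !) * n ^ ℓ                ≡⟨ e (∣ F ∣ !) (g !) (s !) (n ^ ℓ) ⟩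
    (g ! * ∣ F ∣ ! * n ^ ℓ) * s !                ≤⟨ *-monoˡ-≤ (s !) (power-bound ℓ g ∣ F ∣ ℓ≤g (third-below {F} midF)) ⟩
    3 ^ ℓ * ℓ ! * (∣ F ∣ + g) ! * s !            ≡⟨ cong (λ x → 3 ^ ℓ * ℓ ! * x ! * s !) eqg ⟩
    3 ^ ℓ * ℓ ! * ∣ G ∣ ! * s !                  ≡⟨ *-assoc (3 ^ ℓ * ℓ !) (∣ G ∣ !) (s !) ⟩
    3 ^ ℓ * ℓ ! * N G                            ∎
    where
    open ≤-Reasoning
    s = n ∸ ∣ G ∣
    e : ∀ a b c d → a * (b * c) * d ≡ (b * a * d) * c
    e = solve-∀

  private
    -- Division-free form of: a fraction `w / s` is at most `3 w / n`, hence at most `3 / K`.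
    scale : ∀ X s C → X * s ≤ w * C → n ≤ 3 * s → K * X ≤ 3 * C
    scale X s C le n≤3s = *-cancelˡ-≤ n {{>-nonZero 1≤n}} (begin
      n * (K * X)          ≤⟨ *-monoˡ-≤ (K * X) n≤3s ⟩
      3 * s * (K * X)      ≡⟨ e₁ s K X ⟩
      3 * K * (X * s)      ≤⟨ *-monoʳ-≤ (3 * K) le ⟩
      3 * K * (w * C)      ≡⟨ e₂ K w C ⟩
      K * w * (3 * C)      ≤⟨ *-monoˡ-≤ (3 * C) Kw≤n ⟩
      n * (3 * C)          ∎)
      where
      open ≤-Reasoning
      e₁ : ∀ s K X → 3 * s * (K * X) ≡ 3 * K * (X * s)
      e₁ = solve-∀
      e₂ : ∀ K w C → 3 * K * (w * C) ≡ K * w * (3 * C)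
      e₂ = solve-∀

    positive : ∀ {s} → n ≤ 3 * s → ∃[ t ] s ≡ suc t
    positive {zero}  n≤ = contradiction (≤-trans 1≤n n≤) λ ()
    positive {suc t} _  = t , refl

  gains : ∀ {F a} → Mid F → a S.∉ F →
    K * ∑ 𝓜 (λ M → ⟦ F ∈ₗ? M ×-dec
          Any.any? (λ G → (F ⊂? G) ×-dec ((a ∈? G) ×-dec (∣ G ∣ ≤? ∣ F ∣ + w))) M ⟧) ≤ 3 * N F
  gains {F} {a} mid a∉ with positive (third-above {F} mid (split F))
  ... | t , s≡ = scale X (n ∸ ∣ F ∣) (N F) (begin
    X * (n ∸ ∣ F ∣)                        ≤⟨ *-monoˡ-≤ (n ∸ ∣ F ∣) (∑𝓜-markov F R? (p⊂q⇒p⊆q ∘ proj₁)) ⟩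
    ∣ F ∣ ! * Y (n ∸ ∣ F ∣) * (n ∸ ∣ F ∣)  ≡⟨ cong (λ s → ∣ F ∣ ! * Y s * s) s≡ ⟩
    ∣ F ∣ ! * Y (suc t) * suc t            ≤⟨ *-monoˡ-≤ (suc t) (*-monoʳ-≤ (∣ F ∣ !) (≤-trans
      (∑-mono (𝓒 (suc t) F) λ {M} _ → ⟦⟧-mono (Any.any? R? M) (Any.any? _ M) (Any.map proj₂))
      (hits-element t w F a∉ (trans (cong (∣ F ∣ +_) (sym s≡)) (split F)) (∣ F ∣ + w) refl))) ⟩
    ∣ F ∣ ! * (w * t !) * suc t            ≡⟨ e (∣ F ∣ !) w (t !) (suc t) ⟩
    w * (∣ F ∣ ! * (suc t * t !))          ≡⟨ cong (λ s → w * (∣ F ∣ ! * s !)) s≡ ⟨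
    w * N F                                ∎) (third-above {F} mid (split F))
    where
    open ≤-Reasoning
    R? = λ G → (F ⊂? G) ×-dec ((a ∈? G) ×-dec (∣ G ∣ ≤? ∣ F ∣ + w))
    X = ∑ 𝓜 (λ M → ⟦ F ∈ₗ? M ×-dec Any.any? R? M ⟧)
    Y : ℕ → ℕ
    Y s = ∑ (𝓒 s F) (λ M → ⟦ Any.any? R? M ⟧)
    e : ∀ a b c d → a * (b * c) * d ≡ b * (a * (d * c))
    e = solve-∀

  inside-of : ∀ {F A} → Mid F → Mid A →
    K * ∑ 𝓜 (λ M → ⟦ F ∈ₗ? M ×-dec Any.any? (λ G → (F ⊂? G) ×-dec (G ⊆? A)) M ⟧) ≤ 3 * N F
  inside-of {F} {A} mid midA with F ⊆? A
  ... | no F⊈A = ≤-trans (≤-reflexive (trans (cong (K *_) (∑-zero 𝓜 λ {M} _ →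
          ⟦⟧-no (F ∈ₗ? M ×-dec Any.any? _ M) λ { (_ , r) → case find r of λ where
            (G , _ , (F⊆G , _) , G⊆A) → F⊈A (λ i → G⊆A (F⊆G i)) })) (*-zeroʳ K))) z≤n
  ... | yes F⊆A with positive (third-above {F} mid (split F)) | ≤-difference (p⊆q⇒∣p∣≤∣q∣ F⊆A)
  ... | t , s≡ | d , eqd = scale X (n ∸ ∣ F ∣) (N F) (begin
    X * (n ∸ ∣ F ∣)                        ≤⟨ *-monoˡ-≤ (n ∸ ∣ F ∣) (∑𝓜-markov F R? (p⊂q⇒p⊆q ∘ proj₁)) ⟩
    ∣ F ∣ ! * Y (n ∸ ∣ F ∣) * (n ∸ ∣ F ∣)  ≡⟨ cong (λ s → ∣ F ∣ ! * Y s * s) s≡ ⟩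
    ∣ F ∣ ! * Y (suc t) * suc t            ≤⟨ *-monoˡ-≤ (suc t) (*-monoʳ-≤ (∣ F ∣ !) (≤-trans
      (stays-inside t F A d (trans (cong (∣ F ∣ +_) (sym s≡)) (split F)) eqd) (*-monoˡ-≤ (t !) d≤w))) ⟩
    ∣ F ∣ ! * (w * t !) * suc t            ≡⟨ e (∣ F ∣ !) w (t !) (suc t) ⟩
    w * (∣ F ∣ ! * (suc t * t !))          ≡⟨ cong (λ s → w * (∣ F ∣ ! * s !)) s≡ ⟨
    w * N F                                ∎) (third-above {F} mid (split F))
    where
    open ≤-Reasoning
    R? = λ G → (F ⊂? G) ×-dec (G ⊆? A)
    X = ∑ 𝓜 (λ M → ⟦ F ∈ₗ? M ×-dec Any.any? R? M ⟧)
    Y : ℕ → ℕ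
    Y s = ∑ (𝓒 s F) (λ M → ⟦ Any.any? R? M ⟧)
    d≤w : d ≤ w
    d≤w = +-cancelˡ-≤ ∣ F ∣ d w (≤-trans (≤-reflexive eqd) (Mid-size {F} {A} mid midA))
    e : ∀ a b c d → a * (b * c) * d ≡ b * (a * (d * c))
    e = solve-∀

  loses : ∀ {F a} → Mid F → a S.∈ F →
    K * ∑ 𝓜 (λ M → ⟦ F ∈ₗ? M ×-dec
          Any.any? (λ G → ¬? (a ∈? G) ×-dec (∣ F ∣ ∸ w ≤? ∣ G ∣)) M ⟧) ≤ 3 * N F
  loses {F} {a} mid a∈ with positive (third-below {F} mid)
  ... | d , f≡ = scale X ∣ F ∣ (N F) (begin
    X * ∣ F ∣                    ≤⟨ *-monoˡ-≤ ∣ F ∣ (subst (λ t → Y t ≤ w * d ! * s !) d+s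
      (misses-element d s w (∣ F ∣ ∸ w) ⊥ F ⊥⊆ a∈ ∉⊥ (trans ∣⊥∣+ (sym f≡)) (split F) q< (m∸n+n≡m w≤F))) ⟩
    w * d ! * s ! * ∣ F ∣        ≡⟨ cong (w * d ! * s ! *_) f≡ ⟩
    w * d ! * s ! * suc d        ≡⟨ e w (d !) (s !) (suc d) ⟩
    w * (suc d * d ! * s !)      ≡⟨ cong (λ f → w * (f ! * s !)) f≡ ⟨
    w * N F                      ∎) (third-below {F} mid)
    where
    open ≤-Reasoning
    s = n ∸ ∣ F ∣
    Y : ℕ → ℕ
    Y t = ∑ (𝓒 t ⊥) (λ M → ⟦ F ∈ₗ? M ×-dec Any.any? (λ G → ¬? (a ∈? G) ×-dec (∣ F ∣ ∸ w ≤? ∣ G ∣)) M ⟧)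
    X = Y n
    d+s : suc d + s ≡ n
    d+s = trans (cong (_+ s) (sym f≡)) (split F)
    w≤F : w ≤ ∣ F ∣
    w≤F = *-cancelˡ-≤ 3 (≤-trans 3w≤n (third-below {F} mid))
    q< : ∣ F ∣ ∸ w < ∣ F ∣
    q< = ∸-monoʳ-< {∣ F ∣} 1≤w w≤F
    e : ∀ a b c d → a * b * c * d ≡ a * (d * b * c)
    e = solve-∀

  -- Dual of `inside-of`. The last step below `F` is not accessible to an upward recursion, so
  -- `𝓒-saturated` supplies the predecessor `F ⊖ b`. Its `b` lies in `F` but not in `A`, which
  -- leaves at most `w` candidates, each taken by one chain in `∣ F ∣`.
  between : ∀ {F A} → Mid F → Mid A →
    K * ∑ 𝓜 (λ M → ⟦ F ∈ₗ? M ×-dec Any.any? (λ G → (A ⊆? G) ×-dec (G ⊂? F)) M ⟧) ≤ 3 * N F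
  between {F} {A} mid midA with A ⊆? F
  ... | no A⊈F = ≤-trans (≤-reflexive (trans (cong (K *_) (∑-zero 𝓜 λ {M} _ →
          ⟦⟧-no (F ∈ₗ? M ×-dec Any.any? _ M) λ { (_ , r) → case find r of λ where
            (G , _ , A⊆G , (G⊆F , _)) → A⊈F (λ i → G⊆F (A⊆G i)) })) (*-zeroʳ K))) z≤n
  ... | yes A⊆F with positive (third-below {F} mid)
  ... | d , f≡ = scale X ∣ F ∣ (N F) (begin
    X * ∣ F ∣                                  ≤⟨ *-monoˡ-≤ ∣ F ∣ X≤ ⟩
    length bs * (d ! * s !) * ∣ F ∣            ≤⟨ *-monoˡ-≤ ∣ F ∣ (*-monoˡ-≤ (d ! * s !) bs≤w) ⟩
    w * (d ! * s !) * ∣ F ∣                    ≡⟨ cong (w * (d ! * s !) *_) f≡ ⟩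
    w * (d ! * s !) * suc d                    ≡⟨ e w (d !) (s !) (suc d) ⟩
    w * (suc d * d ! * s !)                    ≡⟨ cong (λ f → w * (f ! * s !)) f≡ ⟨
    w * N F                                    ∎) (third-below {F} mid)
    where
    open ≤-Reasoning
    s = n ∸ ∣ F ∣
    e : ∀ a b c d → a * (b * c) * d ≡ a * (d * b * c)
    e = solve-∀
    bs = filter (_∈? F) (outs A)
    R? = λ G → (A ⊆? G) ×-dec (G ⊂? F)
    X = ∑ 𝓜 (λ M → ⟦ F ∈ₗ? M ×-dec Any.any? R? M ⟧)
    bs≤w : length bs ≤ w
    bs≤w = +-cancelʳ-≤ ∣ A ∣ _ _ (≤-trans (≤-reflexive (trans (cong (_+ ∣ A ∣) (length-filter≡∑ (_∈? F) (outs A)))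
             (∑-outs-∈ A F A⊆F))) (≤-trans (Mid-size {A} {F} midA mid) (≤-reflexive (+-comm ∣ A ∣ w))))
    pred-F : ∀ {M} → M ∈ 𝓜 → F ∈ M × Any (λ G → A ⊆ G × G ⊂ F) M → Any (λ b → F ⊖ b ∈ M × F ∈ M) bs
    pred-F M∈ (F∈ , r) with find r
    ... | G , G∈ , A⊆G , G⊂F with 𝓒-saturated n ⊥ M∈ G∈ F∈ G⊂F
    ... | b , b∈ , b∉ , i = lose (∈-filter⁺ (_∈? F) (outs⁺ A (b∉ ∘ A⊆G)) b∈) (i , F∈)
    X≤ : X ≤ length bs * (d ! * s !)
    X≤ = begin
      X ≤⟨ ∑-mono 𝓜 (λ {M} M∈ → ⟦any⟧≤∑ (λ b → (F ⊖ b) ∈ₗ? M ×-dec F ∈ₗ? M) bs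
                        (F ∈ₗ? M ×-dec Any.any? R? M) (pred-F M∈)) ⟩
      ∑ 𝓜 (λ M → ∑ bs (λ b → ⟦ (F ⊖ b) ∈ₗ? M ×-dec F ∈ₗ? M ⟧)) ≡⟨ ∑-swap 𝓜 bs _ ⟩
      ∑ bs (λ b → ∑ 𝓜 (λ M → ⟦ (F ⊖ b) ∈ₗ? M ×-dec F ∈ₗ? M ⟧)) ≤⟨ ∑-mono bs (λ {b} i → one b (proj₂ (∈-filter⁻ (_∈? F) {xs = outs A} i))) ⟩
      ∑ bs (λ _ → d ! * s !) ≡⟨ ∑-const bs _ ⟩
      length bs * (d ! * s !) ∎
      where
      one : ∀ b → b S.∈ F → ∑ 𝓜 (λ M → ⟦ (F ⊖ b) ∈ₗ? M ×-dec F ∈ₗ? M ⟧) ≤ d ! * s !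
      one b b∈ = ≤-trans (both {F ⊖ b} {F} 1 s (proj₁ ∘ ∈⊖⁻ F b) (trans (+-comm _ 1) (∣⊖∣ F b∈)) (split F))
        (≤-reflexive (cong₂ (λ x y → x ! * y) (suc-injective (trans (∣⊖∣ F b∈) f≡)) (+-identityʳ (s !))))

-- Windows of consecutive members of the family on a chain

-- Each factor `a + i` on the left is matched with the larger factor `g + i` on the right.
factorials-balanced : ∀ a d g → a ≤ g → (a + d) ! * g ! ≤ a ! * (g + d) !
factorials-balanced a zero    g a≤g = ≤-reflexive (cong₂ (λ x y → x ! * y !) (+-identityʳ a) (sym (+-identityʳ g)))
factorials-balanced a (suc d) g a≤g = begin
  (a + suc d) ! * g !              ≡⟨ cong (λ x → x ! * g !) (+-suc a d) ⟩
  suc (a + d) * (a + d) ! * g !    ≡⟨ *-assoc (suc (a + d)) ((a + d) !) (g !) ⟩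
  suc (a + d) * ((a + d) ! * g !)  ≤⟨ *-mono-≤ {suc (a + d)} {suc (g + d)} (s≤s (+-monoˡ-≤ d a≤g)) (factorials-balanced a d g a≤g) ⟩
  suc (g + d) * (a ! * (g + d) !)  ≡⟨ e (suc (g + d)) (a !) ((g + d) !) ⟩
  a ! * (suc (g + d)) !            ≡⟨ cong (λ x → a ! * x !) (+-suc g d) ⟨
  a ! * (g + suc d) !              ∎
  where
  open ≤-Reasoning
  e : ∀ a b c → a * (b * c) ≡ b * (a * c)
  e = solve-∀

-- The LYM inequality for one set: `f ! * s !` is smallest for the balanced split, so any set lies
-- on at least a fraction of one over the central coefficient of all chains.
central-binomial : ∀ {n} f s → f + s ≡ n → n ! ≤ f ! * s ! * (n C (n / 2))
central-binomial {n} f s f+s = begin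
  n !                            ≡⟨ C-fact ⟨
  h ! * g ! * (n C h)            ≤⟨ *-monoˡ-≤ (n C h) smallest ⟩
  f ! * s ! * (n C h)            ∎
  where
  open ≤-Reasoning
  h = n / 2
  h≤n : h ≤ n
  h≤n = ≤-trans (m≤m*n h 2) (m/n*n≤m n 2)
  g = n ∸ h
  h+g : h + g ≡ n
  h+g = m+[n∸m]≡n h≤n
  C-fact : h ! * g ! * (n C h) ≡ n !
  C-fact = trans (cong (h ! * g ! *_) (nCk≡n!/k![n-k]! h≤n))
           (trans (*-comm (h ! * g !) _) (m/n*n≡m {n !} {h ! * g !} {{h !* g !≢0}} (k![n∸k]!∣n! h≤n)))
  h≤g : h ≤ g
  h≤g = +-cancelˡ-≤ h h g (≤-trans (≤-reflexive (e h)) (≤-trans (m/n*n≤m n 2) (≤-reflexive (sym h+g))))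
    where
    e : ∀ h → h + h ≡ h * 2
    e = solve-∀
  g≤1+h : g ≤ suc h
  g≤1+h = +-cancelˡ-≤ h g (suc h) (begin
    h + g            ≡⟨ trans h+g (m≡m%n+[m/n]*n n 2) ⟩
    n % 2 + h * 2    ≤⟨ +-monoˡ-≤ (h * 2) (s≤s⁻¹ (m%n<n n 2)) ⟩
    1 + h * 2        ≡⟨ e h ⟩
    h + suc h        ∎)
    where
    e : ∀ h → 1 + h * 2 ≡ h + suc h
    e = solve-∀
  with-small : ∀ a b → a + b ≡ n → a ≤ h → h ! * g ! ≤ a ! * b !
  with-small a b eq a≤h with d , a+d≡h ← ≤-difference a≤h = begin
    h ! * g !          ≡⟨ cong (λ x → x ! * g !) a+d≡h ⟨
    (a + d) ! * g !    ≤⟨ factorials-balanced a d g (≤-trans a≤h h≤g) ⟩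
    a ! * (g + d) !    ≡⟨ cong (λ x → a ! * x !) (+-cancelˡ-≡ a _ _ (trans (e a g d) (trans (cong (_+ g) a+d≡h) (trans h+g (sym eq))))) ⟩
    a ! * b !          ∎
    where
    e : ∀ a g d → a + (g + d) ≡ a + d + g
    e = solve-∀
  smallest : h ! * g ! ≤ f ! * s !
  smallest with f ≤? h
  ... | yes f≤h = with-small f s f+s f≤h
  ... | no  f≰h = ≤-trans (with-small s f (trans (+-comm s f) f+s) s≤h) (≤-reflexive (*-comm (s !) (f !)))
    where
    s≤h : s ≤ h
    s≤h = +-cancelˡ-≤ (suc h) s h (≤-trans (+-monoˡ-≤ s (≰⇒> f≰h)) (≤-trans
      (≤-reflexive (trans f+s (sym h+g))) (≤-trans (+-monoʳ-≤ h g≤1+h) (≤-reflexive (+-suc h h)))))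

-- A window of `k` consecutive members is represented by the suffix that begins with it; longer
-- suffixes are kept whole, and only places below `k` are consulted.
suffixes : List A → List (List A)
suffixes []       = []
suffixes (x ∷ xs) = (x ∷ xs) ∷ suffixes xs

At : List A → ℕ → A → Set
At []       _       y = Absurd
At (x ∷ xs) zero    y = y ≡ x
At (x ∷ xs) (suc i) y = At xs i y

At-∈ : ∀ (xs : List A) i {y} → At xs i y → y ∈ xs
At-∈ (x ∷ xs) zero    refl = here refl
At-∈ (x ∷ xs) (suc i) a    = there (At-∈ xs i a)

At-∃ : ∀ (xs : List A) i → i < length xs → ∃[ y ] At xs i y
At-∃ (x ∷ xs) zero    _         = x , refl
At-∃ (x ∷ xs) (suc i) (s≤s lt)  = At-∃ xs i lt

At-ordered : ∀ {R : A → A → Set} {xs : List A} → AllPairs R xs → ∀ {i j x y} → i < j →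
             At xs i x → At xs j y → R x y
At-ordered {xs = x ∷ xs} (r ∷ rs) {zero}  {suc j} lt       refl a = All.lookup r (At-∈ xs j a)
At-ordered {xs = x ∷ xs} (r ∷ rs) {suc i} {suc j} (s≤s lt) a    b = At-ordered rs lt a b

suffixes-⊆ : ∀ {xs T : List A} → T ∈ suffixes xs → ∀ {y} → y ∈ T → y ∈ xs
suffixes-⊆ {xs = x ∷ xs} (here refl) i = i
suffixes-⊆ {xs = x ∷ xs} (there t)   i = there (suffixes-⊆ t i)

suffixes-AllPairs : ∀ {R : A → A → Set} {xs T : List A} → AllPairs R xs → T ∈ suffixes xs → AllPairs R T
suffixes-AllPairs {xs = x ∷ xs} rs       (here refl) = rs
suffixes-AllPairs {xs = x ∷ xs} (_ ∷ rs) (there t)   = suffixes-AllPairs rs t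

At? : ∀ {n} (T : List (Subset n)) i F → Dec (At T i F)
At? []      i       F = no λ ()
At? (x ∷ T) zero    F = F ≟ₛ x
At? (x ∷ T) (suc i) F = At? T i F

-- Place `i` of a suffix is its starting place shifted by `i`, so different suffixes show different
-- places of `L`. On a chain this means that a set has index `i` in at most one window.
∑-suffixes-At : ∀ {n} i (L : List (Subset n)) F → ∑ (suffixes L) (λ T → ⟦ At? T i F ⟧) ≤ ∑ L (λ G → ⟦ F ≟ₛ G ⟧)
∑-suffixes-At zero    []      F = z≤n
∑-suffixes-At zero    (G ∷ L) F = +-monoʳ-≤ ⟦ F ≟ₛ G ⟧ (∑-suffixes-At zero L F)
∑-suffixes-At (suc i) L       F = ≤-trans (shift L) (∑-suffixes-At′ L)
  where
  tl : List (Subset _) → List (Subset _)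
  tl []      = []
  tl (_ ∷ L) = L
  shift : ∀ L → ∑ (suffixes L) (λ T → ⟦ At? T (suc i) F ⟧) ≤ ∑ (suffixes (tl L)) (λ T → ⟦ At? T i F ⟧)
  shift []          = z≤n
  shift (x ∷ [])    = z≤n
  shift (x ∷ y ∷ L) = +-monoʳ-≤ ⟦ At? (y ∷ L) i F ⟧ (shift (y ∷ L))
  ∑-suffixes-At′ : ∀ L → ∑ (suffixes (tl L)) (λ T → ⟦ At? T i F ⟧) ≤ ∑ L (λ G → ⟦ F ≟ₛ G ⟧)
  ∑-suffixes-At′ []      = z≤n
  ∑-suffixes-At′ (G ∷ L) = ≤-trans (∑-suffixes-At i L F) (m≤n+m _ ⟦ F ≟ₛ G ⟧)

∑-chain≤1 : ∀ {n} {L : List (Subset n)} → AllPairs _⊂_ L → ∀ F → ∑ L (λ G → ⟦ F ≟ₛ G ⟧) ≤ 1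
∑-chain≤1 [] F = z≤n
∑-chain≤1 {L = G ∷ L} (G⊂ ∷ ps) F with F ≟ₛ G
... | no _ = ∑-chain≤1 ps F
... | yes refl = s≤s (≤-reflexive (∑-zero L λ {H} i → ⟦⟧-no (F ≟ₛ H) λ { refl → ⊂-irref refl (All.lookup G⊂ i) }))

long? : ∀ k (T : List A) → Dec (k ≤ length T)
long? k T = k ≤? length T

-- All places but the last `k` start a suffix of more than `k` members. It is used with `k₁`, hence
-- for windows of `suc k₁` members.
length-suffixes : ∀ k (xs : List A) → length xs ≤ k + length (filter (long? (suc k)) (suffixes xs))
length-suffixes k [] = z≤n
length-suffixes k (x ∷ xs) with long? (suc k) (x ∷ xs)
... | yes l = ≤-trans (s≤s (length-suffixes k xs)) (≤-reflexive (trans (sym (+-suc k _))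
  (cong (λ T → k + length T) (sym (Listₚ.filter-accept (long? (suc k)) {x ∷ xs} {suffixes xs} l)))))
... | no ¬l = ≤-trans (s≤s⁻¹ (≰⇒> ¬l)) (m≤m+n k _)

-- `big` says that the family has size at least `k₁ + 1/e` times the central coefficient. The total
-- weight for pruning is `k * Y`, at most `k * q` times the number of windows, whence the bound
-- required of `h`.
module Ladder {n : ℕ} (k₁ e : ℕ) (𝓕 : List (Subset n)) (𝓕! : Unique 𝓕)
              (big : (e * k₁ + 1) * (n C (n / 2)) ≤ length 𝓕 * e)
              (h : ℕ) (h-large : suc k₁ * (e * k₁ + 1) < h) where

  private
    k = suc k₁
    q = e * k₁ + 1
    𝓜 = 𝓒 n (⊥ {n})
    N : Subset n → ℕ
    N F = ∣ F ∣ ! * (n ∸ ∣ F ∣) !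

    in𝓕? : (F : Subset n) → Dec (F ∈ 𝓕)
    in𝓕? F = F ∈ₗ? 𝓕

    wins : List (Subset n) → List (List (Subset n))
    wins M = filter (long? k) (suffixes (filter in𝓕? M))

    edges = concatMap wins 𝓜
    vertices = concatMap (λ F → map (F ,_) (upTo k)) 𝓕

    Y = ∑ 𝓕 N

    ∑𝓜-through : ∀ F → ∑ 𝓜 (λ M → ⟦ F ∈ₗ? M ⟧) ≡ N F
    ∑𝓜-through F = subst (λ t → ∑ (𝓒 t ⊥) (λ M → ⟦ F ∈ₗ? M ⟧) ≡ N F) split
      (through ∣ F ∣ (n ∸ ∣ F ∣) ⊥ F ⊥⊆ (cong (_+ ∣ F ∣) (∣⊥∣≡0 n)) split)
      where split = m+[n∸m]≡n (∣p∣≤n F)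

    ∣𝓜∣ : ∑ 𝓜 (λ _ → 1) ≡ n !
    ∣𝓜∣ = ∣𝓒∣ n ⊥ (cong (_+ n) (∣⊥∣≡0 n))

    weight : ∑ vertices (N ∘ proj₁) ≡ k * Y
    weight = trans (∑-concatMap _ 𝓕 (N ∘ proj₁)) (trans
      (∑-cong 𝓕 λ {F} _ → trans (∑-map (F ,_) (upTo k) (N ∘ proj₁))
        (trans (∑-const (upTo k) (N F)) (cong (_* N F) (Listₚ.length-upTo k))))
      (∑-*ˡ 𝓕 N k))

    -- Incidences of sets and chains are counted in two ways: a chain with `r` members of the family
    -- carries at least `r ∸ k₁` windows.
    Y≤ : Y ≤ k₁ * n ! + length edges
    Y≤ = begin
      ∑ 𝓕 N                                       ≡⟨ ∑-cong 𝓕 (λ {F} _ → ∑𝓜-through F) ⟨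
      ∑ 𝓕 (λ F → ∑ 𝓜 (λ M → ⟦ F ∈ₗ? M ⟧))         ≡⟨ ∑-swap 𝓕 𝓜 _ ⟩
      ∑ 𝓜 (λ M → ∑ 𝓕 (λ F → ⟦ F ∈ₗ? M ⟧))         ≤⟨ ∑-mono 𝓜 (λ {M} _ → per-chain M) ⟩
      ∑ 𝓜 (λ M → k₁ * 1 + ∑ (wins M) (λ _ → 1))   ≡⟨ ∑-+ 𝓜 _ _ ⟩
      ∑ 𝓜 (λ _ → k₁ * 1) + ∑ 𝓜 (λ M → ∑ (wins M) (λ _ → 1))
        ≡⟨ cong₂ _+_ (trans (∑-*ˡ 𝓜 (λ _ → 1) k₁) (cong (k₁ *_) ∣𝓜∣))
                     (trans (sym (∑-concatMap wins 𝓜 (λ _ → 1))) (sym (length≡∑ edges))) ⟩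
      k₁ * n ! + length edges                      ∎
      where
      open ≤-Reasoning
      per-chain : ∀ M → ∑ 𝓕 (λ F → ⟦ F ∈ₗ? M ⟧) ≤ k₁ * 1 + ∑ (wins M) (λ _ → 1)
      per-chain M = begin
        ∑ 𝓕 (λ F → ⟦ F ∈ₗ? M ⟧)        ≡⟨ length-filter≡∑ (_∈ₗ? M) 𝓕 ⟨
        length (filter (_∈ₗ? M) 𝓕)     ≤⟨ length-∈-mono (Uniqueₚ.filter⁺ (_∈ₗ? M) 𝓕!)
                                            (λ i → let i₁ , i₂ = ∈-filter⁻ (_∈ₗ? M) {xs = 𝓕} i in ∈-filter⁺ in𝓕? i₂ i₁) ⟩
        length (filter in𝓕? M)         ≤⟨ length-suffixes k₁ (filter in𝓕? M) ⟩
        k₁ + length (wins M)           ≡⟨ cong₂ _+_ (sym (*-identityʳ k₁)) (length≡∑ (wins M)) ⟩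
        k₁ * 1 + ∑ (wins M) (λ _ → 1)  ∎

    C≢0 : NonZero (n C (n / 2))
    C≢0 = ≢-nonZero λ C≡0 → <⇒≱ (>-nonZero⁻¹ (n !) {{n !≢0}})
      (≤-trans (central-binomial 0 n refl) (≤-reflexive (trans (cong (0 ! * n ! *_) C≡0) (*-zeroʳ (0 ! * n !)))))

    Ye≥ : q * n ! ≤ Y * e
    Ye≥ = *-cancelʳ-≤ (q * n !) (Y * e) (n C (n / 2)) {{C≢0}} (begin
      q * n ! * c               ≡⟨ e₁ q (n !) c ⟩
      q * c * n !               ≤⟨ *-monoˡ-≤ (n !) big ⟩
      length 𝓕 * e * n !        ≡⟨ e₁ (length 𝓕) e (n !) ⟩
      length 𝓕 * n ! * e        ≡⟨ cong (_* e) (∑-const 𝓕 (n !)) ⟨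
      ∑ 𝓕 (λ _ → n !) * e       ≤⟨ *-monoˡ-≤ e (∑-mono 𝓕 λ {F} _ → central-binomial ∣ F ∣ (n ∸ ∣ F ∣) (m+[n∸m]≡n (∣p∣≤n F))) ⟩
      ∑ 𝓕 (λ F → N F * c) * e   ≡⟨ cong (_* e) (∑-*ʳ 𝓕 N c) ⟩
      Y * c * e                 ≡⟨ e₁ Y c e ⟩
      Y * e * c                 ∎)
      where
      open ≤-Reasoning
      c = n C (n / 2)
      e₁ : ∀ a b c → a * b * c ≡ a * c * b
      e₁ = solve-∀

    -- Multiply `Y≤` by `q` and replace `q * n !` by `Y * e`. As `q = e * k₁ + 1`, cancelling
    -- `e * k₁ * Y` leaves exactly one `Y`.
    Y≤q : Y ≤ q * length edges
    Y≤q = +-cancelˡ-≤ (e * k₁ * Y) _ _ (begin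
      e * k₁ * Y + Y                        ≡⟨ e₁ e k₁ Y ⟩
      q * Y                                 ≤⟨ *-monoʳ-≤ q Y≤ ⟩
      q * (k₁ * n ! + length edges)         ≡⟨ e₂ q k₁ (n !) (length edges) ⟩
      k₁ * (q * n !) + q * length edges     ≤⟨ +-monoˡ-≤ _ (*-monoʳ-≤ k₁ Ye≥) ⟩
      k₁ * (Y * e) + q * length edges       ≡⟨ cong (_+ q * length edges) (e₃ k₁ Y e) ⟩
      e * k₁ * Y + q * length edges         ∎)
      where
      open ≤-Reasoning
      e₁ : ∀ e k y → e * k * y + y ≡ (e * k + 1) * y
      e₁ = solve-∀
      e₂ : ∀ q k n m → q * (k * n + m) ≡ k * (q * n) + q * m
      e₂ = solve-∀
      e₃ : ∀ k y e → k * (y * e) ≡ e * k * y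
      e₃ = solve-∀

  private
    edges-exist : 1 ≤ length edges
    edges-exist with length edges in eq
    ... | suc _ = s≤s z≤n
    ... | zero  = contradiction (≤-trans 1≤qn! (≤-trans Ye≥ Ye≡0)) λ ()
      where
      1≤qn! : 1 ≤ q * n !
      1≤qn! = *-mono-≤ (m≤n+m 1 (e * k₁)) (>-nonZero⁻¹ (n !) {{n !≢0}})
      Ye≡0 : Y * e ≤ 0
      Ye≡0 = *-monoˡ-≤ e (≤-trans Y≤q (≤-reflexive (trans (cong (q *_) eq) (*-zeroʳ q))))

    budget : ∑ vertices (N ∘ proj₁) < h * length edges
    budget = begin-strict
      ∑ vertices (N ∘ proj₁)               ≡⟨ weight ⟩
      k * Y                                ≤⟨ *-monoʳ-≤ k Y≤q ⟩
      k * (q * length edges)               ≡⟨ *-assoc k q (length edges) ⟨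
      k * q * length edges                 <⟨ *-monoˡ-< (length edges) {{>-nonZero edges-exist}} h-large ⟩
      h * length edges                     ∎
      where open ≤-Reasoning

    _∋?_ : (T : List (Subset n)) (v : Subset n × ℕ) → Dec (At T (proj₂ v) (proj₁ v))
    T ∋? (F , i) = At? T i F

    abstract
      pruned : ∃[ es ] ((∃[ T ] T ∈ es) × (∀ f → ∑ es f ≤ ∑ edges f) × (∀ {T} → T ∈ es → T ∈ edges)
                        × Rich _∋?_ h (N ∘ proj₁) es vertices)
      pruned = prune _∋?_ h (N ∘ proj₁) (length vertices) vertices ≤-refl edges budget

    edges′ : List (List (Subset n))
    edges′ = proj₁ pruned

    from-chain : ∀ {T} → T ∈ edges′ → ∃[ M ] (M ∈ 𝓜 × T ∈ wins M)
    from-chain i = find (∈-concatMap⁻ wins {xs = 𝓜} (proj₁ (proj₂ (proj₂ (proj₂ pruned))) i))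

    wins⁻ : ∀ {M T} → M ∈ 𝓜 → T ∈ wins M → k ≤ length T × AllPairs _⊂_ T × (∀ {F} → F ∈ T → F ∈ M × F ∈ 𝓕)
    wins⁻ {M} M∈ i with ∈-filter⁻ (long? k) {xs = suffixes (filter in𝓕? M)} i
    ... | s , len = len
      , suffixes-AllPairs (AllPairsₚ.filter⁺ in𝓕? (𝓒-chain n ⊥ M∈)) s
      , λ j → ∈-filter⁻ in𝓕? {xs = M} (suffixes-⊆ s j)

  Alive : Subset n → ℕ → Set
  Alive F i = ∃[ T ] (T ∈ edges′ × At T i F)

  alive-∈ : ∀ {F i} → Alive F i → F ∈ 𝓕
  alive-∈ {F} {i} (T , T∈ , at) with from-chain T∈
  ... | M , M∈ , T∈M = proj₂ (proj₂ (proj₂ (wins⁻ M∈ T∈M)) (At-∈ T i at))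

  alive-exists : ∀ {i} → i < k → ∃[ F ] Alive F i
  alive-exists {i} i<k with proj₁ (proj₂ pruned)
  ... | T , T∈ with from-chain T∈
  ... | M , M∈ , T∈M with At-∃ T i (≤-trans i<k (proj₁ (wins⁻ M∈ T∈M)))
  ... | F , at = F , T , T∈ , at

  module _ {i j : ℕ} (i<k : i < k) (j<k : j < k) {R : Subset n → Subset n → Set} (R? : ∀ F G → Dec (R F G))
           (ordered : ∀ {T F G} → AllPairs _⊂_ T → At T i F → At T j G → R F G) where

    -- By richness at least `N F / h` surviving windows have `F` at place `i`. If all of them had a
    -- bad set at place `j`, their chains would realise an event assumed to be rarer than that. `R`
    -- is `_⊂_` or its converse, so that one proof serves both directions.
    alive-neighbour : ∀ {F} → Alive F i → {Bad : Subset n → Set} (Bad? : Decidable Bad) →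
      h * ∑ 𝓜 (λ M → ⟦ F ∈ₗ? M ×-dec Any.any? (λ G → in𝓕? G ×-dec (R? F G ×-dec Bad? G)) M ⟧) < N F →
      ∃[ G ] (Alive G j × R F G × ¬ Bad G)
    alive-neighbour {F} alive@(T₀ , T₀∈ , at₀) {Bad} Bad? few
      with Any.any? (λ T → At? T i F ×-dec Any.any? (λ G → At? T j G ×-dec ¬? (Bad? G)) T) edges′
    ... | yes found with find found
    ...   | T , T∈ , at , r with find r | from-chain T∈
    ...   | G , _ , atG , ¬bad | M , M∈ , T∈M =
      G , (T , T∈ , atG) , ordered (proj₁ (proj₂ (wins⁻ M∈ T∈M))) at atG , ¬bad
    alive-neighbour {F} alive@(T₀ , T₀∈ , at₀) {Bad} Bad? few | no none =
      contradiction (≤-trans rich (*-monoʳ-≤ h bound)) (<⇒≱ few)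
      where
      rich : N F ≤ h * ∑ edges′ (λ T → ⟦ At? T i F ⟧)
      rich = proj₂ (proj₂ (proj₂ (proj₂ pruned)))
        (∈-concatMap⁺ (λ F → map (F ,_) (upTo k)) (lose (alive-∈ alive) (∈-map⁺ (F ,_) (∈-upTo⁺ i<k)))) T₀∈ at₀
      open ≤-Reasoning
      BadT? = λ T → At? T i F ×-dec Any.any? (λ G → At? T j G ×-dec Bad? G) T
      event? = λ M → F ∈ₗ? M ×-dec Any.any? (λ G → in𝓕? G ×-dec (R? F G ×-dec Bad? G)) M
      always-bad : ∀ {T} → T ∈ edges′ → At T i F → At T i F × Any (λ G → At T j G × Bad G) T
      always-bad {T} T∈ at with from-chain T∈
      ... | M , M∈ , T∈M with At-∃ T j (≤-trans j<k (proj₁ (wins⁻ M∈ T∈M)))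
      ... | G , atG with Bad? G
      ... | yes bad = at , lose (At-∈ T j atG) (atG , bad)
      ... | no ¬bad = contradiction (lose T∈ (at , lose (At-∈ T j atG) (atG , ¬bad))) none
      per-chain : ∀ {M} → M ∈ 𝓜 → ∑ (wins M) (λ T → ⟦ BadT? T ⟧) ≤ ⟦ event? M ⟧
      per-chain {M} M∈ with event? M
      ... | no ¬ev = ≤-reflexive (∑-zero (wins M) λ {T} T∈M → ⟦⟧-no (BadT? T) λ (at , r) →
        case find r of λ { (G , G∈ , atG , bad) →
          let _ , chain , sub = wins⁻ M∈ T∈M in
          ¬ev (proj₁ (sub (At-∈ T i at)) , lose (proj₁ (sub G∈)) (proj₂ (sub G∈) , ordered chain at atG , bad)) })
      -- At most one window of the chain has `F` at place `i`, so windows and chains are counted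
      -- alike.
      ... | yes _ = begin
        ∑ (wins M) (λ T → ⟦ BadT? T ⟧)      ≤⟨ ∑-mono (wins M) (λ {T} _ → ⟦⟧-mono (BadT? T) (At? T i F) proj₁) ⟩
        ∑ (wins M) (λ T → ⟦ At? T i F ⟧)    ≡⟨ ∑-filter (long? k) (suffixes L) _ ⟩
        ∑ (suffixes L) (λ T → ⟦ long? k T ⟧ * ⟦ At? T i F ⟧)
          ≤⟨ ∑-mono (suffixes L) (λ {T} _ → ≤-trans (*-monoˡ-≤ _ (⟦⟧≤1 (long? k T))) (≤-reflexive (*-identityˡ _))) ⟩
        ∑ (suffixes L) (λ T → ⟦ At? T i F ⟧) ≤⟨ ∑-suffixes-At i L F ⟩
        ∑ L (λ G → ⟦ F ≟ₛ G ⟧)              ≤⟨ ∑-chain≤1 (AllPairsₚ.filter⁺ in𝓕? (𝓒-chain n ⊥ M∈)) F ⟩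
        1                                    ∎
        where L = filter in𝓕? M
      bound : ∑ edges′ (λ T → ⟦ At? T i F ⟧) ≤ ∑ 𝓜 (λ M → ⟦ event? M ⟧)
      bound = begin
        ∑ edges′ (λ T → ⟦ At? T i F ⟧)                ≤⟨ ∑-mono edges′ (λ {T} T∈ → ⟦⟧-mono (At? T i F) (BadT? T) (always-bad T∈)) ⟩
        ∑ edges′ (λ T → ⟦ BadT? T ⟧)                  ≤⟨ proj₁ (proj₂ (proj₂ pruned)) (λ T → ⟦ BadT? T ⟧) ⟩
        ∑ edges (λ T → ⟦ BadT? T ⟧)                   ≡⟨ ∑-concatMap wins 𝓜 _ ⟩
        ∑ 𝓜 (λ M → ∑ (wins M) (λ T → ⟦ BadT? T ⟧))    ≤⟨ ∑-mono 𝓜 per-chain ⟩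
        ∑ 𝓜 (λ M → ⟦ event? M ⟧)                      ∎

-- Tree posets

-- Double-negation shift over a finite index set: while a negation is being proved, the order may be
-- assumed decidable.
¬¬-∀ : ∀ {m} {P : Fin m → Set} → (∀ i → ¬ ¬ P i) → ¬ ¬ (∀ i → P i)
¬¬-∀ {zero}  h k = k λ ()
¬¬-∀ {suc m} h k = h zero λ p₀ → ¬¬-∀ (h ∘ suc) λ ps → k λ { zero → p₀ ; (suc i) → ps i }

module TreePoset {m : ℕ} (_<P_ : Fin m → Fin m → Set) (isSPO : IsStrictPartialOrder _≡_ _<P_)
                 (isTree : IsTreePoset _<P_) where

  open IsStrictPartialOrder isSPO using () renaming (trans to <P-trans; irrefl to <P-irrefl; asym to <P-asym)

  private
    1≤m : 1 ≤ m
    1≤m = proj₁ isTree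

    paths : ∀ x y → ∃[ vs ] HassePath _<P_ x y vs
    paths = proj₁ (proj₂ isTree)

    paths-unique : ∀ x y vs ws → HassePath _<P_ x y vs → HassePath _<P_ x y ws → vs ≡ ws
    paths-unique = proj₂ (proj₂ isTree)

    Walk = HasseWalk _<P_

    linked⇒pairs : ∀ {vs} → Linked _<P_ vs → AllPairs _<P_ vs
    linked⇒pairs = Linkedₚ.Linked⇒AllPairs <P-trans

    pairs⇒unique : ∀ {vs} → AllPairs _<P_ vs → Unique vs
    pairs⇒unique = AllPairs.map λ x<y → λ { refl → <P-irrefl refl x<y }

    prepend : ∀ {x y z vs} → x <P y → Walk y z vs → Linked _<P_ vs → Linked _<P_ (x ∷ vs)
    prepend x<y (here _)   l = x<y ∷ l
    prepend x<y (step _ _) l = x<y ∷ l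

    head-linked : ∀ {x y z vs} → Walk y z vs → Linked _<P_ (x ∷ vs) → x <P y × Linked _<P_ vs
    head-linked (here _)   (x<y ∷ l) = x<y , l
    head-linked (step _ _) (x<y ∷ l) = x<y , l

    -- Each Hasse step carries its own direction, so monotonicity of a walk is decidable although
    -- `_<P_` is not assumed to be.
    linked? : ∀ {x y vs} → Walk x y vs → Dec (Linked _<P_ vs)
    linked? (here x) = yes [-]
    linked? (step (inj₁ (x<y , _)) w) with linked? w
    ... | yes l = yes (prepend x<y w l)
    ... | no ¬l = no (¬l ∘ proj₂ ∘ head-linked w)
    linked? (step (inj₂ (y<x , _)) w) = no λ l → <P-asym y<x (proj₁ (head-linked w l))

    start∈ : ∀ {x y vs} → Walk x y vs → x ∈ vs
    start∈ (here _)   = here refl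
    start∈ (step _ _) = here refl

    end∈ : ∀ {x y vs} → Walk x y vs → y ∈ vs
    end∈ (here _)   = here refl
    end∈ (step _ w) = there (end∈ w)

    linked-ends : ∀ {x y vs} → Walk x y vs → Linked _<P_ vs → x ≡ y ⊎ x <P y
    linked-ends (here _)       l = inj₁ refl
    linked-ends (step {x} a w) l with head-linked w l
    ... | x<z , l′ = case linked-ends w l′ of λ where
      (inj₁ refl) → inj₂ x<z
      (inj₂ z<y)  → inj₂ (<P-trans x<z z<y)

    module _ (dec : ∀ x y → Dec (x <P y)) where

      cover-above : ∀ {x y} → x <P y → ∃[ z ] (Covers _<P_ x z × (z ≡ y ⊎ z <P y))
      cover-above {x} {y} x<y = go y x<y (spo-wellFounded isSPO y)
        where
        go : ∀ y → x <P y → Acc _<P_ y → ∃[ z ] (Covers _<P_ x z × (z ≡ y ⊎ z <P y))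
        go y x<y (acc rs) with Finₚ.any? (λ z → dec x z ×-dec dec z y)
        ... | no none = y , (x<y , none) , inj₁ refl
        ... | yes (w , x<w , w<y) with go w x<w (rs w<y)
        ... | z , c , inj₁ refl = z , c , inj₂ w<y
        ... | z , c , inj₂ z<w  = z , c , inj₂ (<P-trans z<w w<y)

      ascending-path : ∀ {x y} → x <P y → ∃[ vs ] (Walk x y vs × Linked _<P_ vs)
      ascending-path {x} x<y = go x<y (spo-noetherian isSPO x)
        where
        go : ∀ {x y} → x <P y → Acc (λ u v → v <P u) x → ∃[ vs ] (Walk x y vs × Linked _<P_ vs)
        go {x} {y} x<y (acc rs) with cover-above x<y
        ... | z , c , inj₁ refl = _ , step (inj₁ c) (here y) , proj₁ c ∷ [-]
        ... | z , c , inj₂ z<y with go z<y (rs (proj₁ c))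
        ... | vs , w , l = _ , step (inj₁ c) w , prepend (proj₁ c) w l

      -- A saturated chain from `x` to `y` is itself a Hasse path, hence the only one.
      ascending : ∀ {x y vs} → x <P y → HassePath _<P_ x y vs → Linked _<P_ vs
      ascending {x} {y} {vs} x<y path with ascending-path x<y
      ... | ws , w , l = subst (Linked _<P_)
        (paths-unique x y ws vs (w , pairs⇒unique (linked⇒pairs l)) path) l

  -- Along the unique Hasse path, x < y can be read off from the directions of the steps.
  _<P?_ : ∀ x y → Dec (x <P y)
  x <P? y with paths x y
  ... | vs , w , u with linked? w
  ... | no ¬l = no λ x<y → ¬¬-∀ (λ x → ¬¬-∀ (λ y → ¬¬-excluded-middle))
                  (λ dec → ¬l (ascending dec x<y (w , u)))
  ... | yes l with linked-ends w l
  ... | inj₁ refl = no (<P-irrefl refl)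
  ... | inj₂ x<y  = yes x<y

  private
    before-end : ∀ {x y v vs} → Walk x y vs → AllPairs _<P_ vs → v ∈ vs → v ≡ y ⊎ v <P y
    before-end (here _)   ps       (here refl) = inj₁ refl
    before-end (step a w) (p ∷ ps) (here refl) = inj₂ (All.lookup p (end∈ w))
    before-end (step a w) (p ∷ ps) (there i)   = before-end w ps i

    after-start : ∀ {x y v vs} → Walk x y vs → AllPairs _<P_ vs → v ∈ vs → v ≡ x ⊎ x <P v
    after-start (here _)   ps       (here refl) = inj₁ refl
    after-start (step a w) (p ∷ ps) (here refl) = inj₁ refl
    after-start (step a w) (p ∷ ps) (there i)   = inj₂ (All.lookup p i)

    on-path : ∀ {x y v vs} → x <P y → HassePath _<P_ x y vs → v ∈ vs → (v ≡ x ⊎ x <P v) × (v ≡ y ⊎ v <P y)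
    on-path x<y path@(w , _) i = let ps = linked⇒pairs (ascending _<P?_ x<y path) in
      after-start w ps i , before-end w ps i

  -- An order in which to place the vertices. Each new `x` is attached to one `p`, and the side
  -- conditions say that its relations to the vertices already present are exactly those inherited
  -- through `p`.
  data Build : List (Fin m) → Set where
    root  : ∀ x → Build (x ∷ [])
    above : ∀ {S p x} → Build S → p ∈ S → x ∉ S → p <P x →
            (∀ {y} → y ∈ S → y <P x → y ≡ p ⊎ y <P p) → (∀ {y} → y ∈ S → ¬ x <P y) → Build (x ∷ S)
    below : ∀ {S p x} → Build S → p ∈ S → x ∉ S → x <P p →
            (∀ {y} → y ∈ S → x <P y → y ≡ p ⊎ p <P y) → (∀ {y} → y ∈ S → ¬ y <P x) → Build (x ∷ S)

  private
    Connected : List (Fin m) → Set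
    Connected S = ∀ {x y} → x ∈ S → y ∈ S → ∃[ vs ] (HassePath _<P_ x y vs × All (_∈ S) vs)

    snoc : ∀ {x y z vs} → Walk x y vs → HasseAdj _<P_ y z → Walk x z (vs ++ z ∷ [])
    snoc (here x)   a = step a (here _)
    snoc (step b w) a = step b (snoc w a)

    adj-sym : ∀ {x y} → HasseAdj _<P_ x y → HasseAdj _<P_ y x
    adj-sym (inj₁ c) = inj₂ c
    adj-sym (inj₂ c) = inj₁ c

    ∉⇒All≢ : ∀ {S vs : List (Fin m)} {x} → x ∉ S → All (_∈ S) vs → All (x ≢_) vs
    ∉⇒All≢ x∉ = All.map λ { i refl → x∉ i }

    cons-path : ∀ {S x p y vs} → x ∉ S → HasseAdj _<P_ x p → HassePath _<P_ p y vs → All (_∈ S) vs →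
                HassePath _<P_ x y (x ∷ vs)
    cons-path x∉ a (w , u) vs⊆ = step a w , ∉⇒All≢ x∉ vs⊆ ∷ u

    snoc-unique : ∀ {vs : List (Fin m)} {x} → Unique vs → All (x ≢_) vs → Unique (vs ++ x ∷ [])
    snoc-unique {x = x} u ne = AllPairsₚ.++⁺ u ([] ∷ [])
      (All.map (λ x≢v → (λ v≡x → x≢v (sym v≡x)) ∷ []) ne)

    snoc-path : ∀ {S x p y vs} → x ∉ S → HasseAdj _<P_ p x → HassePath _<P_ y p vs → All (_∈ S) vs →
                HassePath _<P_ y x (vs ++ x ∷ [])
    snoc-path x∉ a (w , u) vs⊆ = snoc w a , snoc-unique u (∉⇒All≢ x∉ vs⊆)

    connected-∷ : ∀ {S x p} → Connected S → p ∈ S → x ∉ S → HasseAdj _<P_ p x → Connected (x ∷ S)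
    connected-∷ {S} {x} conn p∈ x∉ a (here refl) (here refl) =
      x ∷ [] , (here x , [] ∷ []) , here refl ∷ []
    connected-∷ {S} {x} conn p∈ x∉ a (here refl) (there j) with conn p∈ j
    ... | vs , path , vs⊆ = x ∷ vs , cons-path x∉ (adj-sym a) path vs⊆ , here refl ∷ All.map there vs⊆
    connected-∷ {S} {x} conn p∈ x∉ a (there i) (here refl) with conn i p∈
    ... | vs , path , vs⊆ = vs ++ x ∷ [] , snoc-path x∉ a path vs⊆
                          , Allₚ.++⁺ (All.map there vs⊆) (here refl ∷ [])
    connected-∷ {S} {x} conn p∈ x∉ a (there i) (there j) with conn i j
    ... | vs , path , vs⊆ = vs , path , All.map there vs⊆

    module _ {S x p} (conn : Connected S) (p∈ : p ∈ S) (x∉ : x ∉ S) (a : HasseAdj _<P_ p x) where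

      -- The path inside `S` from `y` to `p`, prolonged to `x`, is the Hasse path from `y` to `x`.
      -- When `y <P x` it ascends, and `p` lies on it.
      via-below : ∀ {y} → y ∈ S → y <P x → (p ≡ y ⊎ y <P p) × (p ≡ x ⊎ p <P x)
      via-below y∈ y<x with conn y∈ p∈
      ... | vs , path , vs⊆ = on-path y<x (snoc-path x∉ a path vs⊆) (∈-++⁺ˡ (end∈ (proj₁ path)))

      via-above : ∀ {y} → y ∈ S → x <P y → (p ≡ x ⊎ x <P p) × (p ≡ y ⊎ p <P y)
      via-above y∈ x<y with conn p∈ y∈
      ... | vs , path , vs⊆ = on-path x<y (cons-path x∉ (adj-sym a) path vs⊆) (there (start∈ (proj₁ path)))

      grow : Build S → Build (x ∷ S)
      grow b = case a of λ where
       (inj₁ (p<x , _)) → above b p∈ x∉ p<x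
        (λ y∈ y<x → [ (λ { refl → inj₁ refl }) , inj₂ ]′ (proj₁ (via-below y∈ y<x)))
        -- An element of `S` above `x` would place `p` on an ascending path that starts at `x`,
        -- against `p <P x`.
        (λ y∈ x<y → [ (λ { refl → <P-irrefl refl p<x }) , <P-asym p<x ]′ (proj₁ (via-above y∈ x<y)))
       (inj₂ (x<p , _)) → below b p∈ x∉ x<p
        (λ y∈ x<y → [ (λ { refl → inj₁ refl }) , inj₂ ]′ (proj₂ (via-above y∈ x<y)))
        (λ y∈ y<x → [ (λ { refl → <P-irrefl refl x<p }) , <P-asym x<p ]′ (proj₂ (via-below y∈ y<x)))

    Stage : List (Fin m) → Set
    Stage S = Build S × Connected S

    _∈P?_ : ∀ (x : Fin m) S → Dec (x ∈ S)
    x ∈P? S = Any.any? (x Finₚ.≟_) S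

    -- Vertices of the walk missing from `S` are attached one at a time, each to its predecessor, so
    -- every stage stays connected.
    reach : ∀ {S x y vs} → Walk x y vs → Stage S → x ∈ S →
            ∃[ S′ ] (Stage S′ × (∀ {z} → z ∈ S → z ∈ S′) × y ∈ S′)
    reach (here x) st x∈ = _ , st , (λ i → i) , x∈
    reach {S} (step {y = y} a w) st@(b , conn) x∈ with y ∈P? S
    ... | yes y∈ = reach w st y∈
    ... | no  y∉ with reach w (grow conn x∈ y∉ a b , connected-∷ conn x∈ y∉ a) (here refl)
    ... | S′ , st′ , sub , z∈ = S′ , st′ , sub ∘ there , z∈

    cover : ∀ {x₀ S} (ts : List (Fin m)) → Stage S → x₀ ∈ S →
            ∃[ S′ ] (Stage S′ × x₀ ∈ S′ × (∀ {z} → z ∈ S → z ∈ S′) × All (_∈ S′) ts)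
    cover [] st x₀∈ = _ , st , x₀∈ , (λ i → i) , []
    cover {x₀} (t ∷ ts) st x₀∈ with reach (proj₁ (proj₂ (paths x₀ t))) st x₀∈
    ... | S₁ , st₁ , sub₁ , t∈ with cover ts st₁ (sub₁ x₀∈)
    ... | S₂ , st₂ , x₀∈₂ , sub₂ , ts⊆ = S₂ , st₂ , x₀∈₂ , sub₂ ∘ sub₁ , sub₂ t∈ ∷ ts⊆

  private
    x₀ : Fin m
    x₀ = fromℕ< 1≤m

  build-all : ∃[ S ] (Build S × (∀ x → x ∈ S))
  build-all with cover (allFin m) (root x₀ , conn₀) (here refl)
    where
    conn₀ : Connected (x₀ ∷ [])
    conn₀ (here refl) (here refl) = x₀ ∷ [] , (here x₀ , [] ∷ []) , here refl ∷ []
  ... | S , (b , _) , _ , _ , all = S , b , λ x → All.lookup all (∈-allFin x)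

  -- Ranks from the height

  module _ {k : ℕ} (height : HasHeight _<P_ k) where

    private
      UpChain : ℕ → Fin m → Set
      UpChain zero    x = Unit
      UpChain (suc t) x = ∃[ y ] (x <P y × UpChain t y)

      upChain? : ∀ t x → Dec (UpChain t x)
      upChain? zero    x = yes _
      upChain? (suc t) x = Finₚ.any? λ y → (x <P? y) ×-dec upChain? t y

      chain-list : ∀ t x → UpChain t x → ∃[ cs ] (Linked _<P_ (x ∷ cs) × length cs ≡ t)
      chain-list zero    x _ = [] , [-] , refl
      chain-list (suc t) x (y , x<y , c) with chain-list t y c
      ... | cs , l , refl = y ∷ cs , x<y ∷ l , refl

      upChain-bound : ∀ {t x} → UpChain t x → t ≤ k ∸ 1
      upChain-bound {t} {x} c with chain-list t x c
      ... | cs , l , refl = ∸-monoˡ-≤ 1 (proj₂ height (x ∷ cs) l)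

      longest : ∀ b x → ∃[ t ] (UpChain t x × t ≤ b × (∀ s → s ≤ b → UpChain s x → s ≤ t))
      longest zero    x = 0 , _ , z≤n , λ s s≤ _ → s≤
      longest (suc b) x with upChain? (suc b) x
      ... | yes c = suc b , c , ≤-refl , λ s s≤ _ → s≤
      ... | no ¬c with longest b x
      ... | t , c , t≤ , max = t , c , m≤n⇒m≤1+n t≤ , λ s s≤ cs → case m≤n⇒m<n∨m≡n s≤ of λ where
        (inj₁ s<) → max s (s≤s⁻¹ s<) cs
        (inj₂ refl) → contradiction cs ¬c

      corank : Fin m → ℕ
      corank x = proj₁ (longest (k ∸ 1) x)

    1≤height : 1 ≤ k
    1≤height = proj₂ height (x₀ ∷ []) [-]

    -- Measured from the top: `corank x` is the number of elements above `x` in a longest chain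
    -- starting at `x`. The height bounds it by `k ∸ 1`, so the truncated subtraction loses nothing
    -- and the rank is strictly monotone.
    rank : Fin m → ℕ
    rank x = k ∸ 1 ∸ corank x

    rank<k : ∀ x → rank x < k
    rank<k x = ≤-trans (s≤s (m∸n≤m (k ∸ 1) (corank x))) (≤-reflexive (m+[n∸m]≡n 1≤height))

    rank-mono : ∀ {x y} → x <P y → rank x < rank y
    rank-mono {x} {y} x<y with longest (k ∸ 1) x | longest (k ∸ 1) y
    ... | s , _ , s≤ , max | t , c , _ , _ =
      ∸-monoʳ-< {k ∸ 1} (max (suc t) (upChain-bound {suc t} {x} (y , x<y , c)) (y , x<y , c)) s≤

-- The central window

-- Bernoulli's inequality for `1 + x / Y`, denominators cleared.
bernoulli : ∀ Y x h → Y ^ h * (Y + h * x) ≤ Y * (Y + x) ^ h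
bernoulli Y x zero    = ≤-reflexive (e Y)
  where
  e : ∀ Y → 1 * (Y + 0) ≡ Y * 1
  e = solve-∀
bernoulli Y x (suc h) = begin
  Y * Y ^ h * (Y + (x + h * x))               ≤⟨ m≤m+n _ (Y ^ h * (h * x * x)) ⟩
  Y * Y ^ h * (Y + (x + h * x)) + Y ^ h * (h * x * x) ≡⟨ e₁ Y (Y ^ h) x h ⟩
  (Y + x) * (Y ^ h * (Y + h * x))             ≤⟨ *-monoʳ-≤ (Y + x) (bernoulli Y x h) ⟩
  (Y + x) * (Y * (Y + x) ^ h)                 ≡⟨ e₂ (Y + x) Y ((Y + x) ^ h) ⟩
  Y * ((Y + x) * (Y + x) ^ h)                 ∎
  where
  open ≤-Reasoning
  e₁ : ∀ Y P x h → Y * P * (Y + (x + h * x)) + P * (h * x * x) ≡ (Y + x) * (P * (Y + h * x))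
  e₁ = solve-∀
  e₂ : ∀ a b c → a * (b * c) ≡ b * (a * c)
  e₂ = solve-∀

halves : ∀ N → 2 ≤ N → ∃[ h ] (1 ≤ h × (N ≡ h + h ⊎ N ≡ suc (h + h)))
halves (suc zero) (s≤s ())
halves (suc (suc zero))       _ = 1 , s≤s z≤n , inj₁ refl
halves (suc (suc (suc zero))) _ = 1 , s≤s z≤n , inj₂ refl
halves (suc (suc N@(suc (suc _)))) _ with halves N (s≤s (s≤s z≤n))
... | h , 1≤h , inj₁ eq = suc h , s≤s z≤n , inj₁ (trans (cong (2 +_) eq) (cong suc (sym (+-suc h h))))
... | h , 1≤h , inj₂ eq = suc h , s≤s z≤n , inj₂ (trans (cong (2 +_) eq) (cong (λ x → suc (suc x)) (sym (+-suc h h))))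

-- Two Bernoulli factors, from the two halves of the exponent, give a bound quadratic in N x.
bernoulli² : ∀ Y x N h → N ≡ h + h ⊎ N ≡ suc (h + h) → Y ^ N * ((h * x) * (h * x)) ≤ Y * Y * (Y + x) ^ N
bernoulli² Y x N h N≡ = begin
  Y ^ N * ((h * x) * (h * x))    ≤⟨ *-monoʳ-≤ (Y ^ N) (*-mono-≤ (m≤n+m (h * x) Y) (m≤n+m (h * x) Y)) ⟩
  Y ^ N * ((Y + h * x) * (Y + h * x)) ≤⟨ go N≡ ⟩
  Y * Y * (Y + x) ^ N            ∎
  where
  open ≤-Reasoning
  even : Y ^ (h + h) * ((Y + h * x) * (Y + h * x)) ≤ Y * Y * (Y + x) ^ (h + h)
  even = begin
    Y ^ (h + h) * ((Y + h * x) * (Y + h * x))         ≡⟨ cong (_* ((Y + h * x) * (Y + h * x))) (^-distribˡ-+-* Y h h) ⟩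
    Y ^ h * Y ^ h * ((Y + h * x) * (Y + h * x))       ≡⟨ e (Y ^ h) (Y ^ h) (Y + h * x) (Y + h * x) ⟩
    (Y ^ h * (Y + h * x)) * (Y ^ h * (Y + h * x))     ≤⟨ *-mono-≤ (bernoulli Y x h) (bernoulli Y x h) ⟩
    (Y * (Y + x) ^ h) * (Y * (Y + x) ^ h)             ≡⟨ e Y Y ((Y + x) ^ h) ((Y + x) ^ h) ⟨
    Y * Y * ((Y + x) ^ h * (Y + x) ^ h)               ≡⟨ cong (Y * Y *_) (^-distribˡ-+-* (Y + x) h h) ⟨
    Y * Y * (Y + x) ^ (h + h)                         ∎
    where
    e : ∀ a b c d → a * b * (c * d) ≡ (a * c) * (b * d)
    e = solve-∀
  go : N ≡ h + h ⊎ N ≡ suc (h + h) → Y ^ N * ((Y + h * x) * (Y + h * x)) ≤ Y * Y * (Y + x) ^ N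
  go (inj₁ refl) = even
  go (inj₂ refl) = begin
    Y * Y ^ (h + h) * ((Y + h * x) * (Y + h * x))     ≡⟨ *-assoc Y (Y ^ (h + h)) _ ⟩
    Y * (Y ^ (h + h) * ((Y + h * x) * (Y + h * x)))   ≤⟨ *-mono-≤ (m≤m+n Y x) even ⟩
    (Y + x) * (Y * Y * (Y + x) ^ (h + h))             ≡⟨ e (Y + x) (Y * Y) ((Y + x) ^ (h + h)) ⟩
    Y * Y * ((Y + x) * (Y + x) ^ (h + h))             ∎
    where
    e : ∀ a b c → a * (b * c) ≡ b * (a * c)
    e = solve-∀

-- Since `(Y ∸ x) * (Y + x) ≤ Y * Y`, a lower bound on powers of `1 - x / Y` becomes an upper bound
-- on powers of `1 + x / Y`, to which Bernoulli applies.
flip-power : ∀ Y x N n → x < Y → Y ^ N < n * (Y ∸ x) ^ N → (Y + x) ^ N < n * Y ^ N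
flip-power Y x N n x<Y lt = *-cancelˡ-< (Y ^ N) _ _ (begin-strict
  Y ^ N * (Y + x) ^ N                ≡⟨ *-comm (Y ^ N) _ ⟩
  (Y + x) ^ N * Y ^ N                <⟨ *-monoʳ-< ((Y + x) ^ N) {{m^n≢0 (Y + x) N {{>-nonZero (≤-trans (≤-trans (s≤s z≤n) x<Y) (m≤m+n Y x))}}}} lt ⟩
  (Y + x) ^ N * (n * z ^ N)          ≡⟨ e₁ ((Y + x) ^ N) n (z ^ N) ⟩
  n * (z ^ N * (Y + x) ^ N)          ≡⟨ cong (n *_) (^-distribʳ-* N z (Y + x)) ⟨
  n * (z * (Y + x)) ^ N              ≤⟨ *-monoʳ-≤ n (^-monoˡ-≤ N square) ⟩
  n * (Y * Y) ^ N                    ≡⟨ cong (n *_) (^-distribʳ-* N Y Y) ⟩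
  n * (Y ^ N * Y ^ N)                ≡⟨ e₂ n (Y ^ N) (Y ^ N) ⟩
  Y ^ N * (n * Y ^ N)                ∎)
  where
  open ≤-Reasoning
  z = Y ∸ x
  z+x : z + x ≡ Y
  z+x = m∸n+n≡m (<⇒≤ x<Y)
  e₁ : ∀ a b c → a * (b * c) ≡ b * (c * a)
  e₁ = solve-∀
  e₂ : ∀ a b c → a * (b * c) ≡ b * (a * c)
  e₂ = solve-∀
  e₃ : ∀ z x → z * (z + x + x) + x * x ≡ (z + x) * (z + x)
  e₃ = solve-∀
  square : z * (Y + x) ≤ Y * Y
  square = begin
    z * (Y + x)                ≡⟨ cong (λ y → z * (y + x)) z+x ⟨
    z * (z + x + x)            ≤⟨ m≤m+n _ (x * x) ⟩
    z * (z + x + x) + x * x    ≡⟨ e₃ z x ⟩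
    (z + x) * (z + x)          ≡⟨ cong (λ y → y * y) z+x ⟩
    Y * Y                      ∎

-- For `x = d * d` this bounds the fourth power of the deviation `d` by a multiple of `n * n * n`,
-- so `d = o(n)`. A single Bernoulli factor would give only `x = O(n * n)`, which is useless. The
-- constant 2304 is the square of 48 = 16 * 3, from `N ≤ 3 * h`.
window-quadratic : ∀ n x N → 2 ≤ N → x < 16 * n * N → (16 * n * N) ^ N < n * (16 * n * N ∸ x) ^ N →
                   x * x < 2304 * (n * n * n)
window-quadratic n x N 2≤N x<Y lt with halves N 2≤N
... | h , 1≤h , N≡ = *-cancelˡ-< (h * h) _ _ (begin-strict
  h * h * (x * x)               ≡⟨ e₁ h x ⟩
  (h * x) * (h * x)             <⟨ *-cancelˡ-< (Y ^ N) _ _ (begin-strict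
      Y ^ N * ((h * x) * (h * x))  ≤⟨ bernoulli² Y x N h N≡ ⟩
      Y * Y * (Y + x) ^ N          <⟨ *-monoʳ-< (Y * Y) {{m*n≢0 Y Y {{Y≢0}} {{Y≢0}}}} (flip-power Y x N n x<Y lt) ⟩
      Y * Y * (n * Y ^ N)          ≡⟨ e₂ (Y * Y) n (Y ^ N) ⟩
      Y ^ N * (n * (Y * Y))        ∎) ⟩
  n * (Y * Y)                   ≤⟨ *-monoʳ-≤ n (*-mono-≤ Y≤ Y≤) ⟩
  n * (16 * n * (3 * h) * (16 * n * (3 * h))) ≡⟨ e₃ n h ⟩
  h * h * (2304 * (n * n * n))  ∎)
  where
  open ≤-Reasoning
  Y = 16 * n * N
  Y≢0 : NonZero Y
  Y≢0 = >-nonZero (≤-trans (s≤s z≤n) x<Y)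
  N≤3h : N ≡ h + h ⊎ N ≡ suc (h + h) → N ≤ 3 * h
  N≤3h (inj₁ refl) = ≤-trans (m≤m+n (h + h) h) (≤-reflexive (e h))
    where
    e : ∀ h → h + h + h ≡ 3 * h
    e = solve-∀
  N≤3h (inj₂ refl) = ≤-trans (+-monoˡ-≤ (h + h) 1≤h) (≤-reflexive (e h))
    where
    e : ∀ h → h + (h + h) ≡ 3 * h
    e = solve-∀
  Y≤ : Y ≤ 16 * n * (3 * h)
  Y≤ = *-monoʳ-≤ (16 * n) (N≤3h N≡)
  e₁ : ∀ h x → h * h * (x * x) ≡ (h * x) * (h * x)
  e₁ = solve-∀
  e₂ : ∀ a b c → a * (b * c) ≡ c * (b * a)
  e₂ = solve-∀
  e₃ : ∀ n h → n * (16 * n * (3 * h) * (16 * n * (3 * h))) ≡ h * h * (2304 * (n * n * n))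
  e₃ = solve-∀

-- If `n < K * d`, fourth powers and `window-quadratic` give `n < 2304 * (K * K * (K * K))`.
window-narrow : ∀ K n → 1 ≤ K → 2304 * (K * K * (K * K)) ≤ n → (F : Subset n) → InWindow n F →
                K * ∣ 2 * ∣ F ∣ - n ∣ ≤ n
window-narrow K n 1≤K n≥ F (N , x<Y , lt) = ≮⇒≥ λ n<Kd →
  let n²<K²x : n * n < K * K * (d * d)
      n²<K²x = ≤-trans (*-mono-< n<Kd n<Kd) (≤-reflexive (e₁ K d))
      n²<K²Y : n * n < n * (16 * (K * K) * N)
      n²<K²Y = ≤-trans n²<K²x (≤-trans (*-monoʳ-≤ (K * K) (<⇒≤ x<Y)) (≤-reflexive (e₂ K n N)))
      n<K²N : n < 16 * (K * K) * N
      n<K²N = *-cancelˡ-< n _ _ n²<K²Y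
      -- The halved exponent must be positive; `N ≤ 1` would force `n < 16 * (K * K)`.
      2≤N : 2 ≤ N
      2≤N = ≮⇒≥ λ N<2 → <⇒≱ n<K²N (≤-trans (*-monoʳ-≤ (16 * (K * K)) (s≤s⁻¹ N<2)) 16K²≤n)
      x²< = window-quadratic n (d * d) N 2≤N x<Y lt
  in <⇒≱ (*-cancelˡ-< (n * n * n) n (2304 * (K * K * (K * K))) (begin-strict
      n * n * n * n                            ≡⟨ e₃ n ⟩
      (n * n) * (n * n)                        <⟨ *-mono-< n²<K²x n²<K²x ⟩
      (K * K * (d * d)) * (K * K * (d * d))    ≡⟨ e₄ K (d * d) ⟩
      (K * K * (K * K)) * (d * d * (d * d))    ≤⟨ *-monoʳ-≤ (K * K * (K * K)) (<⇒≤ x²<) ⟩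
      (K * K * (K * K)) * (2304 * (n * n * n)) ≡⟨ e₅ (K * K * (K * K)) (n * n * n) 2304 ⟩
      n * n * n * (2304 * (K * K * (K * K)))   ∎)) n≥
  where
  open ≤-Reasoning
  d = ∣ 2 * ∣ F ∣ - n ∣
  e₁ : ∀ K d → K * d * (K * d) ≡ K * K * (d * d)
  e₁ = solve-∀
  e₂ : ∀ K n N → K * K * (16 * n * N) ≡ n * (16 * (K * K) * N)
  e₂ = solve-∀
  e₃ : ∀ n → n * n * n * n ≡ (n * n) * (n * n)
  e₃ = solve-∀
  e₄ : ∀ K x → (K * K * x) * (K * K * x) ≡ (K * K * (K * K)) * (x * x)
  e₄ = solve-∀
  e₅ : ∀ a b c → a * (c * b) ≡ b * (c * a)
  e₅ = solve-∀
  1≤K² : 1 ≤ K * K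
  1≤K² = *-mono-≤ 1≤K 1≤K
  16K²≤n : 16 * (K * K) * 1 ≤ n
  16K²≤n = ≤-trans (≤-reflexive (*-identityʳ _)) (≤-trans
    (*-mono-≤ {16} {2304} (m≤m+n 16 2288) (≤-trans (≤-reflexive (sym (*-identityʳ (K * K)))) (*-monoʳ-≤ (K * K) 1≤K²))) n≥)

window-mid : ∀ K n .{{_ : NonZero K}} (F : Subset n) → K * ∣ 2 * ∣ F ∣ - n ∣ ≤ n →
             2 * ∣ F ∣ ≤ n + n / K × n ≤ 2 * ∣ F ∣ + n / K
window-mid K n F le =
  ≤-trans (m≤n+∣m-n∣ (2 * ∣ F ∣) n) (+-monoʳ-≤ n d≤) , ≤-trans (m≤n+∣n-m∣ n (2 * ∣ F ∣)) (+-monoʳ-≤ (2 * ∣ F ∣) d≤)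
  where
  d = ∣ 2 * ∣ F ∣ - n ∣
  d≤ : d ≤ n / K
  d≤ = ≤-trans (≤-reflexive (sym (trans (cong (_/ K) (*-comm K d)) (m*n/n≡m d K)))) (/-monoˡ-≤ K le)

-- Saturated sets of vertices

does-∈ₗ? : (s : Subset n) (xs : List (Subset n)) → does (s ∈ₗ? xs) ≡ s ∈ᵇ xs
does-∈ₗ? s []       = refl
does-∈ₗ? s (x ∷ xs) = cong (does (s ≟ₛ x) ∨_) (does-∈ₗ? s xs)

_⊆image?_ : {m : ℕ} (D : List (Subset n)) (φ : Fin m → Subset n) → Dec (All (_∈ image φ) D)
D ⊆image? φ = All.all? (_∈ₗ? image φ) D

does-⊆image? : {m : ℕ} (D : List (Subset n)) (φ : Fin m → Subset n) →
               does (D ⊆image? φ) ≡ all (λ s → s ∈ᵇ image φ) D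
does-⊆image? []      φ = refl
does-⊆image? (s ∷ D) φ = cong₂ _∧_ (does-∈ₗ? s (image φ)) (does-⊆image? D φ)

deg≡∑ : {m : ℕ} (H : List (Fin m → Subset n)) (D : List (Subset n)) → deg H D ≡ ∑ H (λ φ → ⟦ D ⊆image? φ ⟧)
deg≡∑ []      D = refl
deg≡∑ (φ ∷ H) D with all (λ s → s ∈ᵇ image φ) D | D ⊆image? φ | does-⊆image? D φ
... | .true  | yes _ | refl = cong suc (deg≡∑ H D)
... | .false | no  _ | refl = deg≡∑ H D

sublists : List A → List (List A)
sublists []       = [] ∷ []
sublists (x ∷ xs) = map (x ∷_) (sublists xs) ++ sublists xs

length-sublists : (xs : List A) → length (sublists xs) ≡ 2 ^ length xs
length-sublists []       = refl
length-sublists (x ∷ xs) = trans (length-++ (map (x ∷_) (sublists xs)))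
  (cong₂ _+_ (trans (length-map (x ∷_) (sublists xs)) (length-sublists xs))
             (trans (length-sublists xs) (sym (+-identityʳ _))))

sublist-length : (xs : List A) {D : List A} → D ∈ sublists xs → length D ≤ length xs
sublist-length []       (here refl) = z≤n
sublist-length (x ∷ xs) i with ∈-++⁻ (map (x ∷_) (sublists xs)) i
... | inj₂ j = m≤n⇒m≤1+n (sublist-length xs j)
... | inj₁ j with ∈-map⁻ (x ∷_) j
...   | D′ , D′∈ , refl = s≤s (sublist-length xs D′∈)

filter-sublist : {P : A → Set} (P? : Decidable P) (xs : List A) → filter P? xs ∈ sublists xs
filter-sublist P? []       = here refl
filter-sublist P? (x ∷ xs) with P? x
... | yes _ = ∈-++⁺ˡ (∈-map⁺ (x ∷_) (filter-sublist P? xs))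
... | no  _ = ∈-++⁺ʳ (map (x ∷_) (sublists xs)) (filter-sublist P? xs)

length-concatMap≤ : {B : Set} (f : A → List B) (xs : List A) (c : ℕ) → (∀ {x} → x ∈ xs → length (f x) ≤ c) →
                    length (concatMap f xs) ≤ length xs * c
length-concatMap≤ f xs c h = ≤-trans (≤-reflexive (trans (length≡∑ (concatMap f xs)) (∑-concatMap f xs (λ _ → 1))))
  (≤-trans (∑-mono xs λ {x} i → ≤-trans (≤-reflexive (sym (length≡∑ (f x)))) (h i)) (≤-reflexive (∑-const xs c)))

module Saturation {m n : ℕ} (b : ℕ) (1≤b : 1 ≤ b) (H : List (Fin m → Subset n)) where

  deg-antitone : ∀ {D D′} → (∀ {s} → s ∈ D′ → s ∈ D) → deg H D ≤ deg H D′
  deg-antitone {D} {D′} sub = subst₂ _≤_ (sym (deg≡∑ H D)) (sym (deg≡∑ H D′))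
    (∑-mono H λ {φ} _ → ⟦⟧-mono (D ⊆image? φ) (D′ ⊆image? φ) λ all → All.tabulate λ i → All.lookup all (sub i))

  deg-[] : deg H [] ≡ length H
  deg-[] = trans (deg≡∑ H []) (trans (∑-const H 1) (*-identityʳ _))

  module _ (𝓖 : List (Subset n)) (𝓖! : Unique 𝓖) where

    -- Double counting: a copy containing `D` has only `m` members and is therefore counted for at
    -- most `m` sets `G`.
    ∑-deg : ∀ D → ∑ 𝓖 (λ G → deg H (G ∷ D)) ≤ m * deg H D
    ∑-deg D = begin
      ∑ 𝓖 (λ G → deg H (G ∷ D))                                   ≡⟨ ∑-cong 𝓖 (λ {G} _ → deg≡∑ H (G ∷ D)) ⟩
      ∑ 𝓖 (λ G → ∑ H (λ φ → ⟦ (G ∷ D) ⊆image? φ ⟧))               ≡⟨ ∑-swap 𝓖 H _ ⟩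
      ∑ H (λ φ → ∑ 𝓖 (λ G → ⟦ (G ∷ D) ⊆image? φ ⟧))               ≤⟨ ∑-mono H (λ {φ} _ → per-copy φ) ⟩
      ∑ H (λ φ → m * ⟦ D ⊆image? φ ⟧)                             ≡⟨ ∑-*ˡ H _ m ⟩
      m * ∑ H (λ φ → ⟦ D ⊆image? φ ⟧)                             ≡⟨ cong (m *_) (deg≡∑ H D) ⟨
      m * deg H D                                                 ∎
      where
      open ≤-Reasoning
      per-copy : ∀ φ → ∑ 𝓖 (λ G → ⟦ (G ∷ D) ⊆image? φ ⟧) ≤ m * ⟦ D ⊆image? φ ⟧
      per-copy φ = go (D ⊆image? φ)
       where
       go : (d : Dec (All (_∈ image φ) D)) → ∑ 𝓖 (λ G → ⟦ (G ∷ D) ⊆image? φ ⟧) ≤ m * ⟦ d ⟧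
       go (no ¬a) = ≤-trans (≤-reflexive (∑-zero 𝓖 λ {G} _ → ⟦⟧-no ((G ∷ D) ⊆image? φ) λ { (_ ∷ a) → ¬a a })) z≤n
       go (yes _) = begin
        ∑ 𝓖 (λ G → ⟦ (G ∷ D) ⊆image? φ ⟧)    ≤⟨ ∑-mono 𝓖 (λ {G} _ → ⟦⟧-mono ((G ∷ D) ⊆image? φ) (G ∈ₗ? image φ) All.head) ⟩
        ∑ 𝓖 (λ G → ⟦ G ∈ₗ? image φ ⟧)        ≡⟨ length-filter≡∑ (_∈ₗ? image φ) 𝓖 ⟨
        length (filter (_∈ₗ? image φ) 𝓖)     ≤⟨ length-∈-mono
          (Uniqueₚ.filter⁺ (_∈ₗ? image φ) 𝓖!)
          (λ i → proj₂ (∈-filter⁻ (_∈ₗ? image φ) {xs = 𝓖} i)) ⟩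
        length (image φ)                     ≡⟨ length-tabulate φ ⟩
        m                                    ≡⟨ *-identityʳ m ⟨
        m * 1                                ∎

    heavy : ℕ → List (Subset n) → List (Subset n)
    heavy t D = filter (λ G → t ≤? deg H (G ∷ D)) 𝓖

    length-heavy : ∀ t D → length (heavy t D) * t ≤ m * deg H D
    length-heavy t D = begin
      length (heavy t D) * t                       ≡⟨ ∑-const (heavy t D) t ⟨
      ∑ (heavy t D) (λ _ → t)                      ≤⟨ ∑-mono (heavy t D) (λ i → proj₂ (∈-filter⁻ (λ G → t ≤? deg H (G ∷ D)) {xs = 𝓖} i)) ⟩
      ∑ (heavy t D) (λ G → deg H (G ∷ D))          ≡⟨ ∑-filter (λ G → t ≤? deg H (G ∷ D)) 𝓖 _ ⟩
      ∑ 𝓖 (λ G → ⟦ t ≤? deg H (G ∷ D) ⟧ * deg H (G ∷ D))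
        ≤⟨ ∑-mono 𝓖 (λ {G} _ → ≤-trans (*-monoˡ-≤ _ (⟦⟧≤1 (t ≤? deg H (G ∷ D)))) (≤-reflexive (*-identityˡ _))) ⟩
      ∑ 𝓖 (λ G → deg H (G ∷ D))                    ≤⟨ ∑-deg D ⟩
      m * deg H D                                  ∎
      where open ≤-Reasoning

  Unsaturated : List (Subset n) → Set
  Unsaturated D = deg H D < b ^ (m ∸ length D)

  -- The pattern `s ∷ D` leaves out the empty set, whose degree is the size of `H` and is not
  -- bounded by `b ^ m`.
  Free : List (Subset n) → Set
  Free 𝓢 = ∀ {s D} → s ∷ D ∈ sublists 𝓢 → Unsaturated (s ∷ D)

  Free-[] : Free []
  Free-[] (here ())
  Free-[] (there ())

  module Extension (𝓖 : List (Subset n)) (𝓖! : Unique 𝓖)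
                   (light : ∀ {G} → G ∈ 𝓖 → Unsaturated (G ∷ [])) where

    forbidden : List (Subset n) → List (Subset n)
    forbidden 𝓢 = concatMap (λ D → heavy 𝓖 𝓖! (b ^ (m ∸ suc (length D))) D) (sublists 𝓢)

    free-∷ : ∀ {𝓢 G} → Free 𝓢 → G ∈ 𝓖 → G ∉ forbidden 𝓢 → Free (G ∷ 𝓢)
    free-∷ {𝓢} {G} free G∈ G∉ {s} {D} i with ∈-++⁻ (map (G ∷_) (sublists 𝓢)) i
    ... | inj₂ j = free j
    ... | inj₁ j with ∈-map⁻ (G ∷_) j
    ...   | D , D∈ , refl = ≰⇒> λ le → G∉ (∈-concatMap⁺ _ (lose D∈ (∈-filter⁺ (λ G → b ^ (m ∸ suc (length D)) ≤? deg H (G ∷ D)) G∈ le)))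

    length-forbidden : ∀ {𝓢} → Free 𝓢 → length 𝓢 < m → length (forbidden 𝓢) ≤ 2 ^ m * (m * b)
    length-forbidden {𝓢} free short = ≤-trans (length-concatMap≤ _ (sublists 𝓢) (m * b) few)
      (*-monoˡ-≤ (m * b) (≤-trans (≤-reflexive (length-sublists 𝓢)) (^-monoʳ-≤ 2 (<⇒≤ short))))
      where
      few : ∀ {D} → D ∈ sublists 𝓢 → length (heavy 𝓖 𝓖! (b ^ (m ∸ suc (length D))) D) ≤ m * b
      -- For empty `D` the degree bound needed for double counting is missing; instead `light` shows
      -- that no singleton is saturated.
      few {[]} _ = ≤-trans (≤-reflexive (cong length (Listₚ.filter-none
        (λ G → b ^ (m ∸ 1) ≤? deg H (G ∷ [])) (All.tabulate λ G∈ → <⇒≱ (light G∈))))) z≤n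
      few {D@(_ ∷ _)} D∈ = *-cancelʳ-≤ _ (m * b) t {{m^n≢0 b (m ∸ suc (length D)) {{>-nonZero 1≤b}}}} (begin
        length (heavy 𝓖 𝓖! t D) * t   ≤⟨ length-heavy 𝓖 𝓖! t D ⟩
        m * deg H D                   ≤⟨ *-monoʳ-≤ m (<⇒≤ (free D∈)) ⟩
        m * b ^ (m ∸ length D)        ≡⟨ cong (λ x → m * b ^ x) (sym (suc-∸ (≤-trans (s≤s (sublist-length 𝓢 D∈)) short))) ⟩
        m * (b * t)                   ≡⟨ *-assoc m b t ⟨
        m * b * t                     ∎)
        where
        open ≤-Reasoning
        t = b ^ (m ∸ suc (length D))
        suc-∸ : ∀ {a c} → a < c → suc (c ∸ suc a) ≡ c ∸ a
        suc-∸ {a} a<c = sym (∸-suc a<c)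
          where
          ∸-suc : ∀ {a c} → a < c → c ∸ a ≡ suc (c ∸ suc a)
          ∸-suc {zero}  (s≤s _) = refl
          ∸-suc {suc a} (s≤s p) = ∸-suc p

  -- `Free` speaks of sublists, in the order of `𝓢`. An arbitrary listing `D` is replaced by the
  -- sublist `D′` with the same members; this cannot lower the degree, nor shorten the list.
  free-image : ∀ {𝓢} → Free 𝓢 → ∀ D → Unique D → 1 ≤ length D → (∀ {s} → s ∈ D → s ∈ 𝓢) → Unsaturated D
  free-image {𝓢} free D D! 1≤D D⊆ = ≤-trans (s≤s deg≤) (≤-trans canonical-free (^-monoʳ-≤ b {{>-nonZero 1≤b}} (∸-monoʳ-≤ m longer)))
    where
    D′ = filter (_∈ₗ? D) 𝓢
    D⊆D′ : ∀ {s} → s ∈ D → s ∈ D′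
    D⊆D′ i = ∈-filter⁺ (_∈ₗ? D) (D⊆ i) i
    longer : length D ≤ length D′
    longer = length-∈-mono D! D⊆D′
    deg≤ : deg H D ≤ deg H D′
    deg≤ = deg-antitone λ i → proj₂ (∈-filter⁻ (_∈ₗ? D) {xs = 𝓢} i)
    canonical-free : Unsaturated D′
    canonical-free with D′ | filter-sublist (_∈ₗ? D) 𝓢 | longer
    ... | []    | _ | l = contradiction (≤-trans 1≤D l) λ ()
    ... | _ ∷ _ | i | _ = free i

-- Robust embedding

module Robust {n : ℕ} (w K : ℕ) (1≤w : 1 ≤ w) (3≤K : 3 ≤ K) (Kw≤n : K * w ≤ n)
              (k₁ e : ℕ) (𝓕 : List (Subset n)) (𝓕! : Unique 𝓕)
              (big : (e * k₁ + 1) * (n C (n / 2)) ≤ length 𝓕 * e)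
              (mid : ∀ {F} → F ∈ 𝓕 → Events.Mid n w K 1≤w 3≤K Kw≤n F)
              (ℓ : ℕ) (gapped : ∀ {F G} → F ∈ 𝓕 → G ∈ 𝓕 → F ⊂ G → ∣ F ∣ + ℓ ≤ ∣ G ∣)
              (h : ℕ) (h-large : suc k₁ * (e * k₁ + 1) < h) where

  open Events n w K 1≤w 3≤K Kw≤n
  open Ladder k₁ e 𝓕 𝓕! big h h-large

  -- 3^ℓ ℓ! bounds, up to n^ℓ, the chance that a chain through F also passes through a given gapped neighbour.
  c : ℕ
  c = 3 ^ ℓ * ℓ !

  Comparable : Subset n → Subset n → Set
  Comparable A G = A ⊆ G ⊎ G ⊆ A

  private
    comparable? : ∀ A G → Dec (Comparable A G)
    comparable? A G = (A ⊆? G) ⊎-dec (G ⊆? A)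

    N>0 : ∀ F → 0 < N F
    N>0 F = >-nonZero⁻¹ (N F) {{∣ F ∣ !* (n ∸ ∣ F ∣) !≢0}}

    -- Each of the two sums is at most `N F / (4 * h)`, so together they stay below `N F / h`. The
    -- 24 is this 4 times the 6 in the bound for one comparability.
    union-bound : ∀ F (T U : Subset n → ℕ) (X : ℕ) (Z As : List (Subset n)) → X ≤ ∑ Z T + ∑ As U →
      (∀ {G} → G ∈ Z → T G * n ^ ℓ ≤ c * N F) → (∀ {A} → A ∈ As → K * U A ≤ 6 * N F) →
      length Z * (c * h * 4) ≤ n ^ ℓ → 24 * h * length As ≤ K → h * X < N F
    union-bound F T U X Z As X≤ T≤ U≤ fewZ fewA = ≰⇒> λ NF≤hX → <⇒≱ (4N F) (begin
      4 * N F                          ≤⟨ *-monoʳ-≤ 4 NF≤hX ⟩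
      4 * (h * X)                      ≤⟨ *-monoʳ-≤ 4 (*-monoʳ-≤ h X≤) ⟩
      4 * (h * (∑ Z T + ∑ As U))       ≡⟨ dist h (∑ Z T) (∑ As U) ⟩
      4 * h * ∑ Z T + 4 * h * ∑ As U   ≤⟨ +-mono-≤ partZ partA ⟩
      N F + N F                        ∎)
      where
      open ≤-Reasoning
      4N : ∀ F → N F + N F < 4 * N F
      4N F = ≤-trans (+-monoˡ-≤ (N F + N F) (N>0 F)) (≤-trans (m≤m+n (N F + (N F + N F)) (N F)) (≤-reflexive (e₀ (N F))))
        where
        e₀ : ∀ x → x + (x + x) + x ≡ 4 * x
        e₀ = solve-∀
      dist : ∀ h a b → 4 * (h * (a + b)) ≡ 4 * h * a + 4 * h * b
      dist = solve-∀
      1≤n : 1 ≤ n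
      1≤n = ≤-trans (*-mono-≤ {1} {K} (≤-trans (s≤s z≤n) 3≤K) 1≤w) Kw≤n
      partZ : 4 * h * ∑ Z T ≤ N F
      partZ = *-cancelˡ-≤ (n ^ ℓ) {{m^n≢0 n ℓ {{>-nonZero 1≤n}}}} (begin
        n ^ ℓ * (4 * h * ∑ Z T)               ≡⟨ e₁ (n ^ ℓ) h (∑ Z T) ⟩
        4 * h * (∑ Z T * n ^ ℓ)               ≡⟨ cong (4 * h *_) (∑-*ʳ Z T (n ^ ℓ)) ⟨
        4 * h * ∑ Z (λ G → T G * n ^ ℓ)       ≤⟨ *-monoʳ-≤ (4 * h) (∑-mono Z T≤) ⟩
        4 * h * ∑ Z (λ _ → c * N F)           ≡⟨ cong (4 * h *_) (∑-const Z (c * N F)) ⟩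
        4 * h * (length Z * (c * N F))        ≡⟨ e₂ h (length Z) c (N F) ⟩
        length Z * (c * h * 4) * N F          ≤⟨ *-monoˡ-≤ (N F) fewZ ⟩
        n ^ ℓ * N F                           ∎)
        where
        e₁ : ∀ a h s → a * (4 * h * s) ≡ 4 * h * (s * a)
        e₁ = solve-∀
        e₂ : ∀ h z c N → 4 * h * (z * (c * N)) ≡ z * (c * h * 4) * N
        e₂ = solve-∀
      partA : 4 * h * ∑ As U ≤ N F
      partA = *-cancelˡ-≤ K {{>-nonZero (≤-trans (s≤s z≤n) 3≤K)}} (begin
        K * (4 * h * ∑ As U)                  ≡⟨ e₁ K h (∑ As U) ⟩
        4 * h * (K * ∑ As U)                  ≡⟨ cong (4 * h *_) (∑-*ˡ As U K) ⟨
        4 * h * ∑ As (λ A → K * U A)          ≤⟨ *-monoʳ-≤ (4 * h) (∑-mono As U≤) ⟩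
        4 * h * ∑ As (λ _ → 6 * N F)          ≡⟨ cong (4 * h *_) (∑-const As (6 * N F)) ⟩
        4 * h * (length As * (6 * N F))       ≡⟨ e₂ h (length As) (N F) ⟩
        24 * h * length As * N F              ≤⟨ *-monoˡ-≤ (N F) fewA ⟩
        K * N F                               ∎)
        where
        e₁ : ∀ K h s → K * (4 * h * s) ≡ 4 * h * (K * s)
        e₁ = solve-∀
        e₂ : ∀ h a N → 4 * h * (a * (6 * N)) ≡ 24 * h * a * N
        e₂ = solve-∀

    Bad : List (Subset n) → List (Subset n) → Subset n → Set
    Bad Z As G = G ∈ Z ⊎ Any (λ A → Comparable A G) As

    bad? : ∀ Z As → Decidable (Bad Z As)
    bad? Z As G = (G ∈ₗ? Z) ⊎-dec Any.any? (λ A → comparable? A G) As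

    module Direction {R : Subset n → Subset n → Set} (R? : ∀ F G → Dec (R F G)) (F : Subset n) where

      B? : ∀ M G → Dec (F ∈ M × (G ∈ M × G ∈ 𝓕 × R F G))
      B? M G = F ∈ₗ? M ×-dec (G ∈ₗ? M ×-dec (G ∈ₗ? 𝓕 ×-dec R? F G))

      U? : ∀ M A → Dec (F ∈ M × Any (λ G → G ∈ 𝓕 × R F G × Comparable A G) M)
      U? M A = F ∈ₗ? M ×-dec Any.any? (λ G → G ∈ₗ? 𝓕 ×-dec (R? F G ×-dec comparable? A G)) M

      event? : ∀ Z As M → Dec (F ∈ M × Any (λ G → G ∈ 𝓕 × R F G × Bad Z As G) M)
      event? Z As M = F ∈ₗ? M ×-dec Any.any? (λ G → G ∈ₗ? 𝓕 ×-dec (R? F G ×-dec bad? Z As G)) M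

      rare : ∀ Z As → (∀ {G} → G ∈ 𝓕 → R F G → ∑ 𝓜 (λ M → ⟦ F ∈ₗ? M ×-dec G ∈ₗ? M ⟧) * n ^ ℓ ≤ c * N F) →
             (∀ {A} → A ∈ As → K * ∑ 𝓜 (λ M → ⟦ U? M A ⟧) ≤ 6 * N F) →
             length Z * (c * h * 4) ≤ n ^ ℓ → 24 * h * length As ≤ K →
             h * ∑ 𝓜 (λ M → ⟦ event? Z As M ⟧) < N F
      rare Z As T≤ U≤ fewZ fewA = union-bound F (λ G → ∑ 𝓜 (λ M → ⟦ B? M G ⟧)) (λ A → ∑ 𝓜 (λ M → ⟦ U? M A ⟧))
        _ Z As cover (λ {G} _ → T≤′ G) U≤ fewZ fewA
        where
        open ≤-Reasoning
        T≤′ : ∀ G → ∑ 𝓜 (λ M → ⟦ B? M G ⟧) * n ^ ℓ ≤ c * N F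
        T≤′ G = case G ∈ₗ? 𝓕 ×-dec R? F G of λ where
         (yes (G∈ , r)) → ≤-trans (*-monoˡ-≤ (n ^ ℓ) (∑-mono 𝓜 λ {M} _ →
                ⟦⟧-mono (B? M G) (F ∈ₗ? M ×-dec G ∈ₗ? M) λ (F∈M , G∈M , _) → F∈M , G∈M)) (T≤ G∈ r)
         (no ¬r) → ≤-trans (≤-reflexive (cong (_* n ^ ℓ) (∑-zero 𝓜 λ {M} _ →
                ⟦⟧-no (B? M G) λ (_ , _ , r) → ¬r r))) z≤n
        per-chain : ∀ M → ⟦ event? Z As M ⟧ ≤ ∑ Z (λ G → ⟦ B? M G ⟧) + ∑ As (λ A → ⟦ U? M A ⟧)
        per-chain M = ≤-trans
          (⟦⟧-⊎ (event? Z As M) (Any.any? (B? M) Z) (Any.any? (U? M) As) λ (F∈M , i) → case find i of λ where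
            (G , G∈M , G∈ , r , inj₁ G∈Z) → inj₁ (lose G∈Z (F∈M , G∈M , G∈ , r))
            (G , G∈M , G∈ , r , inj₂ j)   → inj₂ (Any.map (λ comp → F∈M , lose G∈M (G∈ , r , comp)) j))
          (+-mono-≤ (⟦any⟧≤∑ (B? M) Z (Any.any? (B? M) Z) (λ i → i)) (⟦any⟧≤∑ (U? M) As (Any.any? (U? M) As) (λ i → i)))
        cover : ∑ 𝓜 (λ M → ⟦ event? Z As M ⟧)
                ≤ ∑ Z (λ G → ∑ 𝓜 (λ M → ⟦ B? M G ⟧)) + ∑ As (λ A → ∑ 𝓜 (λ M → ⟦ U? M A ⟧))
        cover = begin
          ∑ 𝓜 (λ M → ⟦ event? Z As M ⟧)        ≤⟨ ∑-mono 𝓜 (λ {M} _ → per-chain M) ⟩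
          ∑ 𝓜 (λ M → ∑ Z (λ G → ⟦ B? M G ⟧) + ∑ As (λ A → ⟦ U? M A ⟧)) ≡⟨ ∑-+ 𝓜 _ _ ⟩
          _                                    ≡⟨ cong₂ _+_ (∑-swap 𝓜 Z _) (∑-swap 𝓜 As _) ⟩
          _                                    ∎

    add-bounds : ∀ {F} X V W → X ≤ V + W → K * V ≤ 3 * N F → K * W ≤ 3 * N F → K * X ≤ 6 * N F
    add-bounds {F} X V W X≤ V≤ W≤ = begin
      K * X                  ≤⟨ *-monoʳ-≤ K X≤ ⟩
      K * (V + W)            ≡⟨ *-distribˡ-+ K V W ⟩
      K * V + K * W          ≤⟨ +-mono-≤ V≤ W≤ ⟩
      3 * N F + 3 * N F      ≡⟨ e₁ (N F) ⟩
      6 * N F                ∎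
      where
      open ≤-Reasoning
      e₁ : ∀ x → 3 * x + 3 * x ≡ 6 * x
      e₁ = solve-∀

    outside-element : ∀ {A F : Subset n} → A ⊈ F → ∃[ a ] (a S.∈ A × a S.∉ F)
    outside-element {A} {F} A⊈F with Finₚ.any? (λ a → (a ∈? A) ×-dec ¬? (a ∈? F))
    ... | yes found = found
    ... | no none = contradiction (λ {a} a∈ → decidable-stable (a ∈? F) λ a∉ → none (a , a∈ , a∉)) A⊈F

  -- Take `a` in `A` outside `F`. A member `G` above `F` comparable to `A` either contains `A`, so
  -- the chain gains `a` soon, or is contained in `A`, so the chain stays inside `A` for a step.
  -- Sets `A ⊆ F` cannot be avoided and are excluded.
  step-up : ∀ {F i j} → i < j → j < suc k₁ → Alive F i → ∀ Z As → (∀ {A} → A ∈ As → A ∈ 𝓕 × A ⊈ F) →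
            length Z * (c * h * 4) ≤ n ^ ℓ → 24 * h * length As ≤ K →
            ∃[ G ] (Alive G j × F ⊂ G × G ∉ Z × (∀ {A} → A ∈ As → ¬ Comparable A G))
  step-up {F} {i} {j} i<j j<k alive Z As As⊈ fewZ fewA =
    let G , aliveG , F⊂G , ¬bad = alive-neighbour (<-trans i<j j<k) j<k _⊂?_ (λ ps → At-ordered ps i<j) alive (bad? Z As)
           (rare Z As (λ {G} G∈ F⊂G → both-up ℓ {F} {G} (mid G∈) (p⊂q⇒p⊆q F⊂G) (gapped F∈ G∈ F⊂G)) comparables fewZ fewA)
    in G , aliveG , F⊂G , (λ z → ¬bad (inj₁ z)) , λ A∈ comp → ¬bad (inj₂ (lose A∈ comp))
    where
    open Direction _⊂?_ F
    F∈ = alive-∈ alive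
    comparables : ∀ {A} → A ∈ As → K * ∑ 𝓜 (λ M → ⟦ U? M A ⟧) ≤ 6 * N F
    comparables {A} A∈ = let A∈𝓕 , A⊈F = As⊈ A∈ ; a , a∈A , a∉F = outside-element A⊈F in add-bounds {F} _ (∑ 𝓜 (λ M → ⟦ V? a M ⟧)) (∑ 𝓜 (λ M → ⟦ W? M ⟧))
      (≤-trans (∑-mono 𝓜 λ {M} _ → ⟦⟧-⊎ (U? M A) (V? a M) (W? M) λ (F∈M , r) → case find r of λ where
          (G , G∈M , G∈ , F⊂G , inj₁ A⊆G) → inj₁ (F∈M , lose G∈M (F⊂G , A⊆G a∈A , Mid-size {F} {G} (mid F∈) (mid G∈)))
          (G , G∈M , G∈ , F⊂G , inj₂ G⊆A) → inj₂ (F∈M , lose G∈M (F⊂G , λ {x} → G⊆A {x})))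
        (≤-reflexive (∑-+ 𝓜 (λ M → ⟦ V? a M ⟧) (λ M → ⟦ W? M ⟧))))
      (gains {F} (mid F∈) a∉F) (inside-of {F} {A} (mid F∈) (mid A∈𝓕))
      where
      V? = λ a M → F ∈ₗ? M ×-dec Any.any? (λ G → (F ⊂? G) ×-dec ((a ∈? G) ×-dec (∣ G ∣ ≤? ∣ F ∣ + w))) M
      W? = λ M → F ∈ₗ? M ×-dec Any.any? (λ G → (F ⊂? G) ×-dec (G ⊆? A)) M

  -- Dual to `step-up`, with `a` in `F` outside `A`: either `G ⊆ A` has lost `a` within `w` of `F`,
  -- or `G` lies between `A` and `F`.
  step-down : ∀ {F i j} → j < i → i < suc k₁ → Alive F i → ∀ Z As → (∀ {A} → A ∈ As → A ∈ 𝓕 × F ⊈ A) →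
              length Z * (c * h * 4) ≤ n ^ ℓ → 24 * h * length As ≤ K →
              ∃[ G ] (Alive G j × G ⊂ F × G ∉ Z × (∀ {A} → A ∈ As → ¬ Comparable A G))
  step-down {F} {i} {j} j<i i<k alive Z As As⊈ fewZ fewA =
    let G , aliveG , G⊂F , ¬bad = alive-neighbour i<k (<-trans j<i i<k) (λ F G → G ⊂? F) (λ ps at at′ → At-ordered ps j<i at′ at) alive (bad? Z As)
           (rare Z As (λ {G} G∈ G⊂F → ≤-trans (*-monoˡ-≤ (n ^ ℓ) (∑-mono 𝓜 λ {M} _ →
                        ⟦⟧-mono (F ∈ₗ? M ×-dec G ∈ₗ? M) (G ∈ₗ? M ×-dec F ∈ₗ? M) λ (x , y) → y , x))
                        (both-down ℓ {G} {F} (mid G∈) (p⊂q⇒p⊆q G⊂F) (gapped G∈ F∈ G⊂F))) comparables fewZ fewA)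
    in G , aliveG , G⊂F , (λ z → ¬bad (inj₁ z)) , λ A∈ comp → ¬bad (inj₂ (lose A∈ comp))
    where
    open Direction {R = λ F G → G ⊂ F} (λ F G → G ⊂? F) F
    F∈ = alive-∈ alive
    comparables : ∀ {A} → A ∈ As → K * ∑ 𝓜 (λ M → ⟦ U? M A ⟧) ≤ 6 * N F
    comparables {A} A∈ = let A∈𝓕 , F⊈A = As⊈ A∈ ; a , a∈F , a∉A = outside-element F⊈A in add-bounds {F} _ (∑ 𝓜 (λ M → ⟦ V? a M ⟧)) (∑ 𝓜 (λ M → ⟦ W? M ⟧))
      (≤-trans (∑-mono 𝓜 λ {M} _ → ⟦⟧-⊎ (U? M A) (V? a M) (W? M) λ (F∈M , r) → case find r of λ where
          (G , G∈M , G∈ , G⊂F , inj₁ A⊆G) → inj₂ (F∈M , lose G∈M ((λ {x} → A⊆G {x}) , G⊂F))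
          (G , G∈M , G∈ , G⊂F , inj₂ G⊆A) → inj₁ (F∈M , lose G∈M ((λ a∈G → a∉A (G⊆A a∈G))
            , ∸-from-+ (Mid-size {G} {F} (mid G∈) (mid F∈)))))
        (≤-reflexive (∑-+ 𝓜 (λ M → ⟦ V? a M ⟧) (λ M → ⟦ W? M ⟧))))
      (loses {F} (mid F∈) a∈F) (between {F} {A} (mid F∈) (mid A∈𝓕))
      where
      ∸-from-+ : ∀ {m o p} → m ≤ o + p → m ∸ p ≤ o
      ∸-from-+ {m} {o} {p} le = ≤-trans (∸-monoˡ-≤ p le) (≤-reflexive (m+n∸n≡m o p))
      V? = λ a M → F ∈ₗ? M ×-dec Any.any? (λ G → ¬? (a ∈? G) ×-dec (∣ F ∣ ∸ w ≤? ∣ G ∣)) M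
      W? = λ M → F ∈ₗ? M ×-dec Any.any? (λ G → (A ⊆? G) ×-dec (G ⊂? F)) M

  module Embedding {m : ℕ} (_<P_ : Fin m → Fin m → Set) (isSPO : IsStrictPartialOrder _≡_ _<P_)
                   (isTree : IsTreePoset _<P_) (height : HasHeight _<P_ (suc k₁))
                   (b : ℕ) (1≤b : 1 ≤ b) (H : List (Fin m → Subset n))
                   (light : ∀ {G} → G ∈ 𝓕 → deg H (G ∷ []) < b ^ (m ∸ 1))
                   (fewZ : 2 ^ m * (m * b) * (c * h * 4) ≤ n ^ ℓ) (fewA : 24 * h * m ≤ K) where

    open TreePoset _<P_ isSPO isTree
    open Saturation b 1≤b H
    open Extension 𝓕 𝓕! light
    open IsStrictPartialOrder isSPO using () renaming (trans to <P-trans; irrefl to <P-irrefl; asym to <P-asym)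

    private
      r : Fin m → ℕ
      r = rank height

    -- With `_⊆_` in place of `_⊂_`, `reflect` covers injectivity and incomparability at once.
    record Partial (S : List (Fin m)) (φ : Fin m → Subset n) : Set where
      field
        alive    : ∀ {x} → x ∈ S → Alive (φ x) (r x)
        reflect  : ∀ {x y} → x ∈ S → y ∈ S → φ x ⊆ φ y → x ≡ y ⊎ x <P y
        preserve : ∀ {x y} → x ∈ S → y ∈ S → x <P y → φ x ⊆ φ y
        free     : Free (map φ S)

    build-unique : ∀ {S} → Build S → Unique S
    build-unique (root x)               = [] ∷ []
    build-unique (above b _ x∉ _ _ _)   = All.tabulate (λ i → λ { refl → x∉ i }) ∷ build-unique b
    build-unique (below b _ x∉ _ _ _)   = All.tabulate (λ i → λ { refl → x∉ i }) ∷ build-unique b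

    private
      update : (Fin m → Subset n) → Fin m → Subset n → Fin m → Subset n
      update φ x G y with x Finₚ.≟ y
      ... | yes _ = G
      ... | no  _ = φ y

      update-new : ∀ φ x G → update φ x G x ≡ G
      update-new φ x G with x Finₚ.≟ x
      ... | yes _  = refl
      ... | no x≢x = contradiction refl x≢x

      update-old : ∀ φ x G {S y} → x ∉ S → y ∈ S → update φ x G y ≡ φ y
      update-old φ x G {y = y} x∉ y∈ with x Finₚ.≟ y
      ... | yes refl = contradiction y∈ x∉
      ... | no _     = refl

    extend : ∀ {S φ x G} → Partial S φ → x ∉ S → Alive G (r x) → G ∉ forbidden (map φ S) →
             (∀ {y} → y ∈ S → φ y ⊆ G → y <P x) → (∀ {y} → y ∈ S → G ⊆ φ y → x <P y) →
             (∀ {y} → y ∈ S → y <P x → φ y ⊆ G) → (∀ {y} → y ∈ S → x <P y → G ⊆ φ y) →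
             Partial (x ∷ S) (update φ x G)
    extend {S} {φ} {x} {G} partial x∉ aliveG G∉ below⁻ above⁻ below⁺ above⁺ = record
      { alive    = λ { (here refl) → subst (λ F → Alive F (r x)) (sym new) aliveG
                     ; {y} (there i) → subst (λ F → Alive F (r y)) (sym (old i)) (alive i) }
      ; reflect  = λ { (here refl) (here refl) _ → inj₁ refl
                     ; (here refl) (there j) s → inj₂ (above⁻ j (subst₂ _⊆_ new (old j) s))
                     ; (there i) (here refl) s → inj₂ (below⁻ i (subst₂ _⊆_ (old i) new s))
                     ; (there i) (there j) s → reflect i j (subst₂ _⊆_ (old i) (old j) s) }
      ; preserve = λ { (here refl) (here refl) x<x → contradiction x<x (<P-irrefl refl)
                     ; (here refl) (there j) x<y → subst₂ _⊆_ (sym new) (sym (old j)) (above⁺ j x<y)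
                     ; (there i) (here refl) y<x → subst₂ _⊆_ (sym (old i)) (sym new) (below⁺ i y<x)
                     ; (there i) (there j) y<z → subst₂ _⊆_ (sym (old i)) (sym (old j)) (preserve i j y<z) }
      ; free     = subst Free (cong₂ _∷_ (sym new) (sym (Listₚ.map-cong-local (All.tabulate old))))
                     (free-∷ {map φ S} free (alive-∈ aliveG) G∉)
      }
      where
      open Partial partial
      new = update-new φ x G
      old : ∀ {y} → y ∈ S → update φ x G y ≡ φ y
      old = update-old φ x G x∉

    private
      length<m : ∀ {S x} → Unique S → x ∉ S → length S < m
      length<m {S} {x} S! x∉ = ≤-trans
        (length-∈-mono {xs = x ∷ S} {allFin m} (All.tabulate (λ i → λ { refl → x∉ i }) ∷ S!) (λ _ → ∈-allFin _))
        (≤-reflexive (length-tabulate (λ i → i)))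

      enough-Z : ∀ {S φ x} → Partial S φ → Unique S → x ∉ S → length (forbidden (map φ S)) * (c * h * 4) ≤ n ^ ℓ
      enough-Z {S} {φ} partial S! x∉ = ≤-trans (*-monoˡ-≤ (c * h * 4)
        (length-forbidden {map φ S} (Partial.free partial) (subst (_< m) (sym (length-map φ S)) (length<m S! x∉)))) fewZ

      enough-A : ∀ {S x} {φ : Fin m → Subset n} {P : Fin m → Set} (P? : Decidable P) → Unique S → x ∉ S →
                 24 * h * length (map φ (filter P? S)) ≤ K
      enough-A {S} {_} {φ} P? S! x∉ = ≤-trans (*-monoʳ-≤ (24 * h) (≤-trans
        (≤-reflexive (length-map φ (filter P? S)))
        (≤-trans (Listₚ.length-filter P? S) (<⇒≤ (length<m S! x∉))))) fewA

      _≤P?_ : ∀ x y → Dec (x ≡ y ⊎ x <P y)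
      x ≤P? y = (x Finₚ.≟ y) ⊎-dec (x <P? y)

      ⊆-of-≤ : ∀ {S φ x y} → Partial S φ → x ∈ S → y ∈ S → x ≡ y ⊎ x <P y → φ x ⊆ φ y
      ⊆-of-≤ partial i j (inj₁ refl) = λ z → z
      ⊆-of-≤ partial i j (inj₂ x<y)  = Partial.preserve partial i j x<y

    embed : ∀ {S} → Build S → ∃ (Partial S)
    embed (root x) = let G , aliveG = alive-exists (rank<k height x) in (λ _ → G) , record
      { alive    = λ { (here refl) → aliveG }
      ; reflect  = λ { (here refl) (here refl) _ → inj₁ refl }
      ; preserve = λ { (here refl) (here refl) x<x → contradiction x<x (<P-irrefl refl) }
      ; free     = free-∷ {[]} Free-[] (alive-∈ aliveG) (nothing-forbidden G (alive-∈ aliveG))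
      }
      where
      nothing-forbidden : ∀ G → G ∈ 𝓕 → G ∉ forbidden []
      nothing-forbidden G G∈ i with find (∈-concatMap⁻ (λ D → heavy 𝓕 𝓕! (b ^ (m ∸ suc (length D))) D) {xs = sublists ([] {A = Subset n})} i)
      ... | _ , here refl , j = <⇒≱ (light G∈) (proj₂ (∈-filter⁻ (λ G → b ^ (m ∸ 1) ≤? deg H (G ∷ [])) {xs = 𝓕} j))
    embed (above {S} {p} {x} build p∈ x∉ p<x via no-above) =
      let φ , partial = embed build
          S! = build-unique build
          -- Sets placed at `y` below or equal to `p` lie inside `φ p`, hence inside `G`, as they
          -- should. All others must become incomparable to `G`, because `y <P x` would give `y` at
          -- most `p` by `via`.
          not-below? = λ y → ¬? (y ≤P? p)
          As = map φ (filter not-below? S)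
          G , aliveG , p⊂G , G∉ , incomparable = step-up (rank-mono height p<x) (rank<k height x)
            (Partial.alive partial p∈) (forbidden (map φ S)) As
            (λ A∈ → case ∈-map⁻ φ A∈ of λ where
              (y , y∈ , refl) → let y∈S , y≰p = ∈-filter⁻ not-below? {xs = S} y∈ in
                alive-∈ (Partial.alive partial y∈S) , y≰p ∘ Partial.reflect partial y∈S p∈)
            (enough-Z partial S! x∉) (enough-A {φ = φ} not-below? S! x∉)
          free-of : ∀ {y} → y ∈ S → ¬ (y ≡ p ⊎ y <P p) → ¬ Comparable (φ y) G
          free-of = λ y∈ y≰p → incomparable (∈-map⁺ φ (∈-filter⁺ not-below? y∈ y≰p))
      in update φ x G , extend partial x∉ aliveG G∉
        (λ {y} y∈ y⊆G → case y ≤P? p of λ where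
          (yes (inj₁ refl)) → p<x
          (yes (inj₂ y<p))  → <P-trans y<p p<x
          (no y≰p)          → contradiction (inj₁ (λ {z} → y⊆G {z})) (free-of y∈ y≰p))
        (λ {y} y∈ G⊆y → case y ≤P? p of λ where
          (yes y≤p) → contradiction (⊂-⊆-trans p⊂G (λ {z} i → ⊆-of-≤ partial y∈ p∈ y≤p (G⊆y {z} i))) (⊂-irref refl)
          (no y≰p)  → contradiction (inj₂ (λ {z} → G⊆y {z})) (free-of y∈ y≰p))
        (λ y∈ y<x i → p⊂q⇒p⊆q p⊂G (⊆-of-≤ partial y∈ p∈ (via y∈ y<x) i))
        (λ y∈ x<y → contradiction x<y (no-above y∈))
    embed (below {S} {p} {x} build p∈ x∉ x<p via no-below) =
      let φ , partial = embed build
          S! = build-unique build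
          not-above? = λ y → ¬? (p ≤P? y)
          As = map φ (filter not-above? S)
          G , aliveG , G⊂p , G∉ , incomparable = step-down (rank-mono height x<p) (rank<k height p)
            (Partial.alive partial p∈) (forbidden (map φ S)) As
            (λ A∈ → case ∈-map⁻ φ A∈ of λ where
              (y , y∈ , refl) → let y∈S , p≰y = ∈-filter⁻ not-above? {xs = S} y∈ in
                alive-∈ (Partial.alive partial y∈S) , p≰y ∘ Partial.reflect partial p∈ y∈S)
            (enough-Z partial S! x∉) (enough-A {φ = φ} not-above? S! x∉)
          free-of : ∀ {y} → y ∈ S → ¬ (p ≡ y ⊎ p <P y) → ¬ Comparable (φ y) G
          free-of = λ y∈ p≰y → incomparable (∈-map⁺ φ (∈-filter⁺ not-above? y∈ p≰y))
      in update φ x G , extend partial x∉ aliveG G∉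
        (λ {y} y∈ y⊆G → case p ≤P? y of λ where
          (yes p≤y) → contradiction (⊂-⊆-trans G⊂p (λ {z} i → y⊆G {z} (⊆-of-≤ partial p∈ y∈ p≤y i))) (⊂-irref refl)
          (no p≰y)  → contradiction (inj₁ (λ {z} → y⊆G {z})) (free-of y∈ p≰y))
        (λ {y} y∈ G⊆y → case p ≤P? y of λ where
          (yes (inj₁ refl)) → x<p
          (yes (inj₂ p<y))  → <P-trans x<p p<y
          (no p≰y)          → contradiction (inj₂ (λ {z} → G⊆y {z})) (free-of y∈ p≰y))
        (λ y∈ y<x → contradiction y<x (no-below y∈))
        (λ y∈ x<y i → ⊆-of-≤ partial p∈ y∈ (≤-flip (via y∈ x<y)) (p⊂q⇒p⊆q G⊂p i))
      where
      ≤-flip : ∀ {y} → y ≡ p ⊎ p <P y → p ≡ y ⊎ p <P y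
      ≤-flip (inj₁ refl) = inj₁ refl
      ≤-flip (inj₂ p<y)  = inj₂ p<y

    free-copy : ∃[ φ ] (IsInducedCopy _<P_ 𝓕 φ ×
      (∀ D → Unique D → 1 ≤ length D → (∀ {s} → s ∈ D → s ∈ image φ) → deg H D < b ^ (m ∸ length D)))
    free-copy =
      let S , build , all∈ = build-all
          φ , partial = embed build
          open Partial partial
      in φ , ( (λ {x} {y} eq → injective φ partial all∈ eq)
             , (λ x → alive-∈ (alive (all∈ x)))
             , (λ x y → mk⇔
                  (λ (x⊆y , z , z∈y , z∉x) → case reflect (all∈ x) (all∈ y) x⊆y of λ where
                    (inj₁ refl) → contradiction z∈y z∉x
                    (inj₂ x<y)  → x<y)
                  (λ x<y → ⊆∧≢⇒⊂ (preserve (all∈ x) (all∈ y) x<y) λ y⊆x →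
                    case reflect (all∈ y) (all∈ x) y⊆x of λ where
                      (inj₁ refl) → <P-irrefl refl x<y
                      (inj₂ y<x)  → <P-asym x<y y<x)) )
           , λ D D! 1≤D D⊆ → free-image free D D! 1≤D λ s∈ → case ∈-tabulate⁻ (D⊆ s∈) of λ where
               (x , refl) → ∈-map⁺ φ (all∈ x)
      where
      injective : ∀ {S} φ → Partial S φ → (∀ x → x ∈ S) → ∀ {x y} → φ x ≡ φ y → x ≡ y
      injective φ partial all∈ {x} {y} eq
        with Partial.reflect partial (all∈ x) (all∈ y) (⊆-reflexive eq)
           | Partial.reflect partial (all∈ y) (all∈ x) (⊆-reflexive (sym eq))
      ... | inj₁ x≡y | _         = x≡y
      ... | inj₂ _   | inj₁ y≡x  = sym y≡x
      ... | inj₂ x<y | inj₂ y<x  = contradiction y<x (<P-asym x<y)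

-- The greedy collection

∣─∣ : (F G : Subset n) → F ⊆ G → ∣ F ∣ + ∣ G S.─ F ∣ ≡ ∣ G ∣
∣─∣ []            []            F⊆G = refl
∣─∣ (inside ∷ F)  (outside ∷ G) F⊆G with () ← F⊆G here
∣─∣ (inside ∷ F)  (inside ∷ G)  F⊆G = cong suc (∣─∣ F G (drop-∷-⊆ F⊆G))
∣─∣ (outside ∷ F) (inside ∷ G)  F⊆G = trans (+-suc _ _) (cong suc (∣─∣ F G (drop-∷-⊆ F⊆G)))
∣─∣ (outside ∷ F) (outside ∷ G) F⊆G = ∣─∣ F G (drop-∷-⊆ F⊆G)

module Greedy (m′ k₁ e ℓ : ℕ) (1≤ℓ : 1 ≤ ℓ)
              (_<P_ : Fin (suc m′) → Fin (suc m′) → Set) (isSPO : IsStrictPartialOrder _≡_ _<P_)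
              (isTree : IsTreePoset _<P_) (height : HasHeight _<P_ (suc k₁))
              (h : ℕ) (h-large : suc k₁ * (e * k₁ + 1) < h)
              (K : ℕ) (3≤K : 3 ≤ K) (K-large : h * suc m′ * 24 ≤ K)
              (D : ℕ) (1≤D : 1 ≤ D) (D-large : 2 ^ suc m′ * suc m′ * (3 ^ ℓ * ℓ ! * h * 4) ≤ D)
              (D-large′ : e * (suc m′ * 2 ^ m′) ≤ D)
              (n : ℕ) (K≤n : K ≤ n) (D≤n : D ≤ n) (n-large : K * K * (K * K) * 2304 ≤ n)
              (𝓕 : List (Subset n)) (𝓕! : Unique 𝓕) (inWindow : ∀ {F} → F ∈ 𝓕 → InWindow n F)
              (gapped : IsGapped ℓ 𝓕)
              (big : (e * k₁ + 1) * (n C (n / 2)) + n C (n / 2) ≤ length 𝓕 * e) where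

  private
    m = suc m′
    c = 3 ^ ℓ * ℓ !

    instance
      K≢0 : NonZero K
      K≢0 = >-nonZero (≤-trans (s≤s z≤n) 3≤K)

      D≢0 : NonZero D
      D≢0 = >-nonZero 1≤D

    1≤n : 1 ≤ n
    1≤n = ≤-trans 1≤D D≤n

    w = n / K

    1≤w : 1 ≤ w
    1≤w = m≥n⇒m/n>0 {n} {K} K≤n

    Kw≤n : K * w ≤ n
    Kw≤n = ≤-trans (≤-reflexive (*-comm K w)) (m/n*n≤m n K)

    p = n ^ ℓ

    D≤p : D ≤ p
    D≤p = ≤-trans D≤n (≤-trans (≤-reflexive (sym (^-identityʳ n))) (^-monoʳ-≤ n {{>-nonZero 1≤n}} 1≤ℓ))

  b : ℕ
  b = p / D

  bD≤p : b * D ≤ p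
  bD≤p = m/n*n≤m p D

  private
    1≤b : 1 ≤ b
    1≤b = m≥n⇒m/n>0 {p} {D} D≤p

    -- Rounding `p / D` down loses at most a factor 2, which is where the `2 ^ m′` in `D-large′`
    -- comes from.
    p≤2bD : p ≤ 2 * (b * D)
    p≤2bD = begin
      p                    ≡⟨ m≡m%n+[m/n]*n p D ⟩
      p % D + b * D        ≤⟨ +-monoˡ-≤ (b * D) (<⇒≤ (m%n<n p D)) ⟩
      D + b * D            ≤⟨ +-monoˡ-≤ (b * D) (≤-trans (≤-reflexive (sym (*-identityˡ D))) (*-monoˡ-≤ D 1≤b)) ⟩
      b * D + b * D        ≡⟨ e₁ (b * D) ⟩
      2 * (b * D)          ∎
      where
      open ≤-Reasoning
      e₁ : ∀ x → x + x ≡ 2 * x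
      e₁ = solve-∀

    fewZ : 2 ^ m * (m * b) * (c * h * 4) ≤ p
    fewZ = begin
      2 ^ m * (m * b) * (c * h * 4)    ≡⟨ e₁ (2 ^ m) m b (c * h * 4) ⟩
      b * (2 ^ m * m * (c * h * 4))    ≤⟨ *-monoʳ-≤ b D-large ⟩
      b * D                            ≤⟨ bD≤p ⟩
      p                                ∎
      where
      open ≤-Reasoning
      e₁ : ∀ t m b x → t * (m * b) * x ≡ b * (t * m * x)
      e₁ = solve-∀

    Cₙ = n C (n / 2)

  goal : ℕ
  goal = n ^ (ℓ * m′) * Cₙ

  record Good (H : List (Fin m → Subset n)) : Set where
    field
      collection : IsCopyCollection _<P_ 𝓕 H
      bounded    : ∀ E → Unique E → 1 ≤ length E → deg H E ≤ b ^ (m ∸ length E)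

  module _ (H : List (Fin m → Subset n)) (good : Good H) (small : length H * D ^ m < goal) where

    open Good good
    open Saturation b 1≤b H

    private
      light? : ∀ G → Dec (deg H (G ∷ []) < b ^ m′)
      light? G = deg H (G ∷ []) <? b ^ m′

      𝓖 = filter light? 𝓕

      saturated = filter (¬? ∘ light?) 𝓕

      𝓖! : Unique 𝓖
      𝓖! = Uniqueₚ.filter⁺ light? 𝓕!

      𝓖⊆𝓕 : ∀ {F} → F ∈ 𝓖 → F ∈ 𝓕
      𝓖⊆𝓕 i = proj₁ (∈-filter⁻ light? i)

      saturated≤ : length saturated * b ^ m′ ≤ m * length H
      saturated≤ = ≤-trans (*-monoˡ-≤ (b ^ m′) (length-∈-mono
          (Uniqueₚ.filter⁺ (¬? ∘ light?) 𝓕!)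
          (λ {G} i → let G∈ , ¬l = ∈-filter⁻ (¬? ∘ light?) {xs = 𝓕} i in
            ∈-filter⁺ (λ G → b ^ m′ ≤? deg H (G ∷ [])) G∈ (≮⇒≥ ¬l))))
        (≤-trans (length-heavy 𝓕 𝓕! (b ^ m′) []) (≤-reflexive (cong (m *_) deg-[])))

      -- With `s` saturated sets, `s * b ^ m′` is at most `m` times the size of `H`, and `H` is
      -- still below its goal. Writing `n ^ ℓ ≤ 2 * (b * D)` cancels `b ^ m′`, and one factor `D` is
      -- left over to absorb `e * (m * 2 ^ m′)`.
      few-saturated : length saturated * e ≤ Cₙ
      few-saturated = *-cancelʳ-≤ _ Cₙ (m * 2 ^ m′) {{m*n≢0 m (2 ^ m′) {{_}} {{m^n≢0 2 m′}}}} (*-cancelʳ-≤ _ _ (b ^ m′ * D ^ m′)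
        {{m*n≢0 (b ^ m′) (D ^ m′) {{m^n≢0 b m′ {{>-nonZero 1≤b}}}} {{m^n≢0 D m′}}}} (begin
          s * e * (m * 2 ^ m′) * (b ^ m′ * D ^ m′)     ≤⟨ *-monoˡ-≤ (b ^ m′ * D ^ m′) (≤-trans (≤-reflexive (*-assoc s e (m * 2 ^ m′)))
                                                            (*-monoʳ-≤ s D-large′)) ⟩
          s * D * (b ^ m′ * D ^ m′)                    ≡⟨ e₁ s D (b ^ m′) (D ^ m′) ⟩
          s * b ^ m′ * D ^ m                           ≤⟨ *-monoˡ-≤ (D ^ m) saturated≤ ⟩
          m * length H * D ^ m                         ≡⟨ *-assoc m (length H) (D ^ m) ⟩
          m * (length H * D ^ m)                       ≤⟨ *-monoʳ-≤ m (<⇒≤ small) ⟩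
          m * (n ^ (ℓ * m′) * Cₙ)                      ≡⟨ cong (λ x → m * (x * Cₙ)) (^-*-assoc n ℓ m′) ⟨
          m * (p ^ m′ * Cₙ)                            ≤⟨ *-monoʳ-≤ m (*-monoˡ-≤ Cₙ (^-monoˡ-≤ m′ p≤2bD)) ⟩
          m * ((2 * (b * D)) ^ m′ * Cₙ)                ≡⟨ cong (λ x → m * (x * Cₙ)) (trans (^-distribʳ-* m′ 2 (b * D)) (cong (2 ^ m′ *_) (^-distribʳ-* m′ b D))) ⟩
          m * (2 ^ m′ * (b ^ m′ * D ^ m′) * Cₙ)        ≡⟨ e₂ m (2 ^ m′) (b ^ m′ * D ^ m′) Cₙ ⟩
          Cₙ * (m * 2 ^ m′) * (b ^ m′ * D ^ m′)        ∎))
        where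
        open ≤-Reasoning
        s = length saturated
        e₁ : ∀ s d x y → s * d * (x * y) ≡ s * x * (d * y)
        e₁ = solve-∀
        e₂ : ∀ m t x c → m * (t * x * c) ≡ c * (m * t) * x
        e₂ = solve-∀

      -- The extra `Cₙ` in `big` is the reserve that pays for deleting the saturated sets.
      big-𝓖 : (e * k₁ + 1) * Cₙ ≤ length 𝓖 * e
      big-𝓖 = +-cancelʳ-≤ Cₙ _ _ (begin
        (e * k₁ + 1) * Cₙ + Cₙ                        ≤⟨ big ⟩
        length 𝓕 * e                                  ≡⟨ cong (_* e) (length-filter-not light? 𝓕) ⟨
        (length 𝓖 + length saturated) * e             ≡⟨ *-distribʳ-+ e (length 𝓖) (length saturated) ⟩
        length 𝓖 * e + length saturated * e           ≤⟨ +-monoʳ-≤ (length 𝓖 * e) few-saturated ⟩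
        length 𝓖 * e + Cₙ                             ∎)
        where
        open ≤-Reasoning

      mid : ∀ {F} → F ∈ 𝓖 → Events.Mid n w K 1≤w 3≤K Kw≤n F
      mid {F} F∈ = window-mid K n F (window-narrow K n (≤-trans (s≤s z≤n) 3≤K)
        (≤-trans (≤-reflexive (*-comm 2304 (K * K * (K * K)))) n-large) F (inWindow (𝓖⊆𝓕 F∈)))

      separated : ∀ {F G} → F ∈ 𝓖 → G ∈ 𝓖 → F ⊂ G → ∣ F ∣ + ℓ ≤ ∣ G ∣
      separated {F} {G} F∈ G∈ F⊂G = ≤-trans (+-monoʳ-≤ ∣ F ∣ (gapped (𝓖⊆𝓕 F∈) (𝓖⊆𝓕 G∈) F⊂G))
        (≤-reflexive (∣─∣ F G (p⊂q⇒p⊆q F⊂G)))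

      rotate : ∀ h m → 24 * h * m ≡ h * m * 24
      rotate = solve-∀

      new-copy = Robust.Embedding.free-copy w K 1≤w 3≤K Kw≤n k₁ e 𝓖 𝓖! big-𝓖 mid ℓ separated h h-large
        _<P_ isSPO isTree height b 1≤b H (λ G∈ → proj₂ (∈-filter⁻ light? {xs = 𝓕} G∈)) fewZ (≤-trans (≤-reflexive (rotate h m)) K-large)

    enlarge : ∃[ φ ] Good (φ ∷ H)
    enlarge = let φ , (injective , φ∈ , order) , free = new-copy in φ , record
      { collection = (injective , (λ x → 𝓖⊆𝓕 (φ∈ x)) , order) ∷ proj₁ collection
                   , All.tabulate (λ {ψ} ψ∈ same → distinct φ (λ {x} {y} → injective {x} {y}) free ψ∈ same) ∷ proj₂ collection
      ; bounded    = bounded′ φ free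
      }
      where
      Avoids : (Fin m → Subset n) → Set
      Avoids φ = ∀ E → Unique E → 1 ≤ length E → (∀ {s} → s ∈ E → s ∈ image φ) → deg H E < b ^ (m ∸ length E)
      -- The whole image is unsaturated, so its degree is below `b ^ 0 ≡ 1`: no earlier copy
      -- contains it.
      distinct : ∀ φ → (∀ {x y} → φ x ≡ φ y → x ≡ y) → Avoids φ → ∀ {ψ} → ψ ∈ H → ¬ SameCopy φ ψ
      distinct φ injective free {ψ} ψ∈ same = <⇒≱ (subst (deg H (image φ) <_) one lt) (begin
        1                                            ≡⟨ ⟦⟧-yes (image φ ⊆image? ψ) (All.tabulate λ {s} i → Equivalence.to (same s) i) ⟨
        ⟦ image φ ⊆image? ψ ⟧                        ≤⟨ ∑-∈ (λ ψ → ⟦ image φ ⊆image? ψ ⟧) ψ∈ ⟩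
        ∑ H (λ ψ → ⟦ image φ ⊆image? ψ ⟧)            ≡⟨ deg≡∑ H (image φ) ⟨
        deg H (image φ)                              ∎)
        where
        open ≤-Reasoning
        len : length (image φ) ≡ m
        len = length-tabulate φ
        lt = free (image φ) (Uniqueₚ.tabulate⁺ injective)
               (≤-trans (s≤s z≤n) (≤-reflexive (sym len))) (λ i → i)
        one : b ^ (m ∸ length (image φ)) ≡ 1
        one = cong (b ^_) (trans (cong (m ∸_) len) (n∸n≡0 m))
      bounded′ : ∀ φ → Avoids φ → ∀ E → Unique E → 1 ≤ length E → deg (φ ∷ H) E ≤ b ^ (m ∸ length E)
      bounded′ φ free E E! 1≤E = ≤-trans (≤-reflexive (trans (deg≡∑ (φ ∷ H) E) (cong (⟦ E ⊆image? φ ⟧ +_) (sym (deg≡∑ H E)))))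
        (go (E ⊆image? φ))
        where
        go : (d : Dec (All (_∈ image φ) E)) → ⟦ d ⟧ + deg H E ≤ b ^ (m ∸ length E)
        go (yes sub) = free E E! 1≤E (All.lookup sub)
        go (no _)    = bounded E E! 1≤E

  good-[] : Good []
  good-[] = record { collection = [] , [] ; bounded = λ _ _ _ → z≤n }

  -- The number of rounds bounds the recursion; `goal` rounds suffice because `D ^ m` is at least 1.
  build-up : ∀ t → ∃[ H ] (Good H × (t ≤ length H ⊎ goal ≤ length H * D ^ m))
  build-up zero = [] , good-[] , inj₁ z≤n
  build-up (suc t) with build-up t
  ... | H , good , inj₂ done = H , good , inj₂ done
  ... | H , good , inj₁ t≤ with length H * D ^ m <? goal
  ...   | no ¬small = H , good , inj₂ (≮⇒≥ ¬small)
  ...   | yes small = let φ , good′ = enlarge H good small in φ ∷ H , good′ , inj₁ (s≤s t≤)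

  balanced-collection : ∃[ H ] (Good H × goal ≤ length H * D ^ m)
  balanced-collection with build-up goal
  ... | H , good , inj₂ done = H , good , done
  ... | H , good , inj₁ many = H , good , ≤-trans many (m≤m*n (length H) (D ^ m) {{m^n≢0 D m}})

-- Passing to rational constants

private
  toℚᵘ-ℕ→ℚ : ∀ a → ℚ.toℚᵘ (ℕ→ℚ a) ≡ mkℚᵘ (ℤ.+ a) 0
  toℚᵘ-ℕ→ℚ a = cong ℚ.toℚᵘ (ℚₚ.fromℚᵘ-toℚᵘ (ℚ.mkℚ (ℤ.+ a) 0 (Coprimality.sym (Coprimality.1-coprimeTo a))))

ℕ→ℚ-mono : ∀ {a b} → a ≤ b → ℕ→ℚ a ℚ.≤ ℕ→ℚ b
ℕ→ℚ-mono {a} {b} a≤b = ℚₚ.toℚᵘ-cancel-≤ (subst₂ ℚᵘ._≤_ (sym (toℚᵘ-ℕ→ℚ a)) (sym (toℚᵘ-ℕ→ℚ b))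
  (ℚᵘ.*≤* (ℤₚ.*-monoʳ-≤-nonNeg (ℤ.+ 1) (ℤ.+≤+ a≤b))))

ℕ→ℚ-cancel-≤ : ∀ {a b} → ℕ→ℚ a ℚ.≤ ℕ→ℚ b → a ≤ b
ℕ→ℚ-cancel-≤ {a} {b} le with subst₂ ℚᵘ._≤_ (toℚᵘ-ℕ→ℚ a) (toℚᵘ-ℕ→ℚ b) (ℚₚ.toℚᵘ-mono-≤ le)
... | ℚᵘ.*≤* le′ = ℤₚ.drop‿+≤+ (subst₂ ℤ._≤_ (ℤₚ.*-identityʳ (ℤ.+ a)) (ℤₚ.*-identityʳ (ℤ.+ b)) le′)

ℕ→ℚ-* : ∀ a b → ℕ→ℚ (a * b) ≡ ℕ→ℚ a ℚ.* ℕ→ℚ b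
ℕ→ℚ-* a b = ℚₚ.toℚᵘ-injective (ℚᵘₚ.≃-trans (ℚᵘₚ.≃-reflexive (toℚᵘ-ℕ→ℚ (a * b)))
  (ℚᵘₚ.≃-trans (ℚᵘₚ.≃-reflexive (cong (λ z → mkℚᵘ z 0) (ℤₚ.pos-* a b)))
  (ℚᵘₚ.≃-sym (ℚᵘₚ.≃-trans (ℚₚ.toℚᵘ-homo-* (ℕ→ℚ a) (ℕ→ℚ b))
    (ℚᵘₚ.≃-reflexive (cong₂ ℚᵘ._*_ (toℚᵘ-ℕ→ℚ a) (toℚᵘ-ℕ→ℚ b)))))))

ℕ→ℚ-+ : ∀ a b → ℕ→ℚ (a + b) ≡ ℕ→ℚ a ℚ.+ ℕ→ℚ b
ℕ→ℚ-+ a b = ℚₚ.toℚᵘ-injective (ℚᵘₚ.≃-trans (ℚᵘₚ.≃-reflexive (toℚᵘ-ℕ→ℚ (a + b)))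
  (ℚᵘₚ.≃-trans (ℚᵘₚ.≃-reflexive (cong (λ z → mkℚᵘ z 0)
      (trans (ℤₚ.pos-+ a b) (sym (cong₂ ℤ._+_ (ℤₚ.*-identityʳ (ℤ.+ a)) (ℤₚ.*-identityʳ (ℤ.+ b)))))))
  (ℚᵘₚ.≃-sym (ℚᵘₚ.≃-trans (ℚₚ.toℚᵘ-homo-+ (ℕ→ℚ a) (ℕ→ℚ b))
    (ℚᵘₚ.≃-reflexive (cong₂ ℚᵘ._+_ (toℚᵘ-ℕ→ℚ a) (toℚᵘ-ℕ→ℚ b)))))))

ℕ→ℚ-nonNeg : ∀ a → ℚ.NonNegative (ℕ→ℚ a)
ℕ→ℚ-nonNeg a = ℚ.nonNegative (ℕ→ℚ-mono {0} {a} z≤n)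

ℕ→ℚ-^ : ∀ a t → ℕ→ℚ (a ^ t) ≡ ℕ→ℚ a ^ℚ t
ℕ→ℚ-^ a zero    = refl
ℕ→ℚ-^ a (suc t) = trans (ℕ→ℚ-* a (a ^ t)) (cong (ℕ→ℚ a ℚ.*_) (ℕ→ℚ-^ a t))

^ℚ-distrib-* : ∀ x y t → (x ℚ.* y) ^ℚ t ≡ x ^ℚ t ℚ.* y ^ℚ t
^ℚ-distrib-* x y zero    = refl
^ℚ-distrib-* x y (suc t) = trans (cong ((x ℚ.* y) ℚ.*_) (^ℚ-distrib-* x y t)) (interchange x y (x ^ℚ t) (y ^ℚ t))
  where
  interchange : ∀ a b c d → (a ℚ.* b) ℚ.* (c ℚ.* d) ≡ (a ℚ.* c) ℚ.* (b ℚ.* d)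
  interchange a b c d = begin
    (a ℚ.* b) ℚ.* (c ℚ.* d)    ≡⟨ ℚₚ.*-assoc a b (c ℚ.* d) ⟩
    a ℚ.* (b ℚ.* (c ℚ.* d))    ≡⟨ cong (a ℚ.*_) (trans (sym (ℚₚ.*-assoc b c d)) (trans (cong (ℚ._* d) (ℚₚ.*-comm b c)) (ℚₚ.*-assoc c b d))) ⟩
    a ℚ.* (c ℚ.* (b ℚ.* d))    ≡⟨ ℚₚ.*-assoc a c (b ℚ.* d) ⟨
    (a ℚ.* c) ℚ.* (b ℚ.* d)    ∎
    where open ≡-Reasoning

1^ℚ : ∀ t → ℚ.1ℚ ^ℚ t ≡ ℚ.1ℚ
1^ℚ zero    = refl
1^ℚ (suc t) = trans (ℚₚ.*-identityˡ _) (1^ℚ t)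

^ℚ-nonNeg : ∀ x t .{{_ : ℚ.NonNegative x}} → ℚ.NonNegative (x ^ℚ t)
^ℚ-nonNeg x zero    = _
^ℚ-nonNeg x (suc t) = ℚₚ.nonNeg*nonNeg⇒nonNeg x (x ^ℚ t) {{^ℚ-nonNeg x t}}

^ℚ-mono : ∀ {x y} t .{{_ : ℚ.NonNegative x}} → x ℚ.≤ y → x ^ℚ t ℚ.≤ y ^ℚ t
^ℚ-mono         zero    x≤y = ℚₚ.≤-refl
^ℚ-mono {x} {y} (suc t) x≤y = ℚₚ.≤-trans (ℚₚ.*-monoʳ-≤-nonNeg (x ^ℚ t) {{^ℚ-nonNeg x t}} x≤y)
  (ℚₚ.*-monoˡ-≤-nonNeg y {{ℚ.nonNegative (ℚₚ.≤-trans (ℚₚ.nonNegative⁻¹ x) x≤y)}} (^ℚ-mono t x≤y))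

module Reciprocal (D : ℕ) .{{_ : NonZero D}} where

  δ : ℚ
  δ = ℤ.+ 1 ℚ./ D

  δ>0 : ℚ.0ℚ ℚ.< δ
  δ>0 = ℚₚ.positive⁻¹ δ {{ℚₚ.normalize-pos 1 D}}

  private
    instance
      δ-nonNeg : ℚ.NonNegative δ
      δ-nonNeg = ℚ.nonNegative (ℚₚ.<⇒≤ δ>0)

  δD≡1 : δ ℚ.* ℕ→ℚ D ≡ ℚ.1ℚ
  δD≡1 = go D
    where
    go : ∀ D .{{_ : NonZero D}} → (ℤ.+ 1 ℚ./ D) ℚ.* ℕ→ℚ D ≡ ℚ.1ℚ
    go (suc d) = ℚₚ.toℚᵘ-injective (ℚᵘₚ.≃-trans (ℚₚ.toℚᵘ-homo-* (ℤ.+ 1 ℚ./ suc d) (ℕ→ℚ (suc d)))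
      (ℚᵘₚ.≃-trans (ℚᵘₚ.*-cong (ℚₚ.toℚᵘ-fromℚᵘ (mkℚᵘ (ℤ.+ 1) d)) (ℚᵘₚ.≃-reflexive (toℚᵘ-ℕ→ℚ (suc d))))
        (ℚᵘ.*≡* (trans (ℤₚ.*-identityʳ (ℤ.+ 1 ℤ.* ℤ.+ suc d)) (cong (λ x → ℤ.+ 1 ℤ.* ℤ.+ x) (sym (*-identityʳ (suc d))))))))

  reciprocal-power : ∀ {a b} t → a ≤ b * D ^ t → δ ^ℚ t ℚ.* ℕ→ℚ a ℚ.≤ ℕ→ℚ b
  reciprocal-power {a} {b} t le = ℚₚ.≤-trans
    (ℚₚ.*-monoˡ-≤-nonNeg (δ ^ℚ t) {{^ℚ-nonNeg δ t}} (ℕ→ℚ-mono le))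
    (ℚₚ.≤-reflexive (begin
      δ ^ℚ t ℚ.* ℕ→ℚ (b * D ^ t)              ≡⟨ cong (δ ^ℚ t ℚ.*_) (trans (ℕ→ℚ-* b (D ^ t)) (ℚₚ.*-comm (ℕ→ℚ b) _)) ⟩
      δ ^ℚ t ℚ.* (ℕ→ℚ (D ^ t) ℚ.* ℕ→ℚ b)      ≡⟨ ℚₚ.*-assoc (δ ^ℚ t) _ (ℕ→ℚ b) ⟨
      δ ^ℚ t ℚ.* ℕ→ℚ (D ^ t) ℚ.* ℕ→ℚ b        ≡⟨ cong (λ x → δ ^ℚ t ℚ.* x ℚ.* ℕ→ℚ b) (ℕ→ℚ-^ D t) ⟩
      δ ^ℚ t ℚ.* ℕ→ℚ D ^ℚ t ℚ.* ℕ→ℚ b         ≡⟨ cong (ℚ._* ℕ→ℚ b) (^ℚ-distrib-* δ (ℕ→ℚ D) t) ⟨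
      (δ ℚ.* ℕ→ℚ D) ^ℚ t ℚ.* ℕ→ℚ b            ≡⟨ cong (λ x → x ^ℚ t ℚ.* ℕ→ℚ b) δD≡1 ⟩
      ℚ.1ℚ ^ℚ t ℚ.* ℕ→ℚ b                     ≡⟨ cong (ℚ._* ℕ→ℚ b) (1^ℚ t) ⟩
      ℚ.1ℚ ℚ.* ℕ→ℚ b                          ≡⟨ ℚₚ.*-identityˡ (ℕ→ℚ b) ⟩
      ℕ→ℚ b                                   ∎))
    where open ≡-Reasoning

  power-below : ∀ {a b p} t → a ≤ b ^ t → b * D ≤ p → ℕ→ℚ a ℚ.≤ (δ ℚ.* ℕ→ℚ p) ^ℚ t
  power-below {a} {b} {p} t a≤ bD≤p = ℚₚ.≤-trans (ℕ→ℚ-mono a≤) (ℚₚ.≤-trans (ℚₚ.≤-reflexive (ℕ→ℚ-^ b t))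
    (^ℚ-mono {ℕ→ℚ b} t {{ℕ→ℚ-nonNeg b}} (ℚₚ.≤-trans (ℚₚ.≤-reflexive (begin
      ℕ→ℚ b                          ≡⟨ ℚₚ.*-identityˡ (ℕ→ℚ b) ⟨
      ℚ.1ℚ ℚ.* ℕ→ℚ b                 ≡⟨ cong (ℚ._* ℕ→ℚ b) δD≡1 ⟨
      δ ℚ.* ℕ→ℚ D ℚ.* ℕ→ℚ b          ≡⟨ ℚₚ.*-assoc δ (ℕ→ℚ D) (ℕ→ℚ b) ⟩
      δ ℚ.* (ℕ→ℚ D ℚ.* ℕ→ℚ b)        ≡⟨ cong (δ ℚ.*_) (trans (ℚₚ.*-comm (ℕ→ℚ D) (ℕ→ℚ b)) (sym (ℕ→ℚ-* b D))) ⟩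
      δ ℚ.* ℕ→ℚ (b * D)              ∎))
      (ℚₚ.*-monoˡ-≤-nonNeg δ (ℕ→ℚ-mono bD≤p)))))
    where open ≡-Reasoning

1/denominator≤ : ∀ ε → ℚ.0ℚ ℚ.< ε → Reciprocal.δ (suc (ℚ.denominator-1 ε)) ℚ.≤ ε
1/denominator≤ (ℚ.mkℚ (ℤ.+[1+ a ]) d _) _ = ℚₚ.toℚᵘ-cancel-≤ (ℚᵘₚ.≤-respˡ-≃ (ℚᵘₚ.≃-sym (ℚₚ.toℚᵘ-fromℚᵘ (mkℚᵘ (ℤ.+ 1) d)))
  (ℚᵘ.*≤* (ℤₚ.*-monoʳ-≤-nonNeg (ℤ.+ suc d) {ℤ.+ 1} {ℤ.+[1+ a ]} (ℤ.+≤+ (s≤s z≤n)))))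
1/denominator≤ (ℚ.mkℚ (ℤ.+ zero) d _) (ℚ.*<* lt) = contradiction lt (ℤₚ.<-irrefl refl)
1/denominator≤ (ℚ.mkℚ ℤ.-[1+ a ] d _) (ℚ.*<* ())

-- A positive rational is at least one over its denominator `e`, so ε may be replaced by `1/e`.
clear-denominator : ∀ ε → ℚ.0ℚ ℚ.< ε → let e = suc (ℚ.denominator-1 ε) in
  ∀ k₁ c f → (ℕ→ℚ k₁ ℚ.+ ε) ℚ.* ℕ→ℚ c ℚ.≤ ℕ→ℚ f → (e * k₁ + 1) * c ≤ f * e
clear-denominator ε ε>0 k₁ c f le = ℕ→ℚ-cancel-≤ (begin
  ℕ→ℚ ((e * k₁ + 1) * c)                              ≡⟨ expand k₁ c ⟩
  (ℕ→ℚ k₁ ℚ.* ℕ→ℚ c ℚ.+ ℚ.1ℚ ℚ.* ℕ→ℚ c ℚ.* δ) ℚ.* ℕ→ℚ e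
    ≤⟨ ℚₚ.*-monoʳ-≤-nonNeg (ℕ→ℚ e) {{ℕ→ℚ-nonNeg e}} (ℚₚ.+-monoʳ-≤ (ℕ→ℚ k₁ ℚ.* ℕ→ℚ c) (ℚₚ.≤-trans
         (ℚₚ.≤-reflexive (trans (cong (ℚ._* δ) (ℚₚ.*-identityˡ (ℕ→ℚ c))) (ℚₚ.*-comm (ℕ→ℚ c) δ)))
         (ℚₚ.*-monoʳ-≤-nonNeg (ℕ→ℚ c) {{ℕ→ℚ-nonNeg c}} δ≤ε))) ⟩
  (ℕ→ℚ k₁ ℚ.* ℕ→ℚ c ℚ.+ ε ℚ.* ℕ→ℚ c) ℚ.* ℕ→ℚ e        ≡⟨ cong (ℚ._* ℕ→ℚ e) (ℚₚ.*-distribʳ-+ (ℕ→ℚ c) (ℕ→ℚ k₁) ε) ⟨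
  (ℕ→ℚ k₁ ℚ.+ ε) ℚ.* ℕ→ℚ c ℚ.* ℕ→ℚ e                  ≤⟨ ℚₚ.*-monoʳ-≤-nonNeg (ℕ→ℚ e) {{ℕ→ℚ-nonNeg e}} le ⟩
  ℕ→ℚ f ℚ.* ℕ→ℚ e                                     ≡⟨ ℕ→ℚ-* f e ⟨
  ℕ→ℚ (f * e)                                         ∎)
  where
  open ℚₚ.≤-Reasoning
  e : ℕ
  e = suc (ℚ.denominator-1 ε)
  open Reciprocal e
  δ≤ε : δ ℚ.≤ ε
  δ≤ε = 1/denominator≤ ε ε>0
  expand : ∀ k₁ c → ℕ→ℚ ((e * k₁ + 1) * c) ≡ (ℕ→ℚ k₁ ℚ.* ℕ→ℚ c ℚ.+ ℚ.1ℚ ℚ.* ℕ→ℚ c ℚ.* δ) ℚ.* ℕ→ℚ e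
  expand k₁ c = begin-equality
    ℕ→ℚ ((e * k₁ + 1) * c)                     ≡⟨ cong ℕ→ℚ (shape e k₁ c) ⟩
    ℕ→ℚ (k₁ * c * e + 1 * c)                   ≡⟨ ℕ→ℚ-+ (k₁ * c * e) (1 * c) ⟩
    ℕ→ℚ (k₁ * c * e) ℚ.+ ℕ→ℚ (1 * c)           ≡⟨ cong₂ ℚ._+_ (trans (ℕ→ℚ-* (k₁ * c) e) (cong (ℚ._* ℕ→ℚ e) (ℕ→ℚ-* k₁ c)))
                                                     (trans (ℕ→ℚ-* 1 c) (sym (trans (ℚₚ.*-assoc (ℚ.1ℚ ℚ.* ℕ→ℚ c) δ (ℕ→ℚ e))
                                                       (trans (cong ((ℚ.1ℚ ℚ.* ℕ→ℚ c) ℚ.*_) δD≡1) (ℚₚ.*-identityʳ _))))) ⟩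
    ℕ→ℚ k₁ ℚ.* ℕ→ℚ c ℚ.* ℕ→ℚ e ℚ.+ ℚ.1ℚ ℚ.* ℕ→ℚ c ℚ.* δ ℚ.* ℕ→ℚ e
      ≡⟨ ℚₚ.*-distribʳ-+ (ℕ→ℚ e) (ℕ→ℚ k₁ ℚ.* ℕ→ℚ c) (ℚ.1ℚ ℚ.* ℕ→ℚ c ℚ.* δ) ⟨
    (ℕ→ℚ k₁ ℚ.* ℕ→ℚ c ℚ.+ ℚ.1ℚ ℚ.* ℕ→ℚ c ℚ.* δ) ℚ.* ℕ→ℚ e ∎
    where
    shape : ∀ e k c → (e * k + 1) * c ≡ k * c * e + 1 * c
    shape = solve-∀

abstract
  clear-ε : ∀ ε → ℚ.0ℚ ℚ.< ε →
    ∃[ e ] (∀ k₁ c f → (ℕ→ℚ k₁ ℚ.+ ε) ℚ.* ℕ→ℚ c ℚ.≤ ℕ→ℚ f → (e * k₁ + 1) * c ≤ f * e)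
  clear-ε ε ε>0 = suc (ℚ.denominator-1 ε) , clear-denominator ε ε>0

  constants : ∀ m′ k₁ e ℓ → ∃[ h ] ∃[ K ] ∃[ D ] (suc k₁ * (e * k₁ + 1) < h × 3 ≤ K × h * suc m′ * 24 ≤ K
              × 1 ≤ D × 2 ^ suc m′ * suc m′ * (3 ^ ℓ * ℓ ! * h * 4) ≤ D × e * (suc m′ * 2 ^ m′) ≤ D)
  constants m′ k₁ e ℓ = h , K , suc (x + y) , ≤-refl , m≤n+m 3 (h * suc m′ * 24) , m≤m+n (h * suc m′ * 24) 3
                      , s≤s z≤n , m≤n⇒m≤1+n (m≤m+n x y) , m≤n⇒m≤1+n (m≤n+m y x)
    where
    h K x y : ℕ
    h = suc (suc k₁ * (e * k₁ + 1))
    K = h * suc m′ * 24 + 3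
    x = 2 ^ suc m′ * suc m′ * (3 ^ ℓ * ℓ ! * h * 4)
    y = e * (suc m′ * 2 ^ m′)

private
  first≤ : ∀ {n} x y z → x + y + z ≤ n → x ≤ n
  first≤ x y z = ≤-trans (≤-trans (m≤m+n x y) (m≤m+n (x + y) z))

  middle≤ : ∀ {n} x y z → x + y + z ≤ n → y ≤ n
  middle≤ x y z = ≤-trans (≤-trans (m≤n+m y x) (m≤m+n (x + y) z))

  last≤ : ∀ {n} x z → x + z ≤ n → z ≤ n
  last≤ x z = ≤-trans (m≤n+m z x)

  -- Splits the surplus `1/e` in halves: one remains as the density excess, the other becomes the
  -- reserve `c`.
  double-size : ∀ e k₁ c f → (e * k₁ + 1) * c ≤ f * e → (2 * e * k₁ + 1) * c + c ≤ f * (2 * e)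
  double-size e k₁ c f le = begin
    (2 * e * k₁ + 1) * c + c      ≡⟨ e₁ e k₁ c ⟩
    2 * ((e * k₁ + 1) * c)        ≤⟨ *-monoʳ-≤ 2 le ⟩
    2 * (f * e)                   ≡⟨ e₂ f e ⟩
    f * (2 * e)                   ∎
    where
    open ≤-Reasoning
    e₁ : ∀ a k c → (2 * a * k + 1) * c + c ≡ 2 * ((a * k + 1) * c)
    e₁ = solve-∀
    e₂ : ∀ a b → 2 * (a * b) ≡ a * (2 * b)
    e₂ = solve-∀

theorem5p5 : (m : ℕ) (_<P_ : Fin m → Fin m → Set) → IsStrictPartialOrder _≡_ _<P_ →
    IsTreePoset _<P_ → (k : ℕ) → HasHeight _<P_ k →
    (ε : ℚ) → ℚ.0ℚ ℚ.< ε → (ℓ : ℕ) → 1 ≤ ℓ →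
    ∃[ δ ] (ℚ.0ℚ ℚ.< δ × ∃[ n₀ ] (∀ (n : ℕ) → n₀ ≤ n →
    ∀ (𝓕 : List (Subset n)) → Unique 𝓕 →
    (∀ {F} → F ∈ 𝓕 → InWindow n F) →
    IsGapped ℓ 𝓕 →
    ℚ._≤_ ((ℕ→ℚ (k ∸ 1) ℚ.+ ε) ℚ.* ℕ→ℚ (n C (n / 2))) (ℕ→ℚ (length 𝓕)) →
    ∃[ 𝓗 ] (IsCopyCollection _<P_ 𝓕 𝓗
    × ℚ._≤_ ((δ ^ℚ m) ℚ.* ℕ→ℚ ((n Data.Nat.^ (ℓ Data.Nat.* (m ∸ 1))) Data.Nat.* (n C (n / 2))))
    (ℕ→ℚ (length 𝓗))
    × (∀ (j : ℕ) → 1 ≤ j → j ≤ m →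
    ∀ (𝓓 : List (Subset n)) → Unique 𝓓 → length 𝓓 ≡ j → All (_∈ 𝓕) 𝓓 →
    ℚ._≤_ (ℕ→ℚ (deg 𝓗 𝓓)) ((δ ℚ.* ℕ→ℚ (n Data.Nat.^ ℓ)) ^ℚ (m ∸ j))))))
theorem5p5 zero _<P_ isSPO (() , _) k height ε ε>0 ℓ 1≤ℓ
theorem5p5 (suc m′) _<P_ isSPO isTree zero height ε ε>0 ℓ 1≤ℓ =
  contradiction (TreePoset.1≤height _<P_ isSPO isTree height) λ ()
theorem5p5 (suc m′) _<P_ isSPO isTree (suc k₁) height ε ε>0 ℓ 1≤ℓ =
  let e′ , dense = clear-ε ε ε>0
      h , K , D , h-large , 3≤K , K-large , 1≤D , D-large , D-large′ = constants m′ k₁ (2 * e′) ℓ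
      window = K * K * (K * K) * 2304
      open Reciprocal D {{>-nonZero 1≤D}}
  -- δ is `1/D`. The three lower bounds on `n` make the window narrow, `n / K` positive and `b`
  -- positive.
  in δ , δ>0 , window + K + D , λ n n₀≤n 𝓕 𝓕! inWindow gapped size →
    let open Greedy m′ k₁ (2 * e′) ℓ 1≤ℓ _<P_ isSPO isTree height h h-large K 3≤K K-large D 1≤D D-large D-large′
               n (middle≤ window K D n₀≤n) (last≤ (window + K) D n₀≤n) (first≤ window K D n₀≤n)
               𝓕 𝓕! inWindow gapped (double-size e′ k₁ (n C (n / 2)) (length 𝓕) (dense k₁ (n C (n / 2)) (length 𝓕) size))
        H , good , enough = balanced-collection
    in H , Good.collection good , reciprocal-power {goal} {length H} (suc m′) enough
       , λ { _ 1≤j _ E E! refl _ → power-below {deg H E} {b} {n ^ ℓ} (suc m′ ∸ length E) (Good.bounded good E E! 1≤j) bD≤p }
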